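{- There is a deterministic algorithm which, given two finite $p$-groups $G$ and $H$ ($p$ prime) of order $n$, specified by their multiplication tables, decides whether $G \cong H$ in time $$n^{\min\{(1/2)\log_p n + O(p),\ \log_p n + O(1)\}}.$$ In particular, $n^{(1/2)\log_p n + O(\log n/\log\log n)}$ and $n^{(1/2)\log n + O(1)}$ are upper bounds on the time complexity of $p$-group isomorphism.
   Context: A $p$-group is a group whose order is a power of the prime $p$. The $p$-group isomorphism problem: given two $p$-groups $G$ and $H$ with element set $[n]=\{1,\dots,n\}$ as $n \times n$ multiplication tables, decide whether $G \cong H$. All constants hidden in $O(\cdot)$ are absolute (independent of $n$, $p$, $G$, $H$). The unsubscripted $\log$ is the base-2 logarithm. -}

module Defs where

open import Algebra.Bundles.Raw using (RawGroup)
open import Algebra.Definitions.RawSemiring using () renaming (_^_ to pow)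
open import Algebra.Morphism.Structures using (module GroupMorphisms)
open import Algebra.Structures using (IsGroup)
open import Data.Bool using (Bool; if_then_else_)
open import Data.Fin using (Fin; toℕ)
open import Data.Integer using (+_; ∣_∣)
open import Data.List using (List; []; _∷_; _++_; allFin; cartesianProductWith)
open import Data.Nat using (ℕ; zero; suc; _+_; _∸_; _*_; _^_; _≤_; _≡ᵇ_)
open import Data.Nat.Logarithm using (⌊log₂_⌋)
open import Data.Nat.Primality using (Prime)
open import Data.Product using (∃; ∃-syntax; _×_; _,_)
open import Data.Rational.Unnormalised as ℚᵘ using (ℚᵘ; ↥_; ↧ₙ_; _≃_; NonNegative; Positive)
open import Data.Sum using (_⊎_; inj₁; inj₂)
open import Data.Vec using (Vec; lookup)
open import Data.Vec.Functional using (updateAt)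
open import Function using (const)
open import Level using (0ℓ)
open import Relation.Binary.PropositionalEquality using (_≡_)
open import Relation.Nullary.Reflects using (Reflects)

------------------------------------------------------------------------
-- Groups given by multiplication tables

record GroupTable (n : ℕ) : Set where
  infixl 7 _∙_
  infix 8 _⁻¹
  field
    _∙_     : Fin n → Fin n → Fin n
    ε       : Fin n
    _⁻¹     : Fin n → Fin n
    isGroup : IsGroup _≡_ _∙_ ε _⁻¹

  rawGroup : RawGroup 0ℓ 0ℓ
  rawGroup = record { _≈_ = _≡_ ; _∙_ = _∙_ ; ε = ε ; _⁻¹ = _⁻¹ }

_≅_ : ∀ {m n} → GroupTable m → GroupTable n → Set
G ≅ H = ∃[ f ] IsGroupIsomorphism f
  where open GroupMorphisms (GroupTable.rawGroup G) (GroupTable.rawGroup H)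

_isPowerOf_ : ℕ → ℕ → Set
n isPowerOf p = ∃[ k ] n ≡ p ^ k

------------------------------------------------------------------------
-- Random access machines with logarithmic cost
--
-- r is the number of registers and ℓ the number of program lines; both are
-- fixed by the program.  In addition there is an unbounded memory.  Each
-- non-halting instruction names the line(s) at which execution continues.

data Instr (r ℓ : ℕ) : Set where
  set   : (d : Fin r) (c : ℕ)      → Fin ℓ → Instr r ℓ   -- R[d] ← c
  move  : (d a : Fin r)            → Fin ℓ → Instr r ℓ   -- R[d] ← R[a]
  add   : (d a b : Fin r)          → Fin ℓ → Instr r ℓ   -- R[d] ← R[a] + R[b]
  sub   : (d a b : Fin r)          → Fin ℓ → Instr r ℓ   -- R[d] ← R[a] ∸ R[b]
  load  : (d a : Fin r)            → Fin ℓ → Instr r ℓ   -- R[d] ← M[R[a]]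
  store : (a b : Fin r)            → Fin ℓ → Instr r ℓ   -- M[R[a]] ← R[b]
  ifz   : (a : Fin r) (yes no : Fin ℓ)     → Instr r ℓ   -- branch on R[a] = 0
  halt  : Bool                             → Instr r ℓ

record Program : Set where
  field
    registers lines : ℕ
    code            : Vec (Instr registers lines) lines
    start           : Fin lines

record Config (r ℓ : ℕ) : Set where
  constructor ⟨_,_,_⟩
  field
    pc  : Fin ℓ
    reg : Fin r → ℕ
    mem : ℕ → ℕ

_[_≔_] : ∀ {r} → (Fin r → ℕ) → Fin r → ℕ → (Fin r → ℕ)
R [ d ≔ v ] = updateAt R d (const v)

write : (ℕ → ℕ) → ℕ → ℕ → (ℕ → ℕ)
write M a v x = if x ≡ᵇ a then v else M x

-- The number of binary digits of x (and 1 for x = 0).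
size : ℕ → ℕ
size x = suc ⌊log₂ x ⌋

module Execution (A : Program) where
  open Program A

  State : Set
  State = Config registers lines

  exec : Instr registers lines → State → State ⊎ Bool
  exec (set d c l)   ⟨ _ , R , M ⟩ = inj₁ ⟨ l , R [ d ≔ c ] , M ⟩
  exec (move d a l)  ⟨ _ , R , M ⟩ = inj₁ ⟨ l , R [ d ≔ R a ] , M ⟩
  exec (add d a b l) ⟨ _ , R , M ⟩ = inj₁ ⟨ l , R [ d ≔ R a + R b ] , M ⟩
  exec (sub d a b l) ⟨ _ , R , M ⟩ = inj₁ ⟨ l , R [ d ≔ R a ∸ R b ] , M ⟩
  exec (load d a l)  ⟨ _ , R , M ⟩ = inj₁ ⟨ l , R [ d ≔ M (R a) ] , M ⟩
  exec (store a b l) ⟨ _ , R , M ⟩ = inj₁ ⟨ l , R , write M (R a) (R b) ⟩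
  exec (ifz a y n)   ⟨ _ , R , M ⟩ = inj₁ ⟨ (if R a ≡ᵇ 0 then y else n) , R , M ⟩
  exec (halt b)      _             = inj₂ b

  -- The total length of the numbers (operands and addresses) handled.
  execCost : Instr registers lines → State → ℕ
  execCost (set d c l)   _             = size c
  execCost (move d a l)  ⟨ _ , R , M ⟩ = size (R a)
  execCost (add d a b l) ⟨ _ , R , M ⟩ = size (R a) + size (R b)
  execCost (sub d a b l) ⟨ _ , R , M ⟩ = size (R a) + size (R b)
  execCost (load d a l)  ⟨ _ , R , M ⟩ = size (R a) + size (M (R a))
  execCost (store a b l) ⟨ _ , R , M ⟩ = size (R a) + size (R b)
  execCost (ifz a y n)   ⟨ _ , R , M ⟩ = size (R a)
  execCost (halt b)      _             = 1

  step : State → State ⊎ Bool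
  step s = exec (lookup code (Config.pc s)) s

  cost : State → ℕ
  cost s = execCost (lookup code (Config.pc s)) s

  -- HaltsFrom s b t: started in s, the program halts with output b in time t.
  data HaltsFrom : State → Bool → ℕ → Set where
    done : ∀ {s b} → step s ≡ inj₂ b → HaltsFrom s b (cost s)
    more : ∀ {s s′ b t} → step s ≡ inj₁ s′ → HaltsFrom s′ b t →
           HaltsFrom s b (cost s + t)

fromList : List ℕ → ℕ → ℕ
fromList []       _       = 0
fromList (x ∷ _)  zero    = x
fromList (_ ∷ xs) (suc a) = fromList xs a

-- Row by row; the element i of Fin n is written as the number 1 + i of [n].
table : ∀ {n} → GroupTable n → List ℕ
table {n} G = cartesianProductWith (λ i j → suc (toℕ (i ∙ j))) (allFin n) (allFin n)
  where open GroupTable G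

-- A halts with output b in time t on the input n, table of G, table of H,
-- stored in memory from address 0 on; all other cells and all registers are 0.
Halts : Program → ∀ {n} → GroupTable n → GroupTable n → Bool → ℕ → Set
Halts A {n} G H b t = HaltsFrom ⟨ Program.start A , const 0 , fromList (n ∷ table G ++ table H) ⟩ b t
  where open Execution A

------------------------------------------------------------------------
-- Nonnegative real exponents
--
-- A real x ≥ 0 is presented by a set of nonnegative rationals ≤ x with
-- supremum x and a set of nonnegative rationals ≥ x with infimum x.  The sets
-- need not be closed under weakening, nor contain x itself when it is rational.

record ℝ≥0 : Set₁ where
  field
    lower upper : ℚᵘ → Set
open ℝ≥0 public

fromℚᵘ : ℚᵘ → ℝ≥0
fromℚᵘ p = record { lower = _≃ p ; upper = _≃ p }

fromℕ : ℕ → ℝ≥0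
fromℕ m = fromℚᵘ (+ m ℚᵘ./ 1)

½ : ℝ≥0
½ = fromℚᵘ ℚᵘ.½

infixl 6 _⊕_
infixl 7 _⊗_ _⊘_

_⊕_ : ℝ≥0 → ℝ≥0 → ℝ≥0
x ⊕ y = record
  { lower = λ q → ∃[ a ] ∃[ b ] lower x a × lower y b × q ≃ a ℚᵘ.+ b
  ; upper = λ q → ∃[ a ] ∃[ b ] upper x a × upper y b × q ≃ a ℚᵘ.+ b
  }

_⊗_ : ℝ≥0 → ℝ≥0 → ℝ≥0
x ⊗ y = record
  { lower = λ q → ∃[ a ] ∃[ b ] lower x a × lower y b × q ≃ a ℚᵘ.* b
  ; upper = λ q → ∃[ a ] ∃[ b ] upper x a × upper y b × q ≃ a ℚᵘ.* b
  }

-- The quotient x / y; only meaningful for y > 0.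
_⊘_ : ℝ≥0 → ℝ≥0 → ℝ≥0
x ⊘ y = record
  { lower = λ q → ∃[ a ] ∃[ b ] lower x a × upper y b × Positive b × q ℚᵘ.* b ≃ a
  ; upper = λ q → ∃[ a ] ∃[ b ] upper x a × lower y b × Positive b × q ℚᵘ.* b ≃ a
  }

min : ℝ≥0 → ℝ≥0 → ℝ≥0
min x y = record
  { lower = λ q → (lower x q × ∃[ b ] lower y b × q ℚᵘ.≤ b) ⊎ (lower y q × ∃[ a ] lower x a × q ℚᵘ.≤ a)
  ; upper = λ q → upper x q ⊎ upper y q
  }

_^ℚ_ : ℚᵘ → ℕ → ℚᵘ
_^ℚ_ = pow ℚᵘ.+-*-rawSemiring

-- The logarithm of y to base b; only meaningful for b ≥ 2 and y ≥ 1.  For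
-- q = c/d, q ≤ log_b y means b^c ≤ y^d, and q ≥ log_b y means y^d ≤ b^c.
log : ℕ → ℝ≥0 → ℝ≥0
log b y = record
  { lower = λ q → NonNegative q × ∃[ r ] lower y r × (+ (b ^ ∣ ↥ q ∣) ℚᵘ./ 1) ℚᵘ.≤ r ^ℚ (↧ₙ q)
  ; upper = λ q → NonNegative q × ∃[ r ] upper y r × r ^ℚ (↧ₙ q) ℚᵘ.≤ (+ (b ^ ∣ ↥ q ∣) ℚᵘ./ 1)
  }

-- t ≤ n ^ x, i.e. t ≤ n ^ (c/d) for all rational upper bounds c/d of x.
_≤_^ʳ_ : ℕ → ℕ → ℝ≥0 → Set
t ≤ n ^ʳ x = ∀ q → upper x q → t ^ ↧ₙ q ≤ n ^ ∣ ↥ q ∣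

------------------------------------------------------------------------
-- The p-group isomorphism problem

DecidesPGroupIso : Program → Set
DecidesPGroupIso A =
  ∀ p n → Prime p → n isPowerOf p → (G H : GroupTable n) →
  ∃[ b ] ∃[ t ] Halts A G H b t × Reflects (G ≅ H) b

-- On pairs of p-groups of order n ≥ n₀, A runs in time n ^ e p n.
RunsInTime : Program → (n₀ : ℕ) → (e : (p n : ℕ) → ℝ≥0) → Set
RunsInTime A n₀ e =
  ∀ p n → Prime p → n isPowerOf p → n₀ ≤ n → (G H : GroupTable n) →
  ∀ b t → Halts A G H b t → t ≤ n ^ʳ e p n

{-# OPTIONS --safe #-}
module Submission where

-- Collision detection between generating tuples.  Let n = p ^ k, F = ⌈k/2⌉ + 1 and L = 2F.  A tuple
-- (g₀, …, g_{L-1}) is coded by the canonical enumeration of the subgroup that it generates: starting from g₀,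
-- list the products x ∙ g_j in breadth-first order, and record the position of each x ∙ g_j in the list.  Two
-- generating tuples of G and H have the same code iff g_j ↦ h_j extends to an isomorphism.
--
-- For G, all n ^ F first halves are completed greedily (always adding the first element not yet generated) and
-- the codes of the generating tuples are marked in memory.  For H, the first half is chosen greedily, and all
-- n ^ F second halves are tried and looked up.  By Lagrange each greedy step multiplies the order by at least p,
-- so the greedy half h of H generates at least p ^ ⌈k/2⌉ elements; if φ : G ≅ H, the greedy completion of φ⁻¹(h)
-- therefore fits into the second half, and its image under φ is one of the tuples tried for H.  A code has
-- polynomially many bits, so addressing memory by it is cheap at logarithmic cost, and the total time
-- n ^ (F + O(1)) = n ^ (k/2 + O(1)) is within all the bounds, for every p.

open import Defs
open import Algebra.Bundles using (Group)
open import Algebra.Morphism.Structures using (module GroupMorphisms)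
import Algebra.Properties.Group as GroupProperties
open import Data.Bool using (Bool; true; false; not; _∧_; _∨_; if_then_else_; T)
open import Data.Bool.Properties using (∨-conicalˡ; ∨-conicalʳ)
open import Data.Empty using (⊥)
open import Data.Fin using (Fin; zero; suc; toℕ; fromℕ<; #_; _↑ˡ_; _↑ʳ_; splitAt)
import Data.Fin as Fin
open import Data.Fin.Properties using (all?; ¬∀⟶∃¬; splitAt-↑ˡ; splitAt-↑ʳ; toℕ<n; toℕ-fromℕ<; toℕ-injective)
open import Data.Integer using (-[1+_])
import Data.Integer as ℤ
import Data.Integer.Properties as ℤₚ
open import Data.List using (List; []; _∷_; _++_; length; map; allFin; cartesianProductWith)
import Data.List as List
open import Data.List.Membership.Propositional using (_∈_; _∉_)
open import Data.List.Membership.Propositional.Properties using (∈-∃++; ∈-++⁻; ∈-++⁺ˡ; ∈-++⁺ʳ; ∈-map⁺; ∈-map⁻; ∈-allFin)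
open import Data.List.Properties using (length-++; length-map; length-tabulate; ++-assoc; ++-identityʳ)
open import Data.List.Relation.Unary.All using (All; []; _∷_)
import Data.List.Relation.Unary.All as All
open import Data.List.Relation.Unary.All.Properties using (¬Any⇒All¬; All¬⇒¬Any; ++⁺; map⁺)
open import Data.List.Relation.Unary.AllPairs using ([]; _∷_)
open import Data.List.Relation.Unary.Any using (here; there)
open import Data.List.Relation.Unary.Unique.Propositional using (Unique)
import Data.List.Relation.Unary.Unique.Propositional.Properties as Unique
open import Data.Nat using (ℕ; zero; suc; _+_; _*_; _∸_; _^_; _≤_; _<_; z≤n; s≤s; s≤s⁻¹; _≡ᵇ_; _≤?_; _<?_; ⌊_/2⌋; ⌈_/2⌉; NonZero; >-nonZero; nonTrivial⇒n>1)
open import Data.Nat.Coprimality using (Coprime; coprime-divisor)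
open import Data.Nat.Divisibility using (_∣_; divides; _∣?_; _∣0; ∣-refl; ∣⇒≤; ∣1⇒≡1; ∣m∣n⇒∣m+n; m∣m*n; *-cancelˡ-∣)
open import Data.Nat.DivMod using (_/_; m≡m%n+[m/n]*n; m%n<n; m/n*n≤m)
open import Data.Nat.Logarithm using (⌊log₂⌋-mono-≤; ⌊log₂[2^n]⌋≡n)
open import Data.Nat.Primality using (Prime; euclidsLemma; prime⇒irreducible; prime⇒nonTrivial; prime⇒nonZero)
open import Data.Nat.Properties
open import Data.Nat.Tactic.RingSolver using (solve-∀)
open import Data.Product using (∃-syntax; _×_; _,_; proj₁; proj₂)
open import Data.Rational.Unnormalised as ℚᵘ using (ℚᵘ; mkℚᵘ; ↥_; ↧ₙ_; _≃_; *≡*; *≤*; NonNegative)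
import Data.Rational.Unnormalised.Properties as ℚₚ
open import Data.Sum using (_⊎_; inj₁; inj₂; [_,_]′)
open import Data.Vec using (Vec; lookup; tabulate)
open import Data.Vec.Functional.Properties using (updateAt-updates; updateAt-minimal)
open import Data.Vec.Properties using (lookup∘tabulate)
open import Function using (_∘_; id; const)
open import Level using (0ℓ)
open import Relation.Binary.PropositionalEquality
open import Relation.Nullary using (¬_; Dec; yes; no; does; contradiction)
open import Relation.Nullary.Decidable using (dec-true)
open import Relation.Nullary.Reflects using (Reflects; ofʸ; ofⁿ)

-- Programs with bounded loops

-- The obstacle is the logarithmic cost. The simplest control of number sizes is that every machine
-- step adds at most one bit; applied to all n ^ F rounds of a phase it would square the running
-- time. Hence the scratch registers are cleared after every round. Between rounds all stored
-- numbers are at most `2 ^ (2 + w)` with w quadratic in n, so within one round the crude bound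
-- costs only a polynomial factor, and the rounds add up linearly. The flags need no initialisation,
-- since unwritten memory is 0. The summand 1 in F pays for the first entry of a tuple: the
-- enumeration starts from a nonempty tuple, so the greedy half of H begins with an arbitrary
-- element, possibly the identity, and only the ⌈k/2⌉ entries after it are chosen greedily. Since k
-- = log_p n, the exponent is (1/2) log_p n plus an absolute constant. Each of the claimed bounds
-- has room for such a constant: C is at most C p, log_p n is at most log n, and log n / log log n
-- is bounded below by 1/2.

registers : ℕ
registers = 29

Reg : Set
Reg = Fin registers

-- The register that holds the 1 by which loop counters are decremented.
dec : Reg
dec = zero

data Op : Set where
  set0 set1       : (d : Reg) → Op
  move load store : (d a : Reg) → Op
  add sub         : (d a b : Reg) → Op

infixr 5 _⨾_

-- loop c a b s runs s min(R[a], R[b]) times, with c as its counter.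
data Stmt : Set where
  op   : Op → Stmt
  _⨾_  : Stmt → Stmt → Stmt
  loop : (c a b : Reg) → Stmt → Stmt

record Store : Set where
  constructor _▪_
  field
    reg : Reg → ℕ
    mem : ℕ → ℕ
open Store public

apply : Op → Store → Store
apply (set0 d)    (R ▪ M) = (R [ d ≔ 0 ]) ▪ M
apply (set1 d)    (R ▪ M) = (R [ d ≔ 1 ]) ▪ M
apply (move d a)  (R ▪ M) = (R [ d ≔ R a ]) ▪ M
apply (load d a)  (R ▪ M) = (R [ d ≔ M (R a) ]) ▪ M
apply (store a b) (R ▪ M) = R ▪ write M (R a) (R b)
apply (add d a b) (R ▪ M) = (R [ d ≔ R a + R b ]) ▪ M
apply (sub d a b) (R ▪ M) = (R [ d ≔ R a ∸ R b ]) ▪ M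

-- Two truncated subtractions, `b ∸ (b ∸ a)`, compute the minimum. The operand `b` is there for the
-- cost analysis: it caps the number of rounds by a register of known size.
init : (c a b : Reg) → Store → Store
init c a b σ = apply (sub c b c) (apply (sub c b a) σ)

tick : Reg → ℕ → Store → Store
tick c k (R ▪ M) = ((R [ dec ≔ 1 ]) [ c ≔ k ]) ▪ M

-- The count is fixed on entry, so the semantics is total by structural recursion. That the counter
-- register of the machine shows the same count needs `wf`: the body must not assign `c`.
iter : Reg → (Store → Store) → ℕ → Store → Store
iter c f zero    σ = σ
iter c f (suc k) σ = iter c f k (f (tick c k σ))

⟦_⟧ : Stmt → Store → Store
⟦ op o ⟧ σ         = apply o σ
⟦ s ⨾ t ⟧ σ        = ⟦ t ⟧ (⟦ s ⟧ σ)
⟦ loop c a b s ⟧ σ = iter c ⟦ s ⟧ (reg (init c a b σ) c) (init c a b σ)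

opTime : Op → Store → ℕ
opTime (set0 d)    _       = size 0
opTime (set1 d)    _       = size 1
opTime (move d a)  (R ▪ M) = size (R a)
opTime (load d a)  (R ▪ M) = size (R a) + size (M (R a))
opTime (store a b) (R ▪ M) = size (R a) + size (R b)
opTime (add d a b) (R ▪ M) = size (R a) + size (R b)
opTime (sub d a b) (R ▪ M) = size (R a) + size (R b)

iterTime : Reg → (Store → Store) → (Store → ℕ) → ℕ → Store → ℕ
iterTime c f τ zero    σ = size (reg σ c)
iterTime c f τ (suc k) σ =
  size (reg σ c) + (size 1 + (opTime (sub c c dec) (apply (set1 dec) σ) + (τ (tick c k σ) + iterTime c f τ k (f (tick c k σ)))))

time : Stmt → Store → ℕ
time (op o) σ         = opTime o σ
time (s ⨾ t) σ        = time s σ + time t (⟦ s ⟧ σ)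
time (loop c a b s) σ = opTime (sub c b a) σ + (opTime (sub c b c) (apply (sub c b a) σ) +
  iterTime c ⟦ s ⟧ (time s) (reg (init c a b σ) c) (init c a b σ))

-- Frames and loop invariants

_==_ : Reg → Reg → Bool
a == b = does (a Fin.≟ b)

target : Op → Reg → Bool
target (set0 d)    e = d == e
target (set1 d)    e = d == e
target (move d a)  e = d == e
target (load d a)  e = d == e
target (store a b) e = false
target (add d a b) e = d == e
target (sub d a b) e = d == e

assigns : Stmt → Reg → Bool
assigns (op o)         e = target o e
assigns (s ⨾ t)        e = assigns s e ∨ assigns t e
assigns (loop c a b s) e = c == e ∨ (dec == e ∨ assigns s e)

≔-same : ∀ (R : Reg → ℕ) d v → (R [ d ≔ v ]) d ≡ v
≔-same R d v = updateAt-updates d R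

==-sound : ∀ d e → (d == e) ≡ false → e ≢ d
==-sound d e p refl with () ← trans (sym p) (dec-true (d Fin.≟ d) refl)

≔-other : ∀ (R : Reg → ℕ) d v e → (d == e) ≡ false → (R [ d ≔ v ]) e ≡ R e
≔-other R d v e p = updateAt-minimal e d R (==-sound d e p)

apply-keep : ∀ o e σ → target o e ≡ false → reg (apply o σ) e ≡ reg σ e
apply-keep (set0 d)    e (R ▪ M) p = ≔-other R d _ e p
apply-keep (set1 d)    e (R ▪ M) p = ≔-other R d _ e p
apply-keep (move d a)  e (R ▪ M) p = ≔-other R d _ e p
apply-keep (load d a)  e (R ▪ M) p = ≔-other R d _ e p
apply-keep (store a b) e (R ▪ M) p = refl
apply-keep (add d a b) e (R ▪ M) p = ≔-other R d _ e p
apply-keep (sub d a b) e (R ▪ M) p = ≔-other R d _ e p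

∨-false : ∀ {a b} → a ∨ b ≡ false → a ≡ false × b ≡ false
∨-false {a} {b} p = ∨-conicalˡ a b p , ∨-conicalʳ a b p

tick-keep : ∀ c k e σ → (c == e) ≡ false → (dec == e) ≡ false → reg (tick c k σ) e ≡ reg σ e
tick-keep c k e (R ▪ M) p q = trans (≔-other (R [ dec ≔ 1 ]) c k e p) (≔-other R dec 1 e q)

init-keep : ∀ c a b e σ → (c == e) ≡ false → reg (init c a b σ) e ≡ reg σ e
init-keep c a b e σ p = trans (apply-keep (sub c b c) e (apply (sub c b a) σ) p) (apply-keep (sub c b a) e σ p)

iter-ind : ∀ {ℓ} (P : Store → Set ℓ) c f → (∀ k σ → P σ → P (f (tick c k σ))) → ∀ k σ → P σ → P (iter c f k σ)
iter-ind P c f h zero    σ p = p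
iter-ind P c f h (suc k) σ p = iter-ind P c f h k _ (h k σ p)

keep : ∀ s e σ → assigns s e ≡ false → reg (⟦ s ⟧ σ) e ≡ reg σ e
keep (op o)         e σ p = apply-keep o e σ p
keep (s ⨾ t)        e σ p with ∨-false {assigns s e} p
... | q , r = trans (keep t e (⟦ s ⟧ σ) r) (keep s e σ q)
keep (loop c a b s) e σ p with ∨-false {c == e} p
... | q , r with ∨-false {dec == e} r
... | q′ , r′ = iter-ind (λ σ′ → reg σ′ e ≡ reg σ e) c ⟦ s ⟧
  (λ k σ′ h → trans (keep s e (tick c k σ′) r′) (trans (tick-keep c k e σ′ q q′) h))
  (reg (init c a b σ) c) (init c a b σ) (init-keep c a b e σ q)

stores : Stmt → Bool
stores (op (store _ _)) = true
stores (op _)           = false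
stores (s ⨾ t)          = stores s ∨ stores t
stores (loop _ _ _ s)   = stores s

keepMem : ∀ s σ → stores s ≡ false → mem (⟦ s ⟧ σ) ≡ mem σ
keepMem (op (set0 d))    σ p = refl
keepMem (op (set1 d))    σ p = refl
keepMem (op (move d a))  σ p = refl
keepMem (op (load d a))  σ p = refl
keepMem (op (add d a b)) σ p = refl
keepMem (op (sub d a b)) σ p = refl
keepMem (s ⨾ t)          σ p with ∨-false {stores s} p
... | q , r = trans (keepMem t _ r) (keepMem s σ q)
keepMem (loop c a b s)   σ p =
  iter-ind (λ σ′ → mem σ′ ≡ mem σ) c ⟦ s ⟧ (λ k σ′ h → trans (keepMem s (tick c k σ′) p) h)
    (reg (init c a b σ) c) (init c a b σ) refl

Frame : Stmt → Store → Store → Set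
Frame s σ σ′ = ∀ e → assigns s e ≡ false → reg σ′ e ≡ reg σ e

module _ {ℓ} (c a b : Reg) (s : Stmt) (σ : Store) (P : ℕ → Store → Set ℓ) (m : ℕ) where

  private
    Step : Set ℓ
    Step = ∀ j k σ′ → j < m → k < m → Frame (loop c a b s) σ σ′ → P j σ′ → P (suc j) (⟦ s ⟧ (tick c k σ′))

  body-frame : ∀ k σ′ → Frame (loop c a b s) σ σ′ → Frame (loop c a b s) σ (⟦ s ⟧ (tick c k σ′))
  body-frame k σ′ fr e p with ∨-false {c == e} p
  ... | q , r with ∨-false {dec == e} r
  ... | q′ , r′ = trans (keep s e (tick c k σ′) r′) (trans (tick-keep c k e σ′ q q′) (fr e p))

  init-frame : Frame (loop c a b s) σ (init c a b σ)
  init-frame e p = init-keep c a b e σ (proj₁ (∨-false {c == e} p))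

  iter-rule : Step → ∀ k j σ′ → j + k ≡ m → Frame (loop c a b s) σ σ′ → P j σ′ → P m (iter c ⟦ s ⟧ k σ′)
  iter-rule h zero    j σ′ eq fr p = subst (λ x → P x σ′) (trans (sym (+-identityʳ j)) eq) p
  iter-rule h (suc k) j σ′ eq fr p =
    iter-rule h k (suc j) _ (trans (sym (+-suc j k)) eq) (body-frame k σ′ fr)
      (h j k σ′ (m+n≤o⇒m≤o (suc j) (≤-reflexive (trans (sym (+-suc j k)) eq)))
         (m+n≤o⇒n≤o j (≤-reflexive eq)) fr p)

  -- `P j` is the invariant after `j` rounds. The syntactic frame is handed to every step, so that
  -- `P` need only speak of the registers and the memory that the loop changes.
  loop-rule : reg (init c a b σ) c ≡ m → P 0 (init c a b σ) → Step → P m (⟦ loop c a b s ⟧ σ)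
  loop-rule eq p h = subst (λ k → P m (iter c ⟦ s ⟧ k (init c a b σ))) (sym eq)
    (iter-rule h m 0 _ refl init-frame p)

  iter-time : Step → ∀ S τ → (∀ j k σ′ → j < m → k < m → Frame (loop c a b s) σ σ′ → P j σ′ →
      size (reg σ′ c) + (size 1 + opTime (sub c c dec) (apply (set1 dec) σ′)) ≤ 4 * S × time s (tick c k σ′) ≤ τ) →
    (∀ σ′ → Frame (loop c a b s) σ σ′ → P m σ′ → size (reg σ′ c) ≤ S) →
    ∀ k j σ′ → j + k ≡ m → Frame (loop c a b s) σ σ′ → P j σ′ →
    iterTime c ⟦ s ⟧ (time s) k σ′ ≤ k * (4 * S + τ) + S
  iter-time h S τ hτ he zero j σ′ eq fr p = he σ′ fr (subst (λ x → P x σ′) (trans (sym (+-identityʳ j)) eq) p)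
  iter-time h S τ hτ he (suc k) j σ′ eq fr p = begin
    A + (B + (C + (D + E)))  ≡⟨ lem ⟩
    (A + (B + C) + D) + E    ≤⟨ +-mono-≤ (+-mono-≤ (proj₁ now) (proj₂ now)) rest ⟩
    (4 * S + τ) + (k * (4 * S + τ) + S) ≡⟨ +-assoc (4 * S + τ) _ S ⟨
    suc k * (4 * S + τ) + S ∎
    where
    open ≤-Reasoning
    j<m = m+n≤o⇒m≤o (suc j) (≤-reflexive (trans (sym (+-suc j k)) eq))
    k<m = m+n≤o⇒n≤o j (≤-reflexive eq)
    A = size (reg σ′ c)
    B = size 1
    C = opTime (sub c c dec) (apply (set1 dec) σ′)
    D = time s (tick c k σ′)
    E = iterTime c ⟦ s ⟧ (time s) k (⟦ s ⟧ (tick c k σ′))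
    now = hτ j k σ′ j<m k<m fr p
    rest : E ≤ k * (4 * S + τ) + S
    rest = iter-time h S τ hτ he k (suc j) _ (trans (sym (+-suc j k)) eq) (body-frame k σ′ fr) (h j k σ′ j<m k<m fr p)
    lem : A + (B + (C + (D + E))) ≡ (A + (B + C) + D) + E
    lem = trans (cong (A +_) (trans (sym (+-assoc B C (D + E))) (sym (+-assoc (B + C) D E))))
         (trans (sym (+-assoc A (B + C + D) E)) (cong (_+ E) (sym (+-assoc A (B + C) D))))

-- Step counts and running time

iterSteps : Reg → (Store → Store) → (Store → ℕ) → ℕ → Store → ℕ
iterSteps c f τ zero    σ = 1
iterSteps c f τ (suc k) σ = 3 + (τ (tick c k σ) + iterSteps c f τ k (f (tick c k σ)))

steps : Stmt → Store → ℕ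
steps (op o) σ         = 1
steps (s ⨾ t) σ        = steps s σ + steps t (⟦ s ⟧ σ)
steps (loop c a b s) σ = 2 + iterSteps c ⟦ s ⟧ (steps s) (reg (init c a b σ) c) (init c a b σ)

-- Exponent of a polynomial step bound `V ^ degree s`, where 2 ≤ V bounds all loop counts. Sums are
-- absorbed by `V ^ a + V ^ b ≤ V ^ suc (a + b)`; the 5 of a loop covers the factor `V`, the three
-- lines of overhead per round and the cost of entry and exit.
degree : Stmt → ℕ
degree (op o)         = 0
degree (s ⨾ t)        = suc (degree s + degree t)
degree (loop c a b s) = 5 + degree s

-- `cap` selects registers that the statement never assigns, and every loop must name one of them as
-- the second operand of its minimum. A bound on these registers on entry thus remains valid inside
-- all nested loops.
capped : (Reg → Bool) → Stmt → Bool
capped cap (op (set0 d))    = not (cap d)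
capped cap (op (set1 d))    = not (cap d)
capped cap (op (move d a))  = not (cap d)
capped cap (op (load d a))  = not (cap d)
capped cap (op (store a b)) = true
capped cap (op (add d a b)) = not (cap d)
capped cap (op (sub d a b)) = not (cap d)
capped cap (s ⨾ t)          = capped cap s ∧ capped cap t
capped cap (loop c a b s)   = not (cap c) ∧ (not (cap dec) ∧ (cap b ∧ capped cap s))

∧-true : ∀ {a b} → a ∧ b ≡ true → a ≡ true × b ≡ true
∧-true {true} {true} p = refl , refl

not-true : ∀ {a} → not a ≡ true → a ≡ false
not-true {false} p = refl

pow-sum : ∀ {V} → 2 ≤ V → ∀ a b → V ^ a + V ^ b ≤ V ^ suc (a + b)
pow-sum {V} 2≤V a b = begin
  V ^ a + V ^ b             ≤⟨ +-mono-≤ (^-monoʳ-≤ V (m≤m+n a b)) (^-monoʳ-≤ V (m≤n+m b a)) ⟩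
  V ^ (a + b) + V ^ (a + b) ≡⟨ cong (λ z → V ^ (a + b) + z) (+-identityʳ _) ⟨
  2 * V ^ (a + b)           ≤⟨ *-monoˡ-≤ _ 2≤V ⟩
  V * V ^ (a + b)           ∎
  where
  open ≤-Reasoning
  instance
    V≢0 = >-nonZero (≤-trans (s≤s z≤n) 2≤V)

module _ (cap : Reg → Bool) where

  ==-cap : ∀ d e → not (cap d) ≡ true → cap e ≡ true → (d == e) ≡ false
  ==-cap d e p q with d Fin.≟ e
  ... | no _ = refl
  ... | yes refl with () ← trans (sym q) (not-true p)

  capped-keep : ∀ s e → capped cap s ≡ true → cap e ≡ true → assigns s e ≡ false
  capped-keep (op (set0 d))    e p q = ==-cap d e p q
  capped-keep (op (set1 d))    e p q = ==-cap d e p q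
  capped-keep (op (move d a))  e p q = ==-cap d e p q
  capped-keep (op (load d a))  e p q = ==-cap d e p q
  capped-keep (op (store a b)) e p q = refl
  capped-keep (op (add d a b)) e p q = ==-cap d e p q
  capped-keep (op (sub d a b)) e p q = ==-cap d e p q
  capped-keep (s ⨾ t)          e p q with ∧-true {capped cap s} p
  ... | u , v rewrite capped-keep s e u q = capped-keep t e v q
  capped-keep (loop c a b s)   e p q with ∧-true {not (cap c)} p
  ... | u , v with ∧-true {not (cap dec)} v
  ... | u′ , v′ with ∧-true {cap b} v′
  ... | _ , w rewrite ==-cap c e u q | ==-cap dec e u′ q = capped-keep s e w q

  Caps : ℕ → Store → Set
  Caps V σ = ∀ e → cap e ≡ true → reg σ e ≤ V

  caps-run : ∀ s {V σ} → capped cap s ≡ true → Caps V σ → Caps V (⟦ s ⟧ σ)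
  caps-run s {V} {σ} p h e q = ≤-trans (≤-reflexive (keep s e σ (capped-keep s e p q))) (h e q)

  module _ {V : ℕ} (2≤V : 2 ≤ V) where

    private
      instance
        V≢0 = >-nonZero (≤-trans (s≤s z≤n) 2≤V)

    iter-steps : ∀ c s → not (cap c) ≡ true → not (cap dec) ≡ true → capped cap s ≡ true →
      (∀ σ → Caps V σ → steps s σ ≤ V ^ degree s) → ∀ k σ → Caps V σ →
      iterSteps c ⟦ s ⟧ (steps s) k σ ≤ k * (3 + V ^ degree s) + 1
    iter-steps c s p q w h zero    σ hσ = ≤-refl
    iter-steps c s p q w h (suc k) σ hσ = begin
      3 + (steps s (tick c k σ) + iterSteps c ⟦ s ⟧ (steps s) k (⟦ s ⟧ (tick c k σ)))
        ≤⟨ +-monoʳ-≤ 3 (+-mono-≤ (h _ ht) (iter-steps c s p q w h k _ (caps-run s w ht))) ⟩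
      3 + (V ^ degree s + (k * (3 + V ^ degree s) + 1))
        ≡⟨ +-assoc (3 + V ^ degree s) (k * (3 + V ^ degree s)) 1 ⟨
      suc k * (3 + V ^ degree s) + 1 ∎
      where
      open ≤-Reasoning
      ht : Caps V (tick c k σ)
      ht e r = ≤-trans (≤-reflexive (tick-keep c k e σ (==-cap c e p r) (==-cap dec e q r))) (hσ e r)

    loop-degree : ∀ k d → k ≤ V → 2 + (k * (3 + V ^ d) + 1) ≤ V ^ (5 + d)
    loop-degree k d k≤V = begin
      2 + (k * (3 + V ^ d) + 1) ≡⟨ cong (2 +_) (+-comm _ 1) ⟩
      3 + k * (3 + V ^ d)       ≤⟨ +-mono-≤ 3≤ (*-mono-≤ k≤V (+-monoˡ-≤ (V ^ d) 3≤)) ⟩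
      V ^ 2 + V * (V ^ 2 + V ^ d) ≤⟨ +-mono-≤ (^-monoʳ-≤ V (m≤m+n 2 (2 + d))) (*-monoʳ-≤ V (pow-sum 2≤V 2 d)) ⟩
      V ^ (4 + d) + V ^ (4 + d)   ≡⟨ cong (V ^ (4 + d) +_) (+-identityʳ _) ⟨
      2 * V ^ (4 + d)             ≤⟨ *-monoˡ-≤ _ 2≤V ⟩
      V ^ (5 + d)                 ∎
      where
      open ≤-Reasoning
      3≤ : 3 ≤ V ^ 2
      3≤ = ≤-trans (n≤1+n 3) (^-monoˡ-≤ 2 2≤V)

    steps≤ : ∀ s σ → capped cap s ≡ true → Caps V σ → steps s σ ≤ V ^ degree s
    steps≤ (op o) σ p h = ≤-refl
    steps≤ (s ⨾ t) σ p h with ∧-true {capped cap s} p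
    ... | u , v = ≤-trans (+-mono-≤ (steps≤ s σ u h) (steps≤ t _ v (caps-run s u h))) (pow-sum 2≤V (degree s) (degree t))
    steps≤ (loop c a b s) σ p h with ∧-true {not (cap c)} p
    ... | u , v with ∧-true {not (cap dec)} v
    ... | u′ , v′ with ∧-true {cap b} v′
    ... | u″ , w = ≤-trans (+-monoʳ-≤ 2 (iter-steps c s u u′ w (λ σ′ → steps≤ s σ′ w) trips (init c a b σ)
            (λ e r → ≤-trans (≤-reflexive (init-keep c a b e σ (==-cap c e u r))) (h e r))))
          (loop-degree trips (degree s) trips≤)
      where
      trips = reg (init c a b σ) c
      trips≤ : trips ≤ V
      trips≤ = begin
        trips                        ≡⟨ ≔-same (reg (apply (sub c b a) σ)) c _ ⟩
        reg (apply (sub c b a) σ) b ∸ reg (apply (sub c b a) σ) c ≤⟨ m∸n≤m (reg (apply (sub c b a) σ) b) (reg (apply (sub c b a) σ) c) ⟩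
        reg (apply (sub c b a) σ) b  ≡⟨ apply-keep (sub c b a) b σ (==-cap c b u u″) ⟩
        reg σ b                      ≤⟨ h b u″ ⟩
        V ∎
        where open ≤-Reasoning

-- Growth of the numbers and logarithmic cost

record Bounded (b : ℕ) (σ : Store) : Set where
  constructor bounded
  field
    regs≤ : ∀ d → reg σ d ≤ 2 ^ b
    mems≤ : ∀ a → mem σ a ≤ 2 ^ b
open Bounded public

size≤ : ∀ {x} b → x ≤ 2 ^ b → size x ≤ suc b
size≤ b p = s≤s (≤-trans (⌊log₂⌋-mono-≤ p) (≤-reflexive (⌊log₂[2^n]⌋≡n b)))

≔-≤ : ∀ (R : Reg → ℕ) d v B → (∀ e → R e ≤ B) → v ≤ B → ∀ e → (R [ d ≔ v ]) e ≤ B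
≔-≤ R d v B h p e with d Fin.≟ e
... | yes refl = ≤-trans (≤-reflexive (≔-same R d v)) p
... | no d≢e   = ≤-trans (≤-reflexive (updateAt-minimal e d R (d≢e ∘ sym))) (h e)

write-≤ : ∀ M a v B → (∀ x → M x ≤ B) → v ≤ B → ∀ x → write M a v x ≤ B
write-≤ M a v B h p x with x ≡ᵇ a
... | true  = p
... | false = h x

Bounded-mono : ∀ {b b′ σ} → b ≤ b′ → Bounded b σ → Bounded b′ σ
Bounded-mono le (bounded p q) = bounded (λ d → ≤-trans (p d) (^-monoʳ-≤ 2 le)) (λ a → ≤-trans (q a) (^-monoʳ-≤ 2 le))

2^b≤ : ∀ b → 2 ^ b ≤ 2 ^ suc b
2^b≤ b = ^-monoʳ-≤ 2 (n≤1+n b)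

double : ∀ {x y} b → x ≤ 2 ^ b → y ≤ 2 ^ b → x + y ≤ 2 ^ suc b
double b p q = ≤-trans (+-mono-≤ p q) (≤-reflexive (cong (2 ^ b +_) (sym (+-identityʳ _))))

Bounded-op : ∀ o {b σ} → Bounded b σ → Bounded (suc b) (apply o σ)
Bounded-op (set0 d)    {b} {R ▪ M} (bounded p q) = bounded (≔-≤ R d _ _ (λ e → ≤-trans (p e) (2^b≤ b)) z≤n) (λ a → ≤-trans (q a) (2^b≤ b))
Bounded-op (set1 d)    {b} {R ▪ M} (bounded p q) = bounded (≔-≤ R d _ _ (λ e → ≤-trans (p e) (2^b≤ b)) (m^n>0 2 (suc b))) (λ a → ≤-trans (q a) (2^b≤ b))
Bounded-op (move d c)  {b} {R ▪ M} (bounded p q) = bounded (≔-≤ R d _ _ (λ e → ≤-trans (p e) (2^b≤ b)) (≤-trans (p c) (2^b≤ b))) (λ a → ≤-trans (q a) (2^b≤ b))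
Bounded-op (load d c)  {b} {R ▪ M} (bounded p q) = bounded (≔-≤ R d _ _ (λ e → ≤-trans (p e) (2^b≤ b)) (≤-trans (q (R c)) (2^b≤ b))) (λ a → ≤-trans (q a) (2^b≤ b))
Bounded-op (store c d) {b} {R ▪ M} (bounded p q) = bounded (λ e → ≤-trans (p e) (2^b≤ b)) (write-≤ M (R c) (R d) _ (λ a → ≤-trans (q a) (2^b≤ b)) (≤-trans (p d) (2^b≤ b)))
Bounded-op (add d c e) {b} {R ▪ M} (bounded p q) = bounded (≔-≤ R d _ _ (λ e → ≤-trans (p e) (2^b≤ b)) (double b (p c) (p e))) (λ a → ≤-trans (q a) (2^b≤ b))
Bounded-op (sub d c e) {b} {R ▪ M} (bounded p q) = bounded (≔-≤ R d _ _ (λ e → ≤-trans (p e) (2^b≤ b)) (≤-trans (m∸n≤m (R c) (R e)) (≤-trans (p c) (2^b≤ b)))) (λ a → ≤-trans (q a) (2^b≤ b))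

opTime≤ : ∀ o {b σ} → Bounded b σ → opTime o σ ≤ 2 * suc b
opTime≤ o {b} {R ▪ M} (bounded p q) = go o
  where
  two : ∀ {x y} → x ≤ 2 ^ b → y ≤ 2 ^ b → size x + size y ≤ 2 * suc b
  two h h′ = ≤-trans (+-mono-≤ (size≤ b h) (size≤ b h′)) (≤-reflexive (cong (suc b +_) (sym (+-identityʳ _))))
  one : ∀ {x} → x ≤ 2 ^ b → size x ≤ 2 * suc b
  one h = ≤-trans (size≤ b h) (m≤m+n _ _)
  go : ∀ o → opTime o (R ▪ M) ≤ 2 * suc b
  go (set0 d)    = one {0} z≤n
  go (set1 d)    = one {1} (m^n>0 2 b)
  go (move d a)  = one (p a)
  go (load d a)  = two (p a) (q (R a))
  go (store d a) = two (p d) (p a)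
  go (add d a e) = two (p a) (p e)
  go (sub d a e) = two (p a) (p e)

==-sym : ∀ d e → (d == e) ≡ false → (e == d) ≡ false
==-sym d e p with e Fin.≟ d
... | no _ = refl
... | yes refl = contradiction refl (==-sound d e p)

-- The machine subtracts 1 where the semantics assigns `k`. The two agree because the counter shows
-- `suc k` at that moment and, being different from `dec`, survives the loading of the 1.
tick-exact : ∀ c k σ → (c == dec) ≡ false → reg σ c ≡ suc k →
  apply (sub c c dec) (apply (set1 dec) σ) ≡ tick c k σ
tick-exact c k (R ▪ M) p eq = cong (λ v → ((R [ dec ≔ 1 ]) [ c ≔ v ]) ▪ M)
  (cong₂ _∸_ (trans (≔-other R dec 1 c (==-sym c dec p)) eq) (≔-same R dec 1))

wf : Stmt → Bool
wf (op o)         = true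
wf (s ⨾ t)        = wf s ∧ wf t
wf (loop c a b s) = not (assigns s c) ∧ (not (c == dec) ∧ wf s)

tick-reg : ∀ c k σ → reg (tick c k σ) c ≡ k
tick-reg c k (R ▪ M) = ≔-same (R [ dec ≔ 1 ]) c k

Bounded-tick : ∀ {c k b σ} → (c == dec) ≡ false → reg σ c ≡ suc k → Bounded b σ → Bounded (2 + b) (tick c k σ)
Bounded-tick {c} {k} {b} {σ} p eq h = subst (Bounded (2 + b)) (tick-exact c k σ p eq)
  (Bounded-op (sub c c dec) (Bounded-op (set1 dec) h))

-- One step of the machine at most doubles the largest number present.
mutual
  Bounded-run : ∀ s σ b → wf s ≡ true → Bounded b σ → Bounded (steps s σ + b) (⟦ s ⟧ σ)
  Bounded-run (op o) σ b w h = Bounded-op o h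
  Bounded-run (s ⨾ t) σ b w h with ∧-true {wf s} w
  ... | u , v = subst (λ x → Bounded x (⟦ s ⨾ t ⟧ σ))
    (trans (sym (+-assoc (steps t _) (steps s σ) b)) (cong (_+ b) (+-comm (steps t _) (steps s σ))))
    (Bounded-run t _ _ v (Bounded-run s σ b u h))
  Bounded-run (loop c a d s) σ b w h with ∧-true {not (assigns s c)} w
  ... | u , v with ∧-true {not (c == dec)} v
  ... | u′ , v′ = subst (λ x → Bounded x (⟦ loop c a d s ⟧ σ))
      (trans (+-suc I (suc b)) (cong suc (+-suc I b)))
      (Bounded-iter c s (not-true u) (not-true u′) v′ _ _ (2 + b) refl (Bounded-op (sub c d c) (Bounded-op (sub c d a) h)))
    where I = iterSteps c ⟦ s ⟧ (steps s) (reg (init c a d σ) c) (init c a d σ)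

  Bounded-iter : ∀ c s → assigns s c ≡ false → (c == dec) ≡ false → wf s ≡ true → ∀ k σ b → reg σ c ≡ k →
    Bounded b σ → Bounded (iterSteps c ⟦ s ⟧ (steps s) k σ + b) (iter c ⟦ s ⟧ k σ)
  Bounded-iter c s p q w zero    σ b eq h = Bounded-mono (n≤1+n b) h
  Bounded-iter c s p q w (suc k) σ b eq h = Bounded-mono le
      (Bounded-iter c s p q w k _ _ (trans (keep s c _ p) (tick-reg c k σ))
        (Bounded-run s (tick c k σ) (2 + b) w (Bounded-tick q eq h)))
    where
    S = steps s (tick c k σ)
    I = iterSteps c ⟦ s ⟧ (steps s) k (⟦ s ⟧ (tick c k σ))
    le : I + (S + (2 + b)) ≤ 3 + (S + I) + b
    le = ≤-trans (≤-reflexive (trans (sym (+-assoc I S (2 + b)))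
           (trans (cong (_+ (2 + b)) (+-comm I S)) (trans (+-suc (S + I) (suc b)) (cong suc (+-suc (S + I) b))))))
         (n≤1+n _)

mutual
  -- The exponent of the size bound only grows, so `B`, which is valid at the end, is valid
  -- throughout, and every step costs at most twice the length `suc B`. As `B` exceeds the number of
  -- steps, the bound is quadratic in that number.
  time≤ : ∀ s σ b B → wf s ≡ true → Bounded b σ → steps s σ + b ≤ B → time s σ ≤ steps s σ * (2 * suc B)
  time≤ (op o) σ b B w h le = ≤-trans (opTime≤ o h) (≤-trans (*-monoʳ-≤ 2 (s≤s (≤-trans (n≤1+n b) le))) (m≤m+n _ _))
  time≤ (s ⨾ t) σ b B w h le with ∧-true {wf s} w
  ... | u , v = ≤-trans
      (+-mono-≤ (time≤ s σ b B u h (≤-trans (+-monoˡ-≤ b (m≤m+n (steps s σ) _)) le))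
        (time≤ t _ (steps s σ + b) B v (Bounded-run s σ b u h)
          (≤-trans (≤-reflexive (trans (sym (+-assoc (steps t _) (steps s σ) b)) (cong (_+ b) (+-comm (steps t _) (steps s σ))))) le)))
      (≤-reflexive (sym (*-distribʳ-+ (2 * suc B) (steps s σ) (steps t _))))
  time≤ (loop c a d s) σ b B w h le with ∧-true {not (assigns s c)} w
  ... | u , v with ∧-true {not (c == dec)} v
  ... | u′ , v′ = +-mono-≤ (opTime≤′ (sub c d a) h b≤B)
      (+-mono-≤ (opTime≤′ (sub c d c) h₁ b₁≤B)
        (iterTime≤ c s (not-true u) (not-true u′) v′ _ _ (2 + b) B refl (Bounded-op (sub c d c) h₁)
          (≤-trans (≤-reflexive (trans (+-suc _ (suc b)) (cong suc (+-suc _ b)))) le)))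
    where
    h₁ = Bounded-op (sub c d a) h
    b₁≤B : suc b ≤ B
    b₁≤B = ≤-trans (s≤s (≤-trans (m≤n+m b _) (n≤1+n _))) le
    b≤B = ≤-trans (n≤1+n b) b₁≤B
    opTime≤′ : ∀ o {b σ} → Bounded b σ → b ≤ B → opTime o σ ≤ 2 * suc B
    opTime≤′ o g l = ≤-trans (opTime≤ o g) (*-monoʳ-≤ 2 (s≤s l))

  iterTime≤ : ∀ c s → assigns s c ≡ false → (c == dec) ≡ false → wf s ≡ true → ∀ k σ b B → reg σ c ≡ k →
    Bounded b σ → iterSteps c ⟦ s ⟧ (steps s) k σ + b ≤ B →
    iterTime c ⟦ s ⟧ (time s) k σ ≤ iterSteps c ⟦ s ⟧ (steps s) k σ * (2 * suc B)
  iterTime≤ c s p q w zero σ b B eq h le =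
    ≤-trans (size≤ b (regs≤ h c)) (≤-trans (s≤s (≤-trans (n≤1+n b) le)) (≤-trans (m≤m+n (suc B) _) (m≤m+n _ _)))
  iterTime≤ c s p q w (suc k) σ b B eq h le =
    +-mono-≤ (≤-trans (size≤ b (regs≤ h c)) (≤-trans (s≤s b≤B) (m≤m+n (suc B) _)))
      (+-mono-≤ (≤-trans (opTime≤ (set1 dec) h) (*-monoʳ-≤ 2 (s≤s b≤B)))
        (+-mono-≤ (≤-trans (opTime≤ (sub c c dec) (Bounded-op (set1 dec) h)) (*-monoʳ-≤ 2 (s≤s b₁≤B)))
          (≤-trans (+-mono-≤ (time≤ s _ (2 + b) B w ht (≤-trans (+-monoˡ-≤ (2 + b) (m≤m+n S I)) SI≤))
             (iterTime≤ c s p q w k _ (S + (2 + b)) B (trans (keep s c _ p) (tick-reg c k σ))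
               (Bounded-run s (tick c k σ) (2 + b) w ht)
               (≤-trans (≤-reflexive (trans (sym (+-assoc I S (2 + b))) (cong (_+ (2 + b)) (+-comm I S)))) SI≤)))
            (≤-reflexive (sym (*-distribʳ-+ (2 * suc B) S I))))))
    where
    S = steps s (tick c k σ)
    I = iterSteps c ⟦ s ⟧ (steps s) k (⟦ s ⟧ (tick c k σ))
    ht = Bounded-tick q eq h
    SI≤ : (S + I) + (2 + b) ≤ B
    SI≤ = ≤-trans (≤-reflexive (trans (+-suc (S + I) (suc b)) (cong suc (+-suc (S + I) b)))) (≤-trans (n≤1+n _) le)
    b₁≤B : suc b ≤ B
    b₁≤B = ≤-trans (≤-trans (n≤1+n _) (m≤n+m (2 + b) (S + I))) SI≤
    b≤B = ≤-trans (n≤1+n b) b₁≤B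

-- For a loop of n ^ F rounds the quadratic bound of `time≤` is too weak. Here an invariant keeps
-- the numbers at most `2 ^ B` between the rounds, so the total is linear in the number of rounds.
loop-time : ∀ {ℓ} c a b s σ (P : ℕ → Store → Set ℓ) m B τ → reg (init c a b σ) c ≡ m → Bounded B σ → P 0 (init c a b σ) →
  (∀ j k σ′ → j < m → k < m → Frame (loop c a b s) σ σ′ → P j σ′ → P (suc j) (⟦ s ⟧ (tick c k σ′))) →
  (∀ j σ′ → Frame (loop c a b s) σ σ′ → P j σ′ → Bounded B σ′) →
  (∀ j k σ′ → k < m → Frame (loop c a b s) σ σ′ → P j σ′ → time s (tick c k σ′) ≤ τ) →
  time (loop c a b s) σ ≤ suc m * (4 * (2 + B) + τ) + (2 + B)
loop-time c a b s σ P m B τ e h p st hb hτ = begin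
  T₁ + (T₂ + I)           ≡⟨ +-assoc T₁ T₂ I ⟨
  (T₁ + T₂) + I           ≤⟨ +-mono-≤ heads rest ⟩
  4 * S + (m * (4 * S + τ) + S)         ≤⟨ +-monoˡ-≤ _ (m≤m+n (4 * S) τ) ⟩
  (4 * S + τ) + (m * (4 * S + τ) + S)   ≡⟨ +-assoc (4 * S + τ) _ S ⟨
  suc m * (4 * S + τ) + S ∎
  where
  open ≤-Reasoning
  S = 2 + B
  T₁ = opTime (sub c b a) σ
  T₂ = opTime (sub c b c) (apply (sub c b a) σ)
  I = iterTime c ⟦ s ⟧ (time s) (reg (init c a b σ) c) (init c a b σ)
  two : 2 * S + 2 * S ≡ 4 * S
  two = sym (*-distribʳ-+ S 2 2)
  heads : T₁ + T₂ ≤ 4 * S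
  heads = ≤-trans (+-mono-≤ (≤-trans (opTime≤ (sub c b a) h) (*-monoʳ-≤ 2 (n≤1+n (suc B)))) (opTime≤ (sub c b c) (Bounded-op (sub c b a) h)))
    (≤-reflexive two)
  over : ∀ σ′ → Bounded B σ′ → size (reg σ′ c) + (size 1 + opTime (sub c c dec) (apply (set1 dec) σ′)) ≤ 4 * S
  over σ′ g = ≤-trans (+-mono-≤ (≤-trans (size≤ B (regs≤ g c)) (n≤1+n (suc B)))
      (+-mono-≤ {1} {S} {opTime (sub c c dec) (apply (set1 dec) σ′)} {2 * S} (s≤s z≤n) (opTime≤ (sub c c dec) (Bounded-op (set1 dec) g))))
    (≤-reflexive (trans (sym (+-assoc S S (2 * S))) (trans (cong (λ z → z + 2 * S) (cong (λ z → S + z) (sym (+-identityʳ S)))) two)))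
  rest : I ≤ m * (4 * S + τ) + S
  rest = subst (λ k → iterTime c ⟦ s ⟧ (time s) k (init c a b σ) ≤ m * (4 * S + τ) + S) (sym e)
    (iter-time c a b s σ P m st S τ
      (λ j k σ′ _ k< fr q → over σ′ (hb j σ′ fr q) , hτ j k σ′ k< fr q)
      (λ σ′ fr q → ≤-trans (size≤ B (regs≤ (hb m σ′ fr q) c)) (n≤1+n (suc B)))
      m 0 (init c a b σ) refl (init-frame c a b s σ P m) p)

-- Compilation

lines : Stmt → ℕ
lines (op o)         = 1
lines (s ⨾ t)        = lines s + lines t
lines (loop c a b s) = 5 + lines s

entry : ∀ s → Fin (lines s)
entry (op o)         = zero
entry (s ⨾ t)        = entry s ↑ˡ lines t
entry (loop c a b s) = zero

toInstr : ∀ {ℓ} → Op → Fin ℓ → Instr registers ℓ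
toInstr (set0 d)    = Instr.set d 0
toInstr (set1 d)    = Instr.set d 1
toInstr (move d a)  = Instr.move d a
toInstr (load d a)  = Instr.load d a
toInstr (store a b) = Instr.store a b
toInstr (add d a b) = Instr.add d a b
toInstr (sub d a b) = Instr.sub d a b

-- The line `exit` at which control continues is passed down, and every instruction names its
-- successors. The five extra lines of a loop are the two subtractions of the minimum, the test, the
-- loading of 1 and the decrement.
compile : ∀ {ℓ} s → (Fin (lines s) → Fin ℓ) → Fin ℓ → Fin (lines s) → Instr registers ℓ
compile (op o)         emb exit _ = toInstr o exit
compile (s ⨾ t)        emb exit i =
  [ compile s (emb ∘ (_↑ˡ lines t)) (emb (lines s ↑ʳ entry t)) , compile t (emb ∘ (lines s ↑ʳ_)) exit ]′ (splitAt (lines s) i)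
compile (loop c a b s) emb exit zero                             = sub c b a (emb (# 1))
compile (loop c a b s) emb exit (suc zero)                       = sub c b c (emb (# 2))
compile (loop c a b s) emb exit (suc (suc zero))                 = ifz c exit (emb (# 3))
compile (loop c a b s) emb exit (suc (suc (suc zero)))           = set dec 1 (emb (# 4))
compile (loop c a b s) emb exit (suc (suc (suc (suc zero))))     = sub c c dec (emb (5 ↑ʳ entry s))
compile (loop c a b s) emb exit (suc (suc (suc (suc (suc i))))) = compile s (emb ∘ (5 ↑ʳ_)) (emb (# 2)) i

module Compiled {ℓ : ℕ} (code : Vec (Instr registers ℓ) ℓ) (start : Fin ℓ) where

  machine : Program
  machine = record { registers = registers ; lines = ℓ ; code = code ; start = start }

  open Execution machine

  at : Fin ℓ → Store → State
  at pc (R ▪ M) = ⟨ pc , R , M ⟩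

  data Reach : State → ℕ → State → Set where
    stop : ∀ {s} → Reach s 0 s
    next : ∀ {s s′ s″ t} → step s ≡ inj₁ s′ → Reach s′ t s″ → Reach s (cost s + t) s″

  infixr 4 _▹_
  _▹_ : ∀ {s s′ s″ t u} → Reach s t s′ → Reach s′ u s″ → Reach s (t + u) s″
  stop ▹ q = q
  _▹_ {s} {s″ = s″} {u = u} (next {t = t} e p) q = subst (λ x → Reach s x s″) (sym (+-assoc (cost s) t u)) (next e (p ▹ q))

  reach-halts : ∀ {s s′ t b u} → Reach s t s′ → HaltsFrom s′ b u → HaltsFrom s b (t + u)
  reach-halts stop h = h
  reach-halts {s} {u = u} (next {t = t} e p) h =
    subst (HaltsFrom s _) (sym (+-assoc (cost s) t u)) (more e (reach-halts p h))

  one-step : ∀ {pc σ s′} i → lookup code pc ≡ i → exec i (at pc σ) ≡ inj₁ s′ → Reach (at pc σ) (execCost i (at pc σ)) s′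
  one-step {pc} {σ} i refl e = subst (λ x → Reach (at pc σ) x _) (+-identityʳ _) (next e stop)

  op-step : ∀ o {pc l σ} → lookup code pc ≡ toInstr o l → Reach (at pc σ) (opTime o σ) (at l (apply o σ))
  op-step (set0 d)    e = one-step _ e refl
  op-step (set1 d)    e = one-step _ e refl
  op-step (move d a)  e = one-step _ e refl
  op-step (load d a)  e = one-step _ e refl
  op-step (store a b) e = one-step _ e refl
  op-step (add d a b) e = one-step _ e refl
  op-step (sub d a b) e = one-step _ e refl

  ifz-zero : ∀ {pc y n σ} c → lookup code pc ≡ ifz c y n → reg σ c ≡ 0 → Reach (at pc σ) (size (reg σ c)) (at y σ)
  ifz-zero {y = y} {n} {σ} c e z = one-step _ e (cong (λ x → inj₁ (at (if x ≡ᵇ 0 then y else n) σ)) z)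

  ifz-suc : ∀ {pc y n σ k} c → lookup code pc ≡ ifz c y n → reg σ c ≡ suc k → Reach (at pc σ) (size (reg σ c)) (at n σ)
  ifz-suc {y = y} {n} {σ} c e z = one-step _ e (cong (λ x → inj₁ (at (if x ≡ᵇ 0 then y else n) σ)) z)

  mutual
    run : ∀ s emb exit → wf s ≡ true → (∀ i → lookup code (emb i) ≡ compile s emb exit i) → ∀ σ →
      Reach (at (emb (entry s)) σ) (time s σ) (at exit (⟦ s ⟧ σ))
    run (op o) emb exit w h σ = op-step o (h zero)
    run (s ⨾ t) emb exit w h σ with ∧-true {wf s} w
    ... | u , v =
        run s _ _ u (λ i → trans (h (i ↑ˡ lines t)) (cong split (splitAt-↑ˡ (lines s) i (lines t)))) σ
      ▹ run t _ _ v (λ i → trans (h (lines s ↑ʳ i)) (cong split (splitAt-↑ʳ (lines s) (lines t) i))) (⟦ s ⟧ σ)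
      where
      split = [ compile s (emb ∘ (_↑ˡ lines t)) (emb (lines s ↑ʳ entry t)) , compile t (emb ∘ (lines s ↑ʳ_)) exit ]′
    run (loop c a b s) emb exit w h σ with ∧-true {not (assigns s c)} w
    ... | u , v with ∧-true {not (c == dec)} v
    ... | u′ , v′ = op-step (sub c b a) (h (# 0)) ▹ op-step (sub c b c) (h (# 1)) ▹
      run-iter c a b s emb exit h (not-true u) (not-true u′) v′ _ (init c a b σ) refl

    run-iter : ∀ c a b s emb exit → (∀ i → lookup code (emb i) ≡ compile (loop c a b s) emb exit i) →
      assigns s c ≡ false → (c == dec) ≡ false → wf s ≡ true → ∀ k σ → reg σ c ≡ k →
      Reach (at (emb (# 2)) σ) (iterTime c ⟦ s ⟧ (time s) k σ) (at exit (iter c ⟦ s ⟧ k σ))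
    run-iter c a b s emb exit h p q w zero    σ e = ifz-zero c (h (# 2)) e
    run-iter c a b s emb exit h p q w (suc k) σ e =
        ifz-suc c (h (# 2)) e ▹ op-step (set1 dec) (h (# 3))
      ▹ subst (λ τ → Reach (at (emb (# 4)) (apply (set1 dec) σ)) (opTime (sub c c dec) (apply (set1 dec) σ)) (at (emb (5 ↑ʳ entry s)) τ)) (tick-exact c k σ q e) (op-step (sub c c dec) (h (# 4)))
      ▹ run s _ _ w (λ i → h (5 ↑ʳ i)) (tick c k σ)
      ▹ run-iter c a b s emb exit h p q w k _ (trans (keep s c _ p) (tick-reg c k σ))

  -- `RunsInTime` bounds every halting computation on an input, whereas running the compiled program
  -- exhibits one.
  halts-deterministic : ∀ {s b b′ t t′} → HaltsFrom s b t → HaltsFrom s b′ t′ → b ≡ b′ × t ≡ t′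
  halts-deterministic (done e) (done e′) with trans (sym e) e′
  ... | refl = refl , refl
  halts-deterministic (done e) (more e′ _) with () ← trans (sym e) e′
  halts-deterministic (more e _) (done e′) with () ← trans (sym e) e′
  halts-deterministic (more e h) (more e′ h′) with trans (sym e) e′
  ... | refl with halts-deterministic h h′
  ... | refl , refl = refl , refl

module Whole (s : Stmt) (out : Reg) where

  size′ = lines s + 3

  exit : Fin 3 → Fin size′
  exit = lines s ↑ʳ_

  tail-code : Fin 3 → Instr registers size′
  tail-code zero             = ifz out (exit (# 1)) (exit (# 2))
  tail-code (suc zero)       = halt false
  tail-code (suc (suc zero)) = halt true

  code-at : Fin size′ → Instr registers size′
  code-at i = [ compile s (_↑ˡ 3) (exit (# 0)) , tail-code ]′ (splitAt (lines s) i)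

  open Compiled (tabulate code-at) (entry s ↑ˡ 3) public
  open Execution machine

  code-body : ∀ i → lookup (tabulate code-at) (i ↑ˡ 3) ≡ compile s (_↑ˡ 3) (exit (# 0)) i
  code-body i = trans (lookup∘tabulate code-at _) (cong [ _ , tail-code ]′ (splitAt-↑ˡ (lines s) i 3))

  code-tail : ∀ i → lookup (tabulate code-at) (exit i) ≡ tail-code i
  code-tail i = trans (lookup∘tabulate code-at _) (cong [ compile s (_↑ˡ 3) (exit (# 0)) , tail-code ]′ (splitAt-↑ʳ (lines s) 3 i))

  halt-at : ∀ {pc b} σ → lookup (tabulate code-at) pc ≡ halt b → HaltsFrom (at pc σ) b 1
  halt-at {pc} {b} σ e = subst (HaltsFrom (at pc σ) b) (cong (λ i → execCost i (at pc σ)) e)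
    (done (cong (λ i → exec i (at pc σ)) e))

  finish : ∀ σ → HaltsFrom (at (exit (# 0)) σ) (not (reg σ out ≡ᵇ 0)) (size (reg σ out) + 1)
  finish σ with reg σ out in e
  ... | zero  = subst (λ x → HaltsFrom (at (exit (# 0)) σ) false (size x + 1)) e (reach-halts (ifz-zero {σ = σ} out (code-tail (# 0)) e) (halt-at σ (code-tail (# 1))))
  ... | suc k = subst (λ x → HaltsFrom (at (exit (# 0)) σ) true (size x + 1)) e (reach-halts (ifz-suc {σ = σ} out (code-tail (# 0)) e) (halt-at σ (code-tail (# 2))))

  result : wf s ≡ true → ∀ σ → HaltsFrom (at (entry s ↑ˡ 3) σ) (not (reg (⟦ s ⟧ σ) out ≡ᵇ 0)) (time s σ + (size (reg (⟦ s ⟧ σ) out) + 1))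
  result w σ = reach-halts (run s (_↑ˡ 3) (exit (# 0)) w code-body σ) (finish (⟦ s ⟧ σ))

-- Canonical enumeration of the subgroup generated by a tuple

unique-length : ∀ {A : Set} {xs ys : List A} → Unique xs → (∀ {x} → x ∈ xs → x ∈ ys) → length xs ≤ length ys
unique-length {xs = []}     []       h = z≤n
unique-length {xs = x ∷ xs} (x∉ ∷ u) h with ∈-∃++ (h (here refl))
... | as , bs , refl = begin
  suc (length xs)           ≤⟨ s≤s (unique-length u rest) ⟩
  suc (length (as ++ bs))   ≡⟨ cong suc (length-++ as) ⟩
  suc (length as + length bs) ≡⟨ +-suc (length as) (length bs) ⟨
  length as + length (x ∷ bs) ≡⟨ length-++ as ⟨
  length (as ++ x ∷ bs)     ∎
  where
  open ≤-Reasoning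
  rest : ∀ {y} → y ∈ xs → y ∈ as ++ bs
  rest y∈ with ∈-++⁻ as (h (there y∈))
  ... | inj₁ p           = ∈-++⁺ˡ p
  ... | inj₂ (here refl) = contradiction y∈ (All¬⇒¬Any x∉)
  ... | inj₂ (there p)   = ∈-++⁺ʳ as p

module _ {n : ℕ} where

  open import Data.List.Membership.DecPropositional (Fin._≟_ {n}) using (_∈?_) public

  -- For an absent `y` this is the length of the list, which is exactly the position at which `put`
  -- places it. One number thus serves as search result, as address and as output digit.
  index : Fin n → List (Fin n) → ℕ
  index y []       = 0
  index y (x ∷ xs) with x Fin.≟ y
  ... | yes _ = 0
  ... | no  _ = suc (index y xs)

  nth : Fin n → List (Fin n) → ℕ → Fin n
  nth d []       _       = d
  nth d (x ∷ xs) zero    = x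
  nth d (x ∷ xs) (suc i) = nth d xs i

  put : Fin n → List (Fin n) → List (Fin n)
  put y []       = y ∷ []
  put y (x ∷ xs) with x Fin.≟ y
  ... | yes _ = x ∷ xs
  ... | no  _ = x ∷ put y xs

  index≤ : ∀ y xs → index y xs ≤ length xs
  index≤ y []       = z≤n
  index≤ y (x ∷ xs) with x Fin.≟ y
  ... | yes _ = z≤n
  ... | no  _ = s≤s (index≤ y xs)

  -- The correction `1 ∸ (length xs ∸ index y xs)` is 1 for a new element and 0 for an old one; the
  -- program evaluates this branch-free expression.
  length-put : ∀ y xs → length (put y xs) ≡ length xs + (1 ∸ (length xs ∸ index y xs))
  length-put y []       = refl
  length-put y (x ∷ xs) with x Fin.≟ y
  ... | yes _ = cong suc (trans (sym (+-identityʳ _)) (cong (length xs +_) (sym (0∸n≡0 (length xs)))))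
  ... | no  _ = cong suc (length-put y xs)

  length-put≥ : ∀ y xs → length xs ≤ length (put y xs)
  length-put≥ y xs = ≤-trans (m≤m+n _ _) (≤-reflexive (sym (length-put y xs)))

  nth-put : ∀ d y xs i → i < length xs → nth d (put y xs) i ≡ nth d xs i
  nth-put d y (x ∷ xs) i p with x Fin.≟ y
  nth-put d y (x ∷ xs) i p | yes _ = refl
  nth-put d y (x ∷ xs) zero p | no _ = refl
  nth-put d y (x ∷ xs) (suc i) (s≤s p) | no _ = nth-put d y xs i p

  nth-put-index : ∀ d y xs → nth d (put y xs) (index y xs) ≡ y
  nth-put-index d y []       = refl
  nth-put-index d y (x ∷ xs) with x Fin.≟ y
  ... | yes e = e
  ... | no  _ = nth-put-index d y xs

  index<put : ∀ y xs → index y xs < length (put y xs)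
  index<put y []       = s≤s z≤n
  index<put y (x ∷ xs) with x Fin.≟ y
  ... | yes _ = s≤s z≤n
  ... | no  _ = s≤s (index<put y xs)

  index-before : ∀ d y xs i → i < index y xs → nth d xs i ≢ y
  index-before d y (x ∷ xs) i p e with x Fin.≟ y
  index-before d y (x ∷ xs) zero    p       e | no x≢y = x≢y e
  index-before d y (x ∷ xs) (suc i) (s≤s p) e | no x≢y = index-before d y xs i p e

  index-hit : ∀ d y xs → index y xs < length xs → nth d xs (index y xs) ≡ y
  index-hit d y (x ∷ xs) p with x Fin.≟ y
  ... | yes e = e
  ... | no  _ = index-hit d y xs (s≤s⁻¹ p)

  put-old : ∀ y xs i → i < length (put y xs) → i ≢ index y xs → i < length xs
  put-old y []       zero    p i≢ = contradiction refl i≢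
  put-old y []       (suc i) (s≤s ()) i≢
  put-old y (x ∷ xs) i p i≢ with x Fin.≟ y
  put-old y (x ∷ xs) i       p       i≢ | yes _ = p
  put-old y (x ∷ xs) zero    p       i≢ | no _  = s≤s z≤n
  put-old y (x ∷ xs) (suc i) (s≤s p) i≢ | no _  = s≤s (put-old y xs i p (i≢ ∘ cong suc))

  ∈-put⁻ : ∀ {x} y xs → x ∈ put y xs → x ∈ xs ⊎ x ≡ y
  ∈-put⁻ y []       (here p) = inj₂ p
  ∈-put⁻ y (x ∷ xs) p with x Fin.≟ y
  ∈-put⁻ y (x ∷ xs) p         | yes _ = inj₁ p
  ∈-put⁻ y (x ∷ xs) (here p)  | no _  = inj₁ (here p)
  ∈-put⁻ y (x ∷ xs) (there p) | no _ with ∈-put⁻ y xs p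
  ... | inj₁ q = inj₁ (there q)
  ... | inj₂ q = inj₂ q

  put-present : ∀ y xs → y ∈ xs → put y xs ≡ xs
  put-present y (x ∷ xs) p with x Fin.≟ y
  put-present y (x ∷ xs) p           | yes _   = refl
  put-present y (x ∷ xs) (here refl) | no x≢y = contradiction refl x≢y
  put-present y (x ∷ xs) (there p)   | no _   = cong (x ∷_) (put-present y xs p)

  put-unique : ∀ y xs → Unique xs → Unique (put y xs)
  put-unique y []       u = [] ∷ []
  put-unique y (x ∷ xs) (x∉ ∷ u) with x Fin.≟ y
  ... | yes _  = x∉ ∷ u
  ... | no x≢y = ¬Any⇒All¬ (put y xs) fresh ∷ put-unique y xs u
    where
    fresh : x ∉ put y xs
    fresh p with ∈-put⁻ y xs p
    ... | inj₁ q = All¬⇒¬Any x∉ q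
    ... | inj₂ q = x≢y q

  nth-∈ : ∀ d xs i → i < length xs → nth d xs i ∈ xs
  nth-∈ d (x ∷ xs) zero    p       = here refl
  nth-∈ d (x ∷ xs) (suc i) (s≤s p) = there (nth-∈ d xs i p)

  nth-past : ∀ d xs i → length xs ≤ i → nth d xs i ≡ d
  nth-past d []       i       p       = refl
  nth-past d (x ∷ xs) (suc i) (s≤s p) = nth-past d xs i p

  ∈-nth : ∀ d {x} xs → x ∈ xs → ∃[ i ] i < length xs × nth d xs i ≡ x
  ∈-nth d (x ∷ xs) (here refl) = 0 , s≤s z≤n , refl
  ∈-nth d (x ∷ xs) (there p) with ∈-nth d xs p
  ... | i , q , e = suc i , s≤s q , e

  nth-injective : ∀ d xs i j → Unique xs → i < length xs → j < length xs → nth d xs i ≡ nth d xs j → i ≡ j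
  nth-injective d (x ∷ xs) zero    zero    u       p q e = refl
  nth-injective d (x ∷ xs) zero    (suc j) (x∉ ∷ u) p (s≤s q) e =
    contradiction (subst (_∈ xs) (sym e) (nth-∈ d xs j q)) (All¬⇒¬Any x∉)
  nth-injective d (x ∷ xs) (suc i) zero    (x∉ ∷ u) (s≤s p) q e =
    contradiction (subst (_∈ xs) e (nth-∈ d xs i p)) (All¬⇒¬Any x∉)
  nth-injective d (x ∷ xs) (suc i) (suc j) (_ ∷ u) (s≤s p) (s≤s q) e = cong suc (nth-injective d xs i j u p q e)

  ∈⇒index< : ∀ {y} xs → y ∈ xs → index y xs < length xs
  ∈⇒index< {y} xs p = subst (λ zs → index y xs < length zs) (put-present y xs p) (index<put y xs)

  index<⇒∈ : ∀ {y} xs → index y xs < length xs → y ∈ xs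
  index<⇒∈ {y} xs p = subst (_∈ xs) (index-hit y y xs p) (nth-∈ y xs _ p)

  unique≤ : ∀ {xs : List (Fin n)} → Unique xs → length xs ≤ n
  unique≤ u = ≤-trans (unique-length u (λ {x} _ → ∈-allFin x)) (≤-reflexive (length-tabulate id))

  unique-full : ∀ {xs : List (Fin n)} → Unique xs → n ≤ length xs → ∀ y → y ∈ xs
  unique-full {xs} u le y with y ∈? xs
  ... | yes p = p
  ... | no ∉  = contradiction (unique≤ {y ∷ xs} (¬Any⇒All¬ xs ∉ ∷ u)) (≤⇒≯ le)

  index<n : ∀ y {xs} → Unique xs → index y xs < n
  index<n y {xs} u = ≤-trans (index<put y xs) (unique≤ (put-unique y xs u))

  module _ {φ : Fin n → Fin n} (φ-inj : ∀ {x y} → φ x ≡ φ y → x ≡ y) where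

    index-map : ∀ y xs → index (φ y) (map φ xs) ≡ index y xs
    index-map y []       = refl
    index-map y (x ∷ xs) with x Fin.≟ y | φ x Fin.≟ φ y
    ... | yes _   | yes _   = refl
    ... | no _    | no _    = cong suc (index-map y xs)
    ... | yes e   | no φ≢   = contradiction (cong φ e) φ≢
    ... | no x≢y  | yes e   = contradiction (φ-inj e) x≢y

    put-map : ∀ y xs → put (φ y) (map φ xs) ≡ map φ (put y xs)
    put-map y []       = refl
    put-map y (x ∷ xs) with x Fin.≟ y | φ x Fin.≟ φ y
    ... | yes _   | yes _   = refl
    ... | no _    | no _    = cong (φ x ∷_) (put-map y xs)
    ... | yes e   | no φ≢   = contradiction (cong φ e) φ≢
    ... | no x≢y  | yes e   = contradiction (φ-inj e) x≢y

  nth-map : ∀ (φ : Fin n → Fin n) d xs i → nth (φ d) (map φ xs) i ≡ φ (nth d xs i)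
  nth-map φ d []       i       = refl
  nth-map φ d (x ∷ xs) zero    = refl
  nth-map φ d (x ∷ xs) (suc i) = nth-map φ d xs i

-- Codes of tuples, and the lockstep of equal codes

toGroup : ∀ {n} → GroupTable n → Group 0ℓ 0ℓ
toGroup G = record { isGroup = GroupTable.isGroup G }

Conf : ℕ → Set
Conf n = List (Fin n) × ℕ

-- The latest digit is the least significant one. It is below n even if `y` is new, because the list
-- lengthened by `y` is still free of repetitions (`index<n`); hence equal codes can be peeled apart
-- digit by digit.
visit : ∀ {n} → Fin n → Conf n → Conf n
visit {n} y (xs , c) = put y xs , index y xs + n * c

digit-injective : ∀ n {a b c d} → a < n → b < n → a + n * c ≡ b + n * d → a ≡ b × c ≡ d
digit-injective n {a} {b} {zero} {zero} p q e =
  trans (sym (+-identityʳ a)) (trans (subst (λ z → a + z ≡ b + z) (*-zeroʳ n) e) (+-identityʳ b)) , refl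
digit-injective n {a} {b} {zero} {suc d} p q e = contradiction (≤-trans (m≤m+n n (n * d)) (≤-trans (m≤n+m _ b)
  (≤-reflexive (trans (cong (b +_) (sym (*-suc n d))) (trans (sym e) (trans (cong (a +_) (*-zeroʳ n)) (+-identityʳ a))))))) (<⇒≱ p)
digit-injective n {a} {b} {suc c} {zero} p q e = contradiction (≤-trans (m≤m+n n (n * c)) (≤-trans (m≤n+m _ a)
  (≤-reflexive (trans (cong (a +_) (sym (*-suc n c))) (trans e (trans (cong (b +_) (*-zeroʳ n)) (+-identityʳ b))))))) (<⇒≱ q)
digit-injective n {a} {b} {suc c} {suc d} p q e with digit-injective n {a} {b} {c} {d} p q
  (+-cancelˡ-≡ n _ _ (trans (shift a c) (trans e (sym (shift b d)))))
  where
  shift : ∀ a c → n + (a + n * c) ≡ a + n * suc c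
  shift a c = trans (sym (+-assoc n a (n * c))) (trans (cong (_+ n * c) (+-comm n a))
    (trans (+-assoc a n (n * c)) (cong (a +_) (sym (*-suc n c)))))
... | e₁ , e₂ = e₁ , cong suc e₂

module Runs {n : ℕ} (G : GroupTable n) where
  open GroupTable G

  -- A configuration is the list found so far with the digits, to base n, output so far.
  row : (ℕ → Fin n) → Fin n → Conf n → ℕ → Conf n
  row f x s zero    = s
  row f x s (suc j) = visit (x ∙ f j) (row f x s j)

  -- nth falls back to f 0, so a stage past the end of the list repeats the first one.
  run : (ℕ → Fin n) → ℕ → ℕ → Conf n
  run f L zero    = f 0 ∷ [] , 0
  run f L (suc t) = row f (nth (f 0) (proj₁ (run f L t)) t) (run f L t) L

  elements : (ℕ → Fin n) → ℕ → List (Fin n)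
  elements f L = proj₁ (run f L n)

  code : (ℕ → Fin n) → ℕ → ℕ
  code f L = proj₂ (run f L n)

  order : (ℕ → Fin n) → ℕ → ℕ
  order f L = length (elements f L)

  row-cong : ∀ {f g} x s L → (∀ j → j < L → f j ≡ g j) → row f x s L ≡ row g x s L
  row-cong x s zero    h = refl
  row-cong x s (suc L) h = cong₂ (λ y s → visit (x ∙ y) s) (h L (n<1+n L)) (row-cong x s L (λ j p → h j (m<n⇒m<1+n p)))

  run-cong : ∀ {f g} L t → f 0 ≡ g 0 → (∀ j → j < L → f j ≡ g j) → run f L t ≡ run g L t
  run-cong L zero    e h = cong (λ x → x ∷ [] , 0) e
  run-cong {f} {g} L (suc t) e h = trans (row-cong _ (run f L t) L h)
    (cong₂ (λ d s → row g (nth d (proj₁ s) t) s L) e (run-cong L t e h))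

  row-unique : ∀ f x s L → Unique (proj₁ s) → Unique (proj₁ (row f x s L))
  row-unique f x s zero    u = u
  row-unique f x s (suc L) u = put-unique (x ∙ f L) _ (row-unique f x s L u)

  run-unique : ∀ f L t → Unique (proj₁ (run f L t))
  run-unique f L zero    = [] ∷ []
  run-unique f L (suc t) = row-unique f _ (run f L t) L (run-unique f L t)

  row-length : ∀ f x s L → length (proj₁ s) ≤ length (proj₁ (row f x s L))
  row-length f x s zero    = ≤-refl
  row-length f x s (suc L) = ≤-trans (row-length f x s L) (length-put≥ (x ∙ f L) (proj₁ (row f x s L)))

  row-nth : ∀ d f x s L i → i < length (proj₁ s) → nth d (proj₁ (row f x s L)) i ≡ nth d (proj₁ s) i
  row-nth d f x s zero    i p = refl
  row-nth d f x s (suc L) i p = trans (nth-put d (x ∙ f L) (proj₁ (row f x s L)) i (≤-trans p (row-length f x s L))) (row-nth d f x s L i p)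

  row-present : ∀ f x s L → (∀ j → j < L → x ∙ f j ∈ proj₁ s) → proj₁ (row f x s L) ≡ proj₁ s
  row-present f x s zero    h = refl
  row-present f x s (suc L) h = trans (cong (put (x ∙ f L)) (row-present f x s L (λ j p → h j (m<n⇒m<1+n p))))
    (put-present (x ∙ f L) _ (h L (n<1+n L)))

  run-nonempty : ∀ f L t → 0 < length (proj₁ (run f L t))
  run-nonempty f L zero    = s≤s z≤n
  run-nonempty f L (suc t) = ≤-trans (run-nonempty f L t) (row-length f _ (run f L t) L)

  run-head : ∀ d f L t → nth d (proj₁ (run f L t)) 0 ≡ f 0
  run-head d f L zero    = refl
  run-head d f L (suc t) = trans (row-nth d f _ (run f L t) L 0 (run-nonempty f L t)) (run-head d f L t)

-- Two runs that produce the same code move in lockstep.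
module Lockstep {n : ℕ} (G H : GroupTable n) (f g : ℕ → Fin n) (L : ℕ) where
  open GroupTable G using () renaming (_∙_ to _∙₁_)
  open GroupTable H using () renaming (_∙_ to _∙₂_)
  private
    module A = Runs G
    module B = Runs H

  record Pair (xs ys : List (Fin n)) (x y : Fin n) : Set where
    constructor pair
    field
      pos  : ℕ
      pos₁ : pos < length xs
      pos₂ : pos < length ys
      at₁  : nth (f 0) xs pos ≡ x
      at₂  : nth (g 0) ys pos ≡ y
  open Pair

  pair-put : ∀ {xs ys x y} u v → Pair xs ys x y → Pair (put u xs) (put v ys) x y
  pair-put {xs} {ys} u v (pair k p q e₁ e₂) = pair k (≤-trans p (length-put≥ u xs)) (≤-trans q (length-put≥ v ys))
    (trans (nth-put (f 0) u xs k p) e₁) (trans (nth-put (g 0) v ys k q) e₂)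

  -- Codes and lists are compared in opposite directions: equality of codes passes backwards from
  -- the last digit to the first, equality of lengths passes forwards. This is why the conclusion
  -- about the lists is an implication from the equality of the lengths on entry.
  row-pair : ∀ x y s s′ j → Unique (proj₁ s) → Unique (proj₁ s′) →
    proj₂ (A.row f x s j) ≡ proj₂ (B.row g y s′ j) →
    proj₂ s ≡ proj₂ s′ × (length (proj₁ s) ≡ length (proj₁ s′) →
      length (proj₁ (A.row f x s j)) ≡ length (proj₁ (B.row g y s′ j)) ×
      (∀ i → i < j → Pair (proj₁ (A.row f x s j)) (proj₁ (B.row g y s′ j)) (x ∙₁ f i) (y ∙₂ g i)))
  row-pair x y s s′ zero    u v e = e , λ l → l , λ i ()
  row-pair x y s s′ (suc j) u v e
    with digit-injective n (index<n (x ∙₁ f j) (A.row-unique f x s j u)) (index<n (y ∙₂ g j) (B.row-unique g y s′ j v)) e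
  ... | ei , ec with row-pair x y s s′ j u v ec
  ... | es , h = es , λ l → len (h l) , pairs (h l)
    where
    xs = proj₁ (A.row f x s j)
    ys = proj₁ (B.row g y s′ j)
    a = x ∙₁ f j
    b = y ∙₂ g j
    len : length xs ≡ length ys × _ → length (put a xs) ≡ length (put b ys)
    len (l , _) = trans (length-put a xs) (trans (cong₂ (λ l i → l + (1 ∸ (l ∸ i))) l ei) (sym (length-put b ys)))
    pairs : length xs ≡ length ys × (∀ i → i < j → Pair xs ys (x ∙₁ f i) (y ∙₂ g i)) →
      ∀ i → i < suc j → Pair (put a xs) (put b ys) (x ∙₁ f i) (y ∙₂ g i)
    pairs (l , h) i p with m≤n⇒m<n∨m≡n (s≤s⁻¹ p)
    ... | inj₁ q    = pair-put a b (h i q)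
    ... | inj₂ refl = pair (index a xs) (index<put a xs) (subst (_< length (put b ys)) (sym ei) (index<put b ys))
      (nth-put-index (f 0) a xs) (trans (cong (nth (g 0) (put b ys)) ei) (nth-put-index (g 0) b ys))

  pair-row : ∀ {x y} u v s s′ j → Pair (proj₁ s) (proj₁ s′) x y → Pair (proj₁ (A.row f u s j)) (proj₁ (B.row g v s′ j)) x y
  pair-row u v s s′ zero    p = p
  pair-row u v s s′ (suc j) p = pair-put (u ∙₁ f j) (v ∙₂ g j) (pair-row u v s s′ j p)

  Closed : ℕ → List (Fin n) → List (Fin n) → Set
  Closed t xs ys = ∀ i → i < t → i < length xs → ∀ j → j < L → Pair xs ys (nth (f 0) xs i ∙₁ f j) (nth (g 0) ys i ∙₂ g j)

  pair-∈₁ : ∀ {xs ys x y} → Pair xs ys x y → x ∈ xs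
  pair-∈₁ {xs} (pair k p _ e _) = subst (_∈ xs) e (nth-∈ (f 0) xs k p)

  run-pair : ∀ t → proj₂ (A.run f L t) ≡ proj₂ (B.run g L t) →
    length (proj₁ (A.run f L t)) ≡ length (proj₁ (B.run g L t)) × Closed t (proj₁ (A.run f L t)) (proj₁ (B.run g L t))
  run-pair zero    e = refl , λ i ()
  run-pair (suc t) e with row-pair _ _ (A.run f L t) (B.run g L t) L (A.run-unique f L t) (B.run-unique g L t) e
  ... | e′ , h with run-pair t e′
  ... | l , c = proj₁ (h l) , closed
    where
    s  = A.run f L t
    s′ = B.run g L t
    xs = proj₁ s
    ys = proj₁ s′
    x  = nth (f 0) xs t
    y  = nth (g 0) ys t
    old : ∀ i → i < t → i < length xs → ∀ j → j < L → Pair _ _ _ _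
    old i p q j r = subst₂ (λ a b → Pair (proj₁ (A.row f x s L)) (proj₁ (B.row g y s′ L)) (a ∙₁ f j) (b ∙₂ g j))
        (sym (A.row-nth (f 0) f x s L i q)) (sym (B.row-nth (g 0) g y s′ L i (subst (i <_) l q)))
        (pair-row x y s s′ L (c i p q j r))
    closed : Closed (suc t) (proj₁ (A.row f x s L)) (proj₁ (B.row g y s′ L))
    closed i p q j r with t <? length xs
    closed i p q j r | yes t< with m≤n⇒m<n∨m≡n (s≤s⁻¹ p)
    ... | inj₁ i<t  = old i i<t (<-trans i<t t<) j r
    ... | inj₂ refl = subst₂ (λ a b → Pair (proj₁ (A.row f x s L)) (proj₁ (B.row g y s′ L)) (a ∙₁ f j) (b ∙₂ g j))
        (sym (A.row-nth (f 0) f x s L i t<)) (sym (B.row-nth (g 0) g y s′ L i (subst (i <_) l t<)))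
        (proj₂ (h l) j r)
    -- The list is exhausted, so stage `t` multiplies `f 0` again. These products are in the list by
    -- `c 0`, hence the row adds nothing, and `i` is below the length of the old list and so below
    -- `t`.
    closed i p q j r | no t≮ = old i (<-≤-trans i<xs (≮⇒≥ t≮)) i<xs j r
      where
      0<xs = A.run-nonempty f L t
      present : ∀ j → j < L → x ∙₁ f j ∈ xs
      present j r = subst (λ a → a ∙₁ f j ∈ xs)
        (trans (A.run-head (f 0) f L t) (sym (nth-past (f 0) xs t (≮⇒≥ t≮))))
        (pair-∈₁ (c 0 (<-≤-trans 0<xs (≮⇒≥ t≮)) 0<xs j r))
      i<xs : i < length xs
      i<xs = subst (λ zs → i < length zs) (A.row-present f x s L present) q

-- Generated subgroups, Lagrange's theorem and greedy tuples

module Generation {n : ℕ} (G : GroupTable n) where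
  open GroupTable G
  open Runs G
  open Group (toGroup G) using (assoc; identityˡ; identityʳ; inverseʳ; inverseˡ)
  open GroupProperties (toGroup G) using (∙-cancelˡ; ∙-cancelʳ)

  -- Positive words only: in a finite group they exhaust the generated subgroup, and right
  -- multiplication by one generator is all that the enumeration does.
  data Gen (f : ℕ → Fin n) (L : ℕ) : Fin n → Set where
    gen : ∀ j → j < L → Gen f L (f j)
    mul : ∀ {x} → Gen f L x → ∀ j → j < L → Gen f L (x ∙ f j)

  Gen-mono : ∀ {f g L L′ x} → L ≤ L′ → (∀ j → j < L → f j ≡ g j) → Gen f L x → Gen g L′ x
  Gen-mono {g = g} le h (gen j p) = subst (Gen g _) (sym (h j p)) (gen j (≤-trans p le))
  Gen-mono {g = g} le h (mul {x} q j p) = subst (λ y → Gen g _ (x ∙ y)) (sym (h j p)) (mul (Gen-mono le h q) j (≤-trans p le))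

  row-gen : ∀ {f x s} L j → j ≤ L → Gen f L x → (∀ {y} → y ∈ proj₁ s → Gen f L y) → ∀ {y} → y ∈ proj₁ (row f x s j) → Gen f L y
  row-gen L zero    p q h y∈ = h y∈
  row-gen {f} {x} {s} L (suc j) p q h y∈ with ∈-put⁻ (x ∙ f j) (proj₁ (row f x s j)) y∈
  ... | inj₁ r    = row-gen L j (<⇒≤ p) q h r
  ... | inj₂ refl = mul q j p

  run-gen : ∀ {f L} t → 0 < L → ∀ {y} → y ∈ proj₁ (run f L t) → Gen f L y
  run-gen zero    p (here refl) = gen 0 p
  run-gen {f} {L} (suc t) p y∈ = row-gen L L ≤-refl pick (run-gen t p) y∈
    where
    pick : Gen f L (nth (f 0) (proj₁ (run f L t)) t)
    pick with t <? length (proj₁ (run f L t))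
    ... | yes q = run-gen t p (nth-∈ (f 0) _ t q)
    ... | no  q = subst (Gen f L) (sym (nth-past (f 0) (proj₁ (run f L t)) t (≮⇒≥ q))) (gen 0 p)

  elements-unique : ∀ f L → Unique (elements f L)
  elements-unique f L = run-unique f L n

  -- The lockstep lemma is applied to a tuple and itself. After n stages every position has been
  -- processed, as a list without repetitions has at most n entries.
  elements-closed : ∀ {f L x} → x ∈ elements f L → ∀ j → j < L → x ∙ f j ∈ elements f L
  elements-closed {f} {L} x∈ j p with ∈-nth (f 0) (elements f L) x∈
  ... | i , q , refl = pair-∈₁ (proj₂ (run-pair n refl) i (≤-trans q (unique≤ (elements-unique f L))) q j p)
    where open Lockstep G G f f L

  -- Right translation by a is injective, hence permutes a finite set closed under it.
  cancel-∈ : ∀ {zs a y} → Unique zs → (∀ {z} → z ∈ zs → z ∙ a ∈ zs) → y ∙ a ∈ zs → y ∈ zs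
  cancel-∈ {zs} {a} {y} u h y∈ with y ∈? zs
  ... | yes p = p
  ... | no ∉  = contradiction (unique-length {xs = map (_∙ a) (y ∷ zs)} (Unique.map⁺ (λ {b} {c} → ∙-cancelʳ a b c) (¬Any⇒All¬ zs ∉ ∷ u)) incl)
                  (<⇒≱ (≤-reflexive (cong suc (sym (length-map (_∙ a) zs)))))
    where
    incl : ∀ {x} → x ∈ map (_∙ a) (y ∷ zs) → x ∈ zs
    incl x∈ with ∈-map⁻ (_∙ a) x∈
    ... | _ , here refl , refl = y∈
    ... | _ , there p   , refl = h p

  gen-mul : ∀ {f L x y} {zs : List (Fin n)} → (∀ {z} → z ∈ zs → ∀ j → j < L → z ∙ f j ∈ zs) → x ∈ zs → Gen f L y → x ∙ y ∈ zs
  gen-mul h x∈ (gen j p) = h x∈ j p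
  gen-mul {x = x} {zs = zs} h x∈ (mul {y} q j p) = subst (_∈ zs) (assoc x y _) (h (gen-mul h x∈ q) j p)

  gen-cancel : ∀ {f L x y} {zs : List (Fin n)} → Unique zs → (∀ {z} → z ∈ zs → ∀ j → j < L → z ∙ f j ∈ zs) → Gen f L y → x ∙ y ∈ zs → x ∈ zs
  gen-cancel u h q x∈ = cancel-∈ u (λ z∈ → gen-mul h z∈ q) x∈

  gen-∈ : ∀ {f L x} → 0 < L → Gen f L x → x ∈ elements f L
  gen-∈ {f} {L} {x} 0<L q = subst (_∈ elements f L) (identityˡ x) (gen-mul elements-closed ε∈ q)
    where
    f0∈ : f 0 ∈ elements f L
    f0∈ = subst (_∈ elements f L) (run-head (f 0) f L n) (nth-∈ (f 0) _ 0 (run-nonempty f L n))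
    -- Nothing puts the identity into the list explicitly; but `ε ∙ f 0` is listed, and `f 0` can be
    -- cancelled on the right.
    ε∈ : ε ∈ elements f L
    ε∈ = gen-cancel (elements-unique f L) elements-closed (gen 0 0<L) (subst (_∈ elements f L) (sym (identityˡ (f 0))) f0∈)

  ∈-gen : ∀ {f L x} → 0 < L → x ∈ elements f L → Gen f L x
  ∈-gen 0<L x∈ = run-gen n 0<L x∈

  -- Lagrange: peel off cosets a · elements until all of G is covered.
  order-∣ : ∀ {f L} → 0 < L → order f L ∣ n
  order-∣ {f} {L} 0<L = go n [] [] (λ ()) (order f L ∣0) (m≤n+m n 0)
    where
    xs = elements f L
    go : ∀ fuel zs → Unique zs → (∀ {z} → z ∈ zs → ∀ j → j < L → z ∙ f j ∈ zs) → order f L ∣ length zs →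
      n ≤ length zs + fuel → order f L ∣ n
    go fuel zs u h d le with all? (_∈? zs)
    ... | yes all = subst (order f L ∣_) (≤-antisym (unique≤ u)
            (≤-trans (≤-reflexive (sym (length-tabulate id))) (unique-length (Unique.allFin⁺ n) (λ {x} _ → all x)))) d
    ... | no ¬all with ¬∀⟶∃¬ n (_∈ zs) (_∈? zs) ¬all
    ... | a , a∉ with fuel
    ... | zero = contradiction (unique-full u (subst (n ≤_) (+-identityʳ _) le) a) a∉
    ... | suc m = go m (map (a ∙_) xs ++ zs)
        (Unique.++⁺ (Unique.map⁺ (λ {b} {c} → ∙-cancelˡ a b c) (elements-unique f L)) u disjoint) closed
        (subst (order f L ∣_) (sym len) (∣m∣n⇒∣m+n ∣-refl d))
        (≤-trans le (≤-trans (≤-reflexive (+-suc (length zs) m)) (+-monoˡ-≤ m (≤-trans (+-monoˡ-≤ (length zs) (run-nonempty f L n)) (≤-reflexive (sym len))))))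
      where
      len : length (map (a ∙_) xs ++ zs) ≡ order f L + length zs
      len = trans (length-++ (map (a ∙_) xs)) (cong (_+ length zs) (length-map (a ∙_) xs))
      disjoint : ∀ {v} → v ∈ map (a ∙_) xs × v ∈ zs → ⊥
      disjoint (p , q) with ∈-map⁻ (a ∙_) p
      ... | x , x∈ , refl = a∉ (gen-cancel u h (∈-gen 0<L x∈) q)
      closed : ∀ {z} → z ∈ map (a ∙_) xs ++ zs → ∀ j → j < L → z ∙ f j ∈ map (a ∙_) xs ++ zs
      closed {z} z∈ j p with ∈-++⁻ (map (a ∙_) xs) z∈
      ... | inj₂ q = ∈-++⁺ʳ (map (a ∙_) xs) (h q j p)
      ... | inj₁ q with ∈-map⁻ (a ∙_) q
      ... | x , x∈ , refl = ∈-++⁺ˡ (subst (_∈ map (a ∙_) xs) (sym (assoc a x (f j))) (∈-map⁺ (a ∙_) (elements-closed x∈ j p)))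

  order-< : ∀ {f L} → 0 < L → ¬ Gen f L (f L) → order f L < order f (suc L)
  order-< {f} {L} p ∉ = unique-length {xs = f L ∷ elements f L} (¬Any⇒All¬ _ (∉ ∘ ∈-gen p) ∷ elements-unique f L) incl
    where
    incl : ∀ {x} → x ∈ f L ∷ elements f L → x ∈ elements f (suc L)
    incl (here refl) = gen-∈ (s≤s z≤n) (gen L (n<1+n L))
    incl (there x∈)  = gen-∈ (s≤s z≤n) (Gen-mono (n≤1+n L) (λ _ _ → refl) (∈-gen p x∈))

  order-full : ∀ {f L} → 0 < L → (∀ x → Gen f L x) → order f L ≡ n
  order-full {f} {L} p h = ≤-antisym (unique≤ (elements-unique f L))
    (≤-trans (≤-reflexive (sym (length-tabulate id))) (unique-length (Unique.allFin⁺ n) (λ {x} _ → gen-∈ p (h x))))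

∣-prime-power : ∀ {p} k {d} → Prime p → d ∣ p ^ k → ∃[ j ] d ≡ p ^ j
∣-prime-power zero    pr d∣ = 0 , ∣1⇒≡1 d∣
∣-prime-power {p} (suc k) {d} pr d∣ with p ∣? d
... | yes (divides q refl) with ∣-prime-power k pr (*-cancelˡ-∣ p {{prime⇒nonZero pr}} (subst (_∣ p * p ^ k) (*-comm q p) d∣))
... | j , refl = suc j , *-comm (p ^ j) p
∣-prime-power {p} (suc k) {d} pr d∣ | no p∤d = ∣-prime-power k pr (coprime-divisor coprime d∣)
  where
  coprime : Coprime d p
  coprime (i∣d , i∣p) with prime⇒irreducible pr i∣p
  ... | inj₁ e    = e
  ... | inj₂ refl = contradiction i∣d p∤d

prime-power-gap : ∀ {p} k {d d′} → Prime p → d ∣ p ^ k → d′ ∣ p ^ k → d < d′ → p * d ≤ d′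
prime-power-gap {p} k pr d∣ d′∣ d<d′ with ∣-prime-power k pr d∣ | ∣-prime-power k pr d′∣
... | i , refl | j , refl = ^-monoʳ-≤ p {{prime⇒nonZero pr}} {suc i} {j} (≰⇒> (λ j≤i → <⇒≱ d<d′ (^-monoʳ-≤ p {{prime⇒nonZero pr}} j≤i)))

-- The first `c₀` entries are arbitrary. This is used with `c₀ = F` for the completions in G and
-- with `c₀ = 1` for the half tuple of H, whose first entry is whatever the memory holds.
record Greedy {n : ℕ} (G : GroupTable n) (f : ℕ → Fin n) (c₀ c₁ : ℕ) : Set where
  open Generation G
  field
    c₀≤c₁ : c₀ ≤ c₁
    all   : ∀ x → Gen f c₁ x
    new   : ∀ c → c₀ ≤ c → c < c₁ → ¬ Gen f c (f c)

module _ {n p k : ℕ} (G : GroupTable n) (pr : Prime p) (n≡ : n ≡ p ^ k) where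
  open Runs G
  open Generation G

  -- The exponent `a` already reached by the first `c₀` entries is a parameter: it is 0 for the half
  -- tuple of H and ⌈k/2⌉ for its completion in G.
  greedy-order : ∀ {f c₀ c₁} a → 0 < c₀ → Greedy G f c₀ c₁ → p ^ a ≤ order f c₀ → ∀ d → d + c₀ ≤ c₁ → p ^ (d + a) ≤ order f (d + c₀)
  greedy-order a 0<c₀ gr h zero    le = h
  greedy-order {f} {c₀} {c₁} a 0<c₀ gr h (suc d) le = ≤-trans (*-monoʳ-≤ p (greedy-order a 0<c₀ gr h d (<⇒≤ le)))
    (prime-power-gap k pr (subst (order f (d + c₀) ∣_) n≡ (order-∣ 0<)) (subst (order f (suc (d + c₀)) ∣_) n≡ (order-∣ (s≤s z≤n)))
      (order-< 0< (Greedy.new gr (d + c₀) (m≤n+m c₀ d) le)))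
    where
    0< = ≤-trans 0<c₀ (m≤n+m c₀ d)

-- Equal codes and isomorphisms

module Collision {n : ℕ} (G H : GroupTable n) where
  open GroupTable G using () renaming (_∙_ to _∙₁_; ε to ε₁; _⁻¹ to _⁻¹₁)
  open GroupTable H using () renaming (_∙_ to _∙₂_; ε to ε₂; _⁻¹ to _⁻¹₂)
  private
    module A = Runs G
    module B = Runs H
    module 𝔾 = Group (toGroup G)
    module ℍ = Group (toGroup H)
    module ℍₚ = GroupProperties (toGroup H)

  module Image (φ : Fin n → Fin n) (inj : ∀ {x y} → φ x ≡ φ y → x ≡ y) (homo : ∀ x y → φ (x ∙₁ y) ≡ φ x ∙₂ φ y) where

    image : Conf n → Conf n
    image (xs , c) = map φ xs , c

    row-image : ∀ f x s j → B.row (φ ∘ f) (φ x) (image s) j ≡ image (A.row f x s j)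
    row-image f x s zero    = refl
    row-image f x s (suc j) = trans (cong₂ visit (sym (homo x (f j))) (row-image f x s j))
      (cong₂ (λ xs i → xs , i + n * c) (put-map inj y xs) (index-map inj y xs))
      where
      y = x ∙₁ f j
      xs = proj₁ (A.row f x s j)
      c = proj₂ (A.row f x s j)

    run-image : ∀ f L t → B.run (φ ∘ f) L t ≡ image (A.run f L t)
    run-image f L zero    = refl
    run-image f L (suc t) = trans
      (cong₂ (λ x s → B.row (φ ∘ f) x s L)
        (trans (cong (λ s → nth (φ (f 0)) (proj₁ s) t) (run-image f L t)) (nth-map φ (f 0) (proj₁ (A.run f L t)) t)) (run-image f L t))
      (row-image f _ (A.run f L t) L)

    -- A code consists of positions only. An injective homomorphism carries the enumeration over
    -- entry by entry, so no position changes.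
    code-image : ∀ f L → B.code (φ ∘ f) L ≡ A.code f L
    code-image f L = cong proj₂ (run-image f L n)

    order-image : ∀ f L → B.order (φ ∘ f) L ≡ A.order f L
    order-image f L = trans (cong (length ∘ proj₁) (run-image f L n)) (length-map φ (A.elements f L))

  -- `Z` pairs the elements at equal positions and is the graph of the isomorphism: without
  -- repetitions a position is determined by its element, and both lists exhaust their groups.
  -- Lockstep makes `Z` compatible with right multiplication by corresponding generators.
  collision⇒≅ : ∀ f g L → 0 < L → n ≤ A.order f L → n ≤ B.order g L → A.code f L ≡ B.code g L → G ≅ H
  collision⇒≅ f g L 0<L full₁ full₂ eq = φ , record
    { isGroupMonomorphism = record
      { isGroupHomomorphism = record
        { isMonoidHomomorphism = record
          { isMagmaHomomorphism = record { isRelHomomorphism = record { cong = cong φ } ; homo = homo }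
          ; ε-homo = ε-homo }
        ; ⁻¹-homo = λ x → ℍₚ.inverseʳ-unique _ _ (trans (sym (homo x (x ⁻¹₁))) (trans (cong φ (𝔾.inverseʳ x)) ε-homo)) }
      ; injective = λ {x} {y} e → Z-injective (graph x) (subst (Z y) (sym e) (graph y)) }
    ; surjective = λ y → preimage y , λ { refl → Z-functional (graph (preimage y)) (graph⁻ y) } }
    where
    open Lockstep G H f g L
    open Generation G using (Gen; gen; mul; ∈-gen)
    xs = A.elements f L
    ys = B.elements g L
    ux = A.run-unique f L n
    uy = B.run-unique g L n
    same = run-pair n eq
    Z = Pair xs ys
    graph : ∀ x → Z x (nth (g 0) ys (index x xs))
    graph x = pair (index x xs) i< (subst (index x xs <_) (proj₁ same) i<) (index-hit (f 0) x xs i<) refl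
      where i< = ∈⇒index< xs (unique-full ux full₁ x)
    φ : Fin n → Fin n
    φ x = nth (g 0) ys (index x xs)
    preimage : Fin n → Fin n
    preimage y = nth (f 0) xs (index y ys)
    graph⁻ : ∀ y → Z (preimage y) y
    graph⁻ y = pair (index y ys) (subst (index y ys <_) (sym (proj₁ same)) i<) i< refl (index-hit (g 0) y ys i<)
      where i< = ∈⇒index< ys (unique-full uy full₂ y)
    Z-functional : ∀ {x y y′} → Z x y → Z x y′ → y ≡ y′
    Z-functional (pair i p _ e e₂) (pair j q _ e′ e₂′) with nth-injective (f 0) xs i j ux p q (trans e (sym e′))
    ... | refl = trans (sym e₂) e₂′
    Z-injective : ∀ {x x′ y} → Z x y → Z x′ y → x ≡ x′
    Z-injective (pair i _ p e e₂) (pair j _ q e′ e₂′) with nth-injective (g 0) ys i j uy p q (trans e₂ (sym e₂′))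
    ... | refl = trans (sym e) e′
    Z-closed : ∀ {x y} → Z x y → ∀ j → j < L → Z (x ∙₁ f j) (y ∙₂ g j)
    Z-closed (pair i p q refl refl) j r = proj₂ same i (≤-trans p (unique≤ ux)) p j r
    Z-base : Z (f 0) (g 0)
    Z-base = pair 0 (A.run-nonempty f L n) (B.run-nonempty g L n) (A.run-head (f 0) f L n) (B.run-head (g 0) g L n)
    -- `φ ε₁ ∙ g 0` and `g 0` are both partners of `ε₁ ∙ f 0 = f 0`, hence equal, and cancelling
    -- `g 0` gives `φ ε₁ = ε₂`.
    Z-ε : Z ε₁ ε₂
    Z-ε = subst (Z ε₁) (ℍₚ.identityˡ-unique _ (g 0) (Z-functional
      (subst (λ x → Z x (φ ε₁ ∙₂ g 0)) (𝔾.identityˡ (f 0)) (Z-closed (graph ε₁) 0 0<L)) Z-base)) (graph ε₁)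
    -- Spelling `y` in the generators yields a `y′` by which all pairs of `Z` can be multiplied at
    -- once. The pair of the identities then shows that `y′` is `φ y`, and the other pairs give the
    -- homomorphism law.
    word : ∀ {y} → Gen f L y → ∃[ y′ ] (∀ {x x′} → Z x x′ → Z (x ∙₁ y) (x′ ∙₂ y′))
    word (gen j p) = g j , λ z → Z-closed z j p
    word (mul {y} q j p) with word q
    ... | y′ , h = y′ ∙₂ g j , λ {x} {x′} z → subst₂ Z (𝔾.assoc x y (f j)) (ℍ.assoc x′ y′ (g j)) (Z-closed (h z) j p)
    homo : ∀ x y → φ (x ∙₁ y) ≡ φ x ∙₂ φ y
    homo x y with word (∈-gen 0<L (unique-full ux full₁ y))
    ... | y′ , h = trans (Z-functional (graph (x ∙₁ y)) (h (graph x)))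
      (cong (φ x ∙₂_) (Z-functional (subst₂ Z (𝔾.identityˡ y) (ℍ.identityˡ y′) (h Z-ε)) (graph y)))
    ε-homo : φ ε₁ ≡ ε₂
    ε-homo = Z-functional (graph ε₁) Z-ε

-- Real exponents

ι : ℕ → ℚᵘ
ι m = ℤ.+ m ℚᵘ./ 1

≤-fraction : ∀ {a b} c d → a * suc d ≤ b * suc c → mkℚᵘ (ℤ.+ a) c ℚᵘ.≤ mkℚᵘ (ℤ.+ b) d
≤-fraction {a} {b} c d h = *≤* (subst₂ ℤ._≤_ (ℤₚ.pos-* a (suc d)) (ℤₚ.pos-* b (suc c)) (ℤ.+≤+ h))

≤-fraction⁻ : ∀ {a b} c d → mkℚᵘ (ℤ.+ a) c ℚᵘ.≤ mkℚᵘ (ℤ.+ b) d → a * suc d ≤ b * suc c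
≤-fraction⁻ {a} {b} c d (*≤* h) = ℤₚ.drop‿+≤+ (subst₂ ℤ._≤_ (sym (ℤₚ.pos-* a (suc d))) (sym (ℤₚ.pos-* b (suc c))) h)

ι-mono : ∀ {a b} → a ≤ b → ι a ℚᵘ.≤ ι b
ι-mono {a} {b} h = ≤-fraction 0 0 (*-monoˡ-≤ 1 h)

ι-cancel : ∀ {a b} → ι a ℚᵘ.≤ ι b → a ≤ b
ι-cancel {a} {b} h = subst₂ _≤_ (*-identityʳ a) (*-identityʳ b) (≤-fraction⁻ 0 0 h)

ι-* : ∀ a b → ι a ℚᵘ.* ι b ≃ ι (a * b)
ι-* a b = *≡* (cong (ℤ._* ℤ.+ 1) (sym (ℤₚ.pos-* a b)))

^ℚ-cong : ∀ {r s} d → r ≃ s → r ^ℚ d ≃ s ^ℚ d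
^ℚ-cong zero    h = ℚₚ.≃-refl
^ℚ-cong (suc d) h = ℚₚ.*-cong h (^ℚ-cong d h)

^ℚ-ι : ∀ m d → ι m ^ℚ d ≃ ι (m ^ d)
^ℚ-ι m zero    = ℚₚ.≃-refl
^ℚ-ι m (suc d) = ℚₚ.≃-trans (ℚₚ.*-congˡ {ι m} (^ℚ-ι m d)) (ι-* m (m ^ d))

^ℚ-nonNeg : ∀ r d .{{_ : NonNegative r}} → NonNegative (r ^ℚ d)
^ℚ-nonNeg r zero    = _
^ℚ-nonNeg r (suc d) = ℚₚ.nonNeg*nonNeg⇒nonNeg r (r ^ℚ d) {{^ℚ-nonNeg r d}}

^ℚ-mono : ∀ {r s} d .{{nn : NonNegative r}} → r ℚᵘ.≤ s → r ^ℚ d ℚᵘ.≤ s ^ℚ d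
^ℚ-mono zero    h = ℚₚ.≤-refl
^ℚ-mono {r} {s} (suc d) {{nn}} h = ℚₚ.*-mono-≤-nonNeg {{nn}} {{^ℚ-nonNeg r d}} h (^ℚ-mono d h)

log-upper : ∀ b n q → upper (log b (fromℕ n)) q → NonNegative q × n ^ ↧ₙ q ≤ b ^ ℤ.∣ ↥ q ∣
log-upper b n q (nn , r , r≃ , h) = nn , ι-cancel (ℚₚ.≤-trans (ℚₚ.≤-reflexive
  (ℚₚ.≃-sym (ℚₚ.≃-trans (^ℚ-cong (↧ₙ q) r≃) (^ℚ-ι n (↧ₙ q))))) h)

log-lower : ∀ b n q → lower (log b (fromℕ n)) q → NonNegative q × b ^ ℤ.∣ ↥ q ∣ ≤ n ^ ↧ₙ q
log-lower b n q (nn , r , r≃ , h) = nn , ι-cancel (ℚₚ.≤-trans h (ℚₚ.≤-reflexive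
  (ℚₚ.≃-trans (^ℚ-cong (↧ₙ q) r≃) (^ℚ-ι n (↧ₙ q)))))

m<n^m : ∀ {d} m → 2 ≤ d → m < d ^ m
m<n^m zero    p = s≤s z≤n
m<n^m {d} (suc m) p = begin-strict
  suc m         ≤⟨ m<n^m m p ⟩
  d ^ m         <⟨ m<m+n (d ^ m) (≤-trans (s≤s z≤n) (m<n^m m p)) ⟩
  d ^ m + d ^ m ≡⟨ cong (λ z → d ^ m + z) (+-identityʳ (d ^ m)) ⟨
  2 * d ^ m     ≤⟨ *-monoˡ-≤ (d ^ m) p ⟩
  d * d ^ m     ∎
  where open ≤-Reasoning

^-cancelˡ-≤ : ∀ b {x y} → 1 < b → b ^ x ≤ b ^ y → x ≤ y
^-cancelˡ-≤ b {x} {y} 1<b h with x ≤? y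
... | yes p = p
... | no  p = contradiction h (<⇒≱ (^-monoʳ-< b 1<b (≰⇒> p)))

-- A smaller base only enlarges the logarithm. So one lemma serves both b = p and b = 2.
log-upper-≥ : ∀ {b p} k q → b ≤ p → 1 < p → upper (log b (fromℕ (p ^ k))) q → ι k ℚᵘ.≤ q
log-upper-≥ {b} {p} k (mkℚᵘ (ℤ.+ c) d) b≤p 1<p u = ≤-fraction 0 d (≤-trans (^-cancelˡ-≤ p 1<p (begin
  p ^ (k * suc d)   ≡⟨ ^-*-assoc p k (suc d) ⟨
  (p ^ k) ^ suc d   ≤⟨ proj₂ (log-upper b (p ^ k) (mkℚᵘ (ℤ.+ c) d) u) ⟩
  b ^ c             ≤⟨ ^-monoˡ-≤ c b≤p ⟩
  p ^ c             ∎)) (≤-reflexive (sym (*-identityʳ c))))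
  where open ≤-Reasoning
log-upper-≥ {b} {p} k (mkℚᵘ -[1+ c ] d) b≤p 1<p (() , _)

^-distribʳ-* : ∀ d x y → (x * y) ^ d ≡ x ^ d * y ^ d
^-distribʳ-* zero    x y = refl
^-distribʳ-* (suc d) x y = trans (cong ((x * y) *_) (^-distribʳ-* d x y)) (interchange x y (x ^ d) (y ^ d))
  where
  interchange : ∀ a b c d → (a * b) * (c * d) ≡ (a * c) * (b * d)
  interchange = solve-∀

sqrt-mono : ∀ {x y} → x * x ≤ y * y → x ≤ y
sqrt-mono {x} {y} h with x ≤? y
... | yes p = p
... | no  p = contradiction h (<⇒≱ (*-mono-< (≰⇒> p) (≰⇒> p)))

-- Squaring removes the half from the exponent: the hypothesis on `t * t` has a natural number as
-- its exponent even for odd k, and the conclusion is recovered by monotonicity of the square root.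
power-bound : ∀ {t n k C} q .{{_ : NonZero n}} → t * t ≤ n ^ (k + 2 * C) →
  ℚᵘ.½ ℚᵘ.* ι k ℚᵘ.+ ι C ℚᵘ.≤ q → t ^ ↧ₙ q ≤ n ^ ℤ.∣ ↥ q ∣
power-bound {t} {n} {k} {C} (mkℚᵘ (ℤ.+ c) d) h le = sqrt-mono (begin
  t ^ suc d * t ^ suc d          ≡⟨ ^-distribʳ-* (suc d) t t ⟨
  (t * t) ^ suc d                ≤⟨ ^-monoˡ-≤ (suc d) h ⟩
  (n ^ (k + 2 * C)) ^ suc d      ≡⟨ ^-*-assoc n (k + 2 * C) (suc d) ⟩
  n ^ ((k + 2 * C) * suc d)      ≤⟨ ^-monoʳ-≤ n (≤-fraction⁻ 1 d (ℚₚ.≤-trans (ℚₚ.≤-reflexive (ℚₚ.≃-sym eq)) le)) ⟩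
  n ^ (c * 2)                    ≡⟨ cong (n ^_) (trans (*-comm c 2) (cong (c +_) (+-identityʳ c))) ⟩
  n ^ (c + c)                    ≡⟨ ^-distribˡ-+-* n c c ⟩
  n ^ c * n ^ c                  ∎)
  where
  open ≤-Reasoning
  eq : ℚᵘ.½ ℚᵘ.* ι k ℚᵘ.+ ι C ≃ mkℚᵘ (ℤ.+ (k + 2 * C)) 1
  eq = *≡* (cong (ℤ._* ℤ.+ 2) (trans (cong₂ ℤ._+_ (trans (ℤₚ.*-identityʳ _) (ℤₚ.*-identityˡ (ℤ.+ k))) (trans (sym (ℤₚ.pos-* C 2)) (cong ℤ.+_ (*-comm C 2)))) refl))
power-bound {t} {n} {k} {C} (mkℚᵘ -[1+ c ] d) h le with ℚₚ.≤-trans nonneg le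
  where
  nonneg : ι 0 ℚᵘ.≤ ℚᵘ.½ ℚᵘ.* ι k ℚᵘ.+ ι C
  nonneg = ℚₚ.+-mono-≤ {ι 0} {ℚᵘ.½ ℚᵘ.* ι k} {ι 0} {ι C} (ℚₚ.*-mono-≤-nonNeg {ι 0} {ℚᵘ.½} {ι 0} {ι k} (≤-fraction 0 1 z≤n) (ι-mono {0} z≤n)) (ι-mono {0} z≤n)
... | *≤* ()

half-upper : ∀ {a l h k} → a ≃ h ℚᵘ.* l → h ≃ ℚᵘ.½ → ι k ℚᵘ.≤ l → ℚᵘ.½ ℚᵘ.* ι k ℚᵘ.≤ a
half-upper {a} {l} e e′ le = ℚₚ.≤-trans (ℚₚ.*-monoʳ-≤-nonNeg ℚᵘ.½ le)
  (ℚₚ.≤-reflexive (ℚₚ.≃-sym (ℚₚ.≃-trans e (ℚₚ.*-congʳ {l} e′))))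

sum-upper : ∀ {q a b a′ b′} → q ≃ a ℚᵘ.+ b → a′ ℚᵘ.≤ a → b′ ℚᵘ.≤ b → a′ ℚᵘ.+ b′ ℚᵘ.≤ q
sum-upper e h h′ = ℚₚ.≤-trans (ℚₚ.+-mono-≤ h h′) (ℚₚ.≤-reflexive (ℚₚ.≃-sym e))

-- The factor `2 * C` pays for a quotient of logarithms that is only known to be at least ½.
product-upper : ∀ {b c x} C {D} → b ≃ c ℚᵘ.* x → c ≃ ι (2 * C) → ℚᵘ.½ ℚᵘ.≤ x → D ≤ C → ι D ℚᵘ.≤ b
product-upper {b} {c} {x} C e e′ h D≤C = ℚₚ.≤-trans (ι-mono D≤C) (ℚₚ.≤-trans (ℚₚ.≤-trans (ℚₚ.≤-reflexive half) (ℚₚ.*-monoʳ-≤-nonNeg (ι (2 * C)) h))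
  (ℚₚ.≤-reflexive (ℚₚ.≃-sym (ℚₚ.≃-trans e (ℚₚ.*-congʳ {x} e′)))))
  where
  half : ι C ≃ ι (2 * C) ℚᵘ.* ℚᵘ.½
  half = *≡* (trans (sym (ℤₚ.pos-* C 2)) (trans (cong ℤ.+_ (*-comm C 2))
    (sym (trans (ℤₚ.*-identityʳ _) (ℤₚ.*-identityʳ (ℤ.+ (2 * C)))))))

-- log₂ y ≤ ⌈y⌉ ≤ 2 y for y = log₂ n ≥ 1.
quotient-≥ : ∀ {n} x → 2 ≤ n → upper (log 2 (fromℕ n) ⊘ log 2 (log 2 (fromℕ n))) x → ℚᵘ.½ ℚᵘ.≤ x
quotient-≥ {n} x 2≤n (a , b , ua , (nb , r , lr , hb) , pos , e) =
  ℚₚ.*-cancelʳ-≤-pos b {{pos}} (ℚₚ.≤-trans (go a b r nb ua lr hb) (ℚₚ.≤-reflexive (ℚₚ.≃-sym e)))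
  where
  go : ∀ a b r → NonNegative b → upper (log 2 (fromℕ n)) a → lower (log 2 (fromℕ n)) r →
    ι (2 ^ ℤ.∣ ↥ b ∣) ℚᵘ.≤ r ^ℚ (↧ₙ b) → ℚᵘ.½ ℚᵘ.* b ℚᵘ.≤ a
  go (mkℚᵘ -[1+ _ ] _) _ _ _ (() , _) _ _
  go (mkℚᵘ (ℤ.+ c) d) b (mkℚᵘ -[1+ _ ] _) _ _ (() , _) _
  go (mkℚᵘ (ℤ.+ c) d) (mkℚᵘ -[1+ _ ] _) (mkℚᵘ (ℤ.+ f) g) () _ _ _
  go (mkℚᵘ (ℤ.+ c) d) (mkℚᵘ (ℤ.+ u) v) (mkℚᵘ (ℤ.+ f) g) nb ua lr hb =
    ℚₚ.≤-trans (ℚₚ.*-monoʳ-≤-nonNeg ℚᵘ.½ (≤-fraction v 0 (≤-trans (≤-reflexive (*-identityʳ u)) u≤mv)))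
      (ℚₚ.≤-trans (ℚₚ.≤-reflexive (ℚₚ.≃-sym halfm)) (≤-fraction 1 d md≤2c))
    where
    -- An integer above the upper approximation `a = c / suc d` of log₂ n. It is at most 2 a because
    -- a ≥ 1, which is where 2 ≤ n enters (`d≤c`).
    m = suc (c / suc d)
    c≤md : c ≤ m * suc d
    c≤md = ≤-trans (≤-reflexive (m≡m%n+[m/n]*n c (suc d))) (+-monoˡ-≤ _ (<⇒≤ (m%n<n c (suc d))))
    d≤c : suc d ≤ c
    d≤c = ^-cancelˡ-≤ 2 (s≤s (s≤s z≤n)) (≤-trans (^-monoˡ-≤ (suc d) 2≤n) (proj₂ (log-upper 2 n (mkℚᵘ (ℤ.+ c) d) ua)))
    md≤2c : m * suc d ≤ c * 2
    md≤2c = ≤-trans (+-mono-≤ d≤c (m/n*n≤m c (suc d))) (≤-reflexive (trans (cong (λ z → c + z) (sym (+-identityʳ c))) (*-comm 2 c)))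
    fd≤cg : f * suc d ≤ c * suc g
    fd≤cg = ^-cancelˡ-≤ 2 (s≤s (s≤s z≤n)) (begin
      2 ^ (f * suc d)    ≡⟨ ^-*-assoc 2 f (suc d) ⟨
      (2 ^ f) ^ suc d    ≤⟨ ^-monoˡ-≤ (suc d) (proj₂ (log-lower 2 n (mkℚᵘ (ℤ.+ f) g) lr)) ⟩
      (n ^ suc g) ^ suc d ≡⟨ trans (^-*-assoc n (suc g) (suc d)) (trans (cong (n ^_) (*-comm (suc g) (suc d))) (sym (^-*-assoc n (suc d) (suc g)))) ⟩
      (n ^ suc d) ^ suc g ≤⟨ ^-monoˡ-≤ (suc g) (proj₂ (log-upper 2 n (mkℚᵘ (ℤ.+ c) d) ua)) ⟩
      (2 ^ c) ^ suc g     ≡⟨ ^-*-assoc 2 c (suc g) ⟩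
      2 ^ (c * suc g)     ∎)
      where open ≤-Reasoning
    f≤mg : f * 1 ≤ m * suc g
    f≤mg = *-cancelʳ-≤ (f * 1) (m * suc g) (suc d) (begin
      f * 1 * suc d      ≡⟨ cong (_* suc d) (*-identityʳ f) ⟩
      f * suc d          ≤⟨ fd≤cg ⟩
      c * suc g          ≤⟨ *-monoˡ-≤ (suc g) c≤md ⟩
      m * suc d * suc g  ≡⟨ trans (*-assoc m (suc d) (suc g)) (trans (cong (m *_) (*-comm (suc d) (suc g))) (sym (*-assoc m (suc g) (suc d)))) ⟩
      m * suc g * suc d  ∎)
      where open ≤-Reasoning
    -- With `b = u / suc v` and `r ≤ m`, the chain is `2 ^ u ≤ r ^ suc v ≤ m ^ suc v ≤ (2 ^ m) ^ suc
    -- v`, the last step by m < 2 ^ m.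
    u≤mv : u ≤ m * suc v
    u≤mv = ^-cancelˡ-≤ 2 (s≤s (s≤s z≤n)) (≤-trans (ι-cancel (ℚₚ.≤-trans hb
      (ℚₚ.≤-trans (^ℚ-mono {mkℚᵘ (ℤ.+ f) g} {ι m} (suc v) (≤-fraction g 0 f≤mg)) (ℚₚ.≤-reflexive (^ℚ-ι m (suc v))))))
      (≤-trans (^-monoˡ-≤ (suc v) (<⇒≤ (m<n^m m ≤-refl))) (≤-reflexive (^-*-assoc 2 m (suc v)))))
    halfm : mkℚᵘ (ℤ.+ m) 1 ≃ ℚᵘ.½ ℚᵘ.* ι m
    halfm = *≡* (cong (ℤ._* ℤ.+ 2) (sym (ℤₚ.*-identityˡ (ℤ.+ m))))

module _ {t p k C₀ : ℕ} (1<p : 1 < p) (bound : t * t ≤ (p ^ k) ^ (k + 2 * C₀)) where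

  private
    instance
      n≢0 : NonZero (p ^ k)
      n≢0 = m^n≢0 p k {{>-nonZero (<⇒≤ 1<p)}}

  -- Both terms of the minimum are weakenings of k / 2 + C₀: the first by `C₀ ≤ C₀ * p`, the second
  -- by `½ k ≤ k`.
  bound-min : t ≤ p ^ k ^ʳ min (½ ⊗ log p (fromℕ (p ^ k)) ⊕ fromℕ C₀ ⊗ fromℕ p) (log p (fromℕ (p ^ k)) ⊕ fromℕ C₀)
  bound-min q (inj₁ (a , b , (h , l , h≃ , lu , a≃) , (c , p′ , c≃ , p≃ , b≃) , q≃)) = power-bound {t} {p ^ k} {k} {C₀} q bound
    (sum-upper q≃ (half-upper {k = k} a≃ h≃ (log-upper-≥ k l ≤-refl 1<p lu))
      (ℚₚ.≤-trans (ι-mono (m≤m*n C₀ p {{>-nonZero (<⇒≤ 1<p)}})) (ℚₚ.≤-reflexive (ℚₚ.≃-sym (ℚₚ.≃-trans b≃ (ℚₚ.≃-trans (ℚₚ.*-cong c≃ p≃) (ι-* C₀ p)))))))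
  bound-min q (inj₂ (l , b , lu , b≃ , q≃)) = power-bound {t} {p ^ k} {k} {C₀} q bound
    (sum-upper q≃ (ℚₚ.≤-trans half≤ (log-upper-≥ k l ≤-refl 1<p lu)) (ℚₚ.≤-reflexive (ℚₚ.≃-sym b≃)))
    where
    half≤ : ℚᵘ.½ ℚᵘ.* ι k ℚᵘ.≤ ι k
    half≤ = ℚₚ.≤-trans (ℚₚ.*-monoˡ-≤-nonNeg (ι k) {ℚᵘ.½} {ι 1} (≤-fraction 1 0 (s≤s z≤n))) (ℚₚ.≤-reflexive (ℚₚ.*-identityˡ (ι k)))

  bound-loglog : 2 ≤ p ^ k → t ≤ p ^ k ^ʳ (½ ⊗ log p (fromℕ (p ^ k)) ⊕ fromℕ (2 * C₀) ⊗ (log 2 (fromℕ (p ^ k)) ⊘ log 2 (log 2 (fromℕ (p ^ k)))))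
  bound-loglog 2≤n q (a , b , (h , l , h≃ , lu , a≃) , (c , x , c≃ , xu , b≃) , q≃) = power-bound {t} {p ^ k} {k} {C₀} q bound
    (sum-upper q≃ (half-upper {k = k} a≃ h≃ (log-upper-≥ k l ≤-refl 1<p lu)) (product-upper C₀ b≃ c≃ (quotient-≥ x 2≤n xu) ≤-refl))

  bound-log : t ≤ p ^ k ^ʳ (½ ⊗ log 2 (fromℕ (p ^ k)) ⊕ fromℕ C₀)
  bound-log q (a , b , (h , l , h≃ , lu , a≃) , b≃ , q≃) = power-bound {t} {p ^ k} {k} {C₀} q bound
    (sum-upper q≃ (half-upper {k = k} a≃ h≃ (log-upper-≥ k l 1<p 1<p lu)) (ℚₚ.≤-reflexive (ℚₚ.≃-sym b≃)))

-- The program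

-- With w = R[#W], the memory holds the input below w, the current tuple from w on, the list of elements
-- found from 2w on, and a flag for the code c at 3w + c.  #T is the address of the table in use, #O the
-- address of the half of the tuple that is being varied, and N = n ^ F is the number of its values.
#n #one #W #F #L #N #T #X #Z #O #ans #c0 #c1 #c2 #c3 #c4 : Reg
#cur #i #len #code #x #row #j #y #idx #v #t #y0 : Reg
#n    = # 1
#one  = # 2
#W    = # 3
#F    = # 4
#L    = # 5
#N    = # 6
#T    = # 7
#X    = # 8
#Z    = # 9
#O    = # 10
#ans  = # 11
#c0   = # 12
#c1   = # 13
#c2   = # 14
#c3   = # 15
#c4   = # 16
#cur  = # 17
#i    = # 18
#len  = # 19
#code = # 20
#x    = # 21
#row  = # 22
#j    = # 23
#y    = # 24
#idx  = # 25
#v    = # 26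
#t    = # 27
#y0   = # 28

-- dst ← src + cnt * inc
addmul : (dst src inc cnt cap : Reg) → Stmt
addmul dst src inc cnt cap = op (move dst src) ⨾ loop #c4 cnt cap (op (add dst dst inc))

-- #idx ← the first position of #y in the list, or #len if there is none.
searchBody : Stmt
searchBody =
    op (add #t #X #idx) ⨾ op (load #v #t) ⨾ op (sub #t #v #y) ⨾ op (sub #v #y #v) ⨾ op (add #t #t #v)
  ⨾ op (sub #t #one #t) ⨾ op (sub #t #one #t) ⨾ op (add #idx #idx #t)

search : Stmt
search = op (set0 #idx) ⨾ loop #c4 #len #W searchBody

jPre : Stmt
jPre = op (add #t #W #j) ⨾ op (load #t #t) ⨾ op (add #t #row #t) ⨾ op (load #y #t) ⨾ op (sub #y #y #one)

jMul : Stmt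
jMul = addmul #v #idx #code #n #n

jPost : Stmt
jPost = op (move #code #v) ⨾ op (add #t #X #idx) ⨾ op (store #t #y) ⨾ op (sub #t #len #idx) ⨾ op (sub #t #one #t)
  ⨾ op (add #len #len #t) ⨾ op (add #j #j #one)

jBody : Stmt
jBody = jPre ⨾ search ⨾ jMul ⨾ jPost

-- A loop whose count is the minimum of a number and 1 acts as a conditional. If `i` is past the end
-- of the list, position 0 stands in for it; it holds `f 0`, the default used by `run`.
iPick : Stmt
iPick = (op (set0 #v) ⨾ op (sub #t #len #i)) ⨾ loop #c4 #t #one (op (move #v #i))

iLoad : Stmt
iLoad = op (add #t #X #v) ⨾ op (load #x #t)

iRow : Stmt
iRow = addmul #row #T #n #x #n ⨾ op (set0 #j)

iLoop : Stmt
iLoop = loop #c3 #cur #W jBody ⨾ op (add #i #i #one)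

iBody : Stmt
iBody = iPick ⨾ iLoad ⨾ iRow ⨾ iLoop

closureInit : Stmt
closureInit = op (load #t #W) ⨾ op (store #X #t) ⨾ op (set1 #len) ⨾ op (set0 #code) ⨾ op (set0 #i)

closure : Stmt
closure = closureInit ⨾ loop #c2 #n #n iBody

-- Correctness of the elementary loops

write-hit : ∀ M a v → write M a v a ≡ v
write-hit M a v with a ≡ᵇ a | ≡⇒≡ᵇ a a refl
... | true | _ = refl

write-miss : ∀ M a v {x} → x ≢ a → write M a v x ≡ M x
write-miss M a v {x} h with x ≡ᵇ a in e
... | false = refl
... | true  = contradiction (≡ᵇ⇒≡ x a (subst T (sym e) _)) h

trips : ∀ c a b σ → (c == b) ≡ false → reg σ a ≤ reg σ b → reg (init c a b σ) c ≡ reg σ a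
trips c a b σ p le = trans (≔-same (reg (apply (sub c b a) σ)) c _)
  (trans (cong₂ _∸_ (apply-keep (sub c b a) b σ p) (≔-same (reg σ) c _)) (m∸[m∸n]≡n le))

addmul-spec : ∀ dst src inc cnt cap σ → (dst == inc) ≡ false → (dst == cnt) ≡ false → (dst == cap) ≡ false →
  (#c4 == inc) ≡ false → (dec == inc) ≡ false → (#c4 == cap) ≡ false → (#c4 == dst) ≡ false → (dec == dst) ≡ false →
  reg σ cnt ≤ reg σ cap → reg (⟦ addmul dst src inc cnt cap ⟧ σ) dst ≡ reg σ src + reg σ cnt * reg σ inc
addmul-spec dst src inc cnt cap σ p₁ p₂ p₃ p₄ p₅ p₆ p₇ p₈ le =
  loop-rule #c4 cnt cap (op (add dst dst inc)) σ₁ P (reg σ cnt)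
    (trans (trips #c4 cnt cap σ₁ p₆ (subst₂ _≤_ (sym e₂) (sym e₃) le)) e₂)
    (trans (init-keep #c4 cnt cap dst σ₁ p₇) (trans (≔-same (reg σ) dst _) (sym (+-identityʳ _))))
    step
  where
  σ₁ = apply (move dst src) σ
  e₁ = apply-keep (move dst src) inc σ p₁
  e₂ = apply-keep (move dst src) cnt σ p₂
  e₃ = apply-keep (move dst src) cap σ p₃
  P : ℕ → Store → Set
  P j σ′ = reg σ′ dst ≡ reg σ src + j * reg σ inc
  step : ∀ j k σ′ → j < reg σ cnt → k < reg σ cnt → Frame (loop #c4 cnt cap (op (add dst dst inc))) σ₁ σ′ → P j σ′ →
    P (suc j) (apply (add dst dst inc) (tick #c4 k σ′))
  step j k σ′ _ _ fr h = trans (≔-same (reg (tick #c4 k σ′)) dst _) (trans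
    (cong₂ _+_ (trans (tick-keep #c4 k dst σ′ p₇ p₈) h)
      (trans (tick-keep #c4 k inc σ′ p₄ p₅) (trans (fr inc (cong₂ _∨_ p₄ (cong₂ _∨_ p₅ p₁))) e₁)))
    (trans (+-assoc (reg σ src) (j * reg σ inc) (reg σ inc)) (cong (λ z → reg σ src + z) (+-comm (j * reg σ inc) (reg σ inc)))))

-- With o = 1 this is min(1, |v - y|), a test for inequality without a branch: the sum of the two
-- truncated differences is the distance. `searchBody` adds this value to `#idx`.
neq : ℕ → ℕ → ℕ → ℕ
neq o v y = o ∸ (o ∸ ((v ∸ y) + (y ∸ v)))

neq-same : ∀ {v y} → v ≡ y → neq 1 v y ≡ 0
neq-same {v} refl rewrite n∸n≡0 v = refl

neq-diff : ∀ {v y} → v ≢ y → neq 1 v y ≡ 1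
neq-diff {v} {y} h with (v ∸ y) + (y ∸ v) in e
... | zero  = contradiction (≤-antisym (m∸n≡0⇒m≤n (m+n≡0⇒m≡0 (v ∸ y) e)) (m∸n≡0⇒m≤n (m+n≡0⇒n≡0 (v ∸ y) e))) h
... | suc m = cong (1 ∸_) (0∸n≡0 m)

-- The loop always makes one round per list entry. Before the first match `#idx` advances with the
-- round number; from then on it stays, because the cell that it points to keeps matching.
search-spec : ∀ {n} (d : Fin n) (xs : List (Fin n)) (y : Fin n) σ → reg σ #one ≡ 1 → reg σ #len ≡ length xs →
  length xs ≤ reg σ #W → reg σ #y ≡ toℕ y → (∀ i → i < length xs → mem σ (reg σ #X + i) ≡ toℕ (nth d xs i)) →
  reg (⟦ search ⟧ σ) #idx ≡ index y xs
search-spec d xs y σ e1 el le ey hx = finish (loop-rule #c4 #len #W searchBody σ₁ P (length xs)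
    (trans (trips #c4 #len #W σ₁ refl (≤-trans (≤-reflexive el) le)) el)
    (refl , inj₁ (z≤n , refl)) step)
  where
  σ₁ = apply (set0 #idx) σ
  ix = index y xs
  P : ℕ → Store → Set
  P j σ′ = mem σ′ ≡ mem σ × ((j ≤ ix × reg σ′ #idx ≡ j) ⊎ (ix ≤ j × reg σ′ #idx ≡ ix))
  finish : P (length xs) (⟦ search ⟧ σ) → reg (⟦ search ⟧ σ) #idx ≡ ix
  finish (_ , inj₁ (p , e)) = trans e (≤-antisym p (index≤ y xs))
  finish (_ , inj₂ (_ , e)) = e
  step : ∀ j k σ′ → j < length xs → k < length xs → Frame (loop #c4 #len #W searchBody) σ₁ σ′ → P j σ′ →
    P (suc j) (⟦ searchBody ⟧ (tick #c4 k σ′))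
  step j k σ′ j< k< fr (em , h) = em , go h
    where
    body : ∀ {m} → reg σ′ #idx ≡ m → reg (⟦ searchBody ⟧ (tick #c4 k σ′)) #idx ≡ m + neq 1 (mem σ (reg σ #X + m)) (toℕ y)
    body {m} e = trans (cong₃ (λ a b c → reg σ′ #idx + neq a b c) (trans (fr #one refl) e1)
        (cong₂ (λ M a → M (a + reg σ′ #idx)) em (fr #X refl)) (trans (fr #y refl) ey))
      (cong (λ m → m + neq 1 (mem σ (reg σ #X + m)) (toℕ y)) e)
      where
      cong₃ : ∀ (f : ℕ → ℕ → ℕ → ℕ) {a a′ b b′ c c′} → a ≡ a′ → b ≡ b′ → c ≡ c′ → f a b c ≡ f a′ b′ c′
      cong₃ f refl refl refl = refl
    stay : ix ≤ j → reg σ′ #idx ≡ ix → reg (⟦ searchBody ⟧ (tick #c4 k σ′)) #idx ≡ ix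
    stay p e = trans (body e) (trans (cong (λ z → ix + z) (neq-same (trans (hx ix ix<) (cong toℕ (index-hit d y xs ix<))))) (+-identityʳ ix))
      where ix< = ≤-<-trans p j<
    go : (j ≤ ix × reg σ′ #idx ≡ j) ⊎ (ix ≤ j × reg σ′ #idx ≡ ix) →
      (suc j ≤ ix × reg (⟦ searchBody ⟧ (tick #c4 k σ′)) #idx ≡ suc j) ⊎ (ix ≤ suc j × reg (⟦ searchBody ⟧ (tick #c4 k σ′)) #idx ≡ ix)
    go (inj₂ (p , e)) = inj₂ (m≤n⇒m≤1+n p , stay p e)
    go (inj₁ (p , e)) with m≤n⇒m<n∨m≡n p
    ... | inj₂ refl = inj₂ (n≤1+n j , stay ≤-refl e)
    ... | inj₁ j<ix = inj₁ (j<ix , trans (body e) (trans (cong (λ z → j + z)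
            (neq-diff (λ q → index-before d y xs j j<ix (toℕ-injective (trans (sym (hx j j<)) q))))) (+-comm j 1)))

-- The enumeration computed in memory

decode : ∀ {n} → Fin n → ℕ → Fin n
decode {n} d v with v <? n
... | yes p = fromℕ< p
... | no  _ = d

toℕ-decode : ∀ {n} (d : Fin n) {v} → v < n → toℕ (decode d v) ≡ v
toℕ-decode {n} d {v} p with v <? n
... | yes q = toℕ-fromℕ< q
... | no ¬q = contradiction p ¬q

decode-toℕ : ∀ {n} (d x : Fin n) → decode d (toℕ x) ≡ x
decode-toℕ d x = toℕ-injective (toℕ-decode d (toℕ<n x))

-- Indexed by register values instead of a store, so that it carries over definitionally to `tick`
-- and to assignments of other registers.
record EnvV (n w b vn v1 vW vX vT : ℕ) : Set where
  constructor env
  field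
    n≡   : vn ≡ n
    one≡ : v1 ≡ 1
    W≡   : vW ≡ w
    X≡   : vX ≡ w + w
    T≡   : vT ≡ b

Env : (n w b : ℕ) → Store → Set
Env n w b σ = EnvV n w b (reg σ #n) (reg σ #one) (reg σ #W) (reg σ #X) (reg σ #T)

envRegs : Stmt → Bool
envRegs s = assigns s #n ∨ (assigns s #one ∨ (assigns s #W ∨ (assigns s #X ∨ assigns s #T)))

env-frame : ∀ s {n w b} σ σ′ → envRegs s ≡ false → Frame s σ σ′ → Env n w b σ → Env n w b σ′
env-frame s σ σ′ p fr (env a b c d e) with ∨-false {assigns s #n} p
... | q₁ , p₁ with ∨-false {assigns s #one} p₁
... | q₂ , p₂ with ∨-false {assigns s #W} p₂
... | q₃ , p₃ with ∨-false {assigns s #X} p₃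
... | q₄ , q₅ = env (trans (fr #n q₁) a) (trans (fr #one q₂) b) (trans (fr #W q₃) c) (trans (fr #X q₄) d) (trans (fr #T q₅) e)

-- The continuation gets the intermediate store as a variable: the term ⟦ s ⟧ σ itself is too large to compute with.
seq : ∀ {ℓ} u s t → u ≡ s ⨾ t → (Q : Store → Set ℓ) → ∀ σ →
  (∀ σ′ → Frame s σ σ′ → (stores s ≡ false → mem σ′ ≡ mem σ) → σ′ ≡ ⟦ s ⟧ σ → Q (⟦ t ⟧ σ′)) → Q (⟦ u ⟧ σ)
seq u s t refl Q σ h = h (⟦ s ⟧ σ) (λ e → keep s e σ) (keepMem s σ) refl

iPick-spec : ∀ l t σ → reg σ #len ≡ l → reg σ #i ≡ t → reg σ #one ≡ 1 →
  (t < l × reg (⟦ iPick ⟧ σ) #v ≡ t) ⊎ (l ≤ t × reg (⟦ iPick ⟧ σ) #v ≡ 0)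
iPick-spec l t σ el ei e1 with l ∸ t in eq
... | zero  = inj₂ (m∸n≡0⇒m≤n eq , loop-rule #c4 #t #one (op (move #v #i)) σ₁ (λ _ σ′ → reg σ′ #v ≡ 0) 0
    (trans (cong₂ (λ a b → a ∸ (a ∸ b)) e1 (trans (cong₂ _∸_ el ei) eq)) refl) refl (λ j k σ′ ()))
  where σ₁ = ⟦ op (set0 #v) ⨾ op (sub #t #len #i) ⟧ σ
... | suc m = inj₁ (m∸n≢0⇒n<m (λ q → 1+n≢0 (trans (sym eq) q)) ,
    loop-rule #c4 #t #one (op (move #v #i)) σ₁ P 1
    (trans (cong₂ (λ a b → a ∸ (a ∸ b)) e1 (trans (cong₂ _∸_ el ei) eq)) (cong (1 ∸_) (0∸n≡0 m)))
    (λ ()) (λ j k σ′ _ _ fr _ _ → trans (fr #i refl) ei) (s≤s z≤n))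
  where
  σ₁ = ⟦ op (set0 #v) ⨾ op (sub #t #len #i) ⟧ σ
  P : ℕ → Store → Set
  P j σ′ = 0 < j → reg σ′ #v ≡ t

module Closure {n : ℕ} (G : GroupTable n) (w b : ℕ) (bn≤w : b + n * n ≤ w) (n≤w : n ≤ w) where
  open GroupTable G using (_∙_)
  open Runs G

  -- `tab` has a successor because the input numbers the elements from 1. `slot` and `aux` also feed
  -- the cost analysis: they keep the cells of the tuple and list zones below n.
  record Input (M : ℕ → ℕ) : Set where
    field
      tab  : ∀ x y → M (b + toℕ x * n + toℕ y) ≡ suc (toℕ (x ∙ y))
      slot : ∀ j → j < w → M (w + j) < n
      aux  : ∀ i → i < w → M (w + w + i) < n
  open Input

  record Agree (M₀ M : ℕ → ℕ) : Set where
    field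
      low  : ∀ a → a < w + w → M a ≡ M₀ a
      high : ∀ a → w + w + w ≤ a → M a ≡ M₀ a
      aux′ : ∀ i → i < w → M (w + w + i) < n
  open Agree

  record Holds (M₀ : ℕ → ℕ) (d : Fin n) (s : Conf n) (vlen vcode : ℕ) (M : ℕ → ℕ) : Set where
    constructor holds
    field
      len≡  : vlen ≡ length (proj₁ s)
      code≡ : vcode ≡ proj₂ s
      arr   : ∀ i → i < length (proj₁ s) → M (w + w + i) ≡ toℕ (nth d (proj₁ s) i)
      agree : Agree M₀ M
  open Holds

  cell< : ∀ (x y : Fin n) → b + toℕ x * n + toℕ y < b + n * n
  cell< x y = ≤-trans (≤-reflexive (sym (+-suc (b + toℕ x * n) (toℕ y)))) (≤-trans (+-monoʳ-≤ (b + toℕ x * n) (toℕ<n y))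
    (≤-trans (≤-reflexive (trans (+-assoc b (toℕ x * n) n) (cong (λ z → b + z) (+-comm (toℕ x * n) n)))) (+-monoʳ-≤ b (*-monoˡ-≤ n (toℕ<n x)))))

  agree-write : ∀ {M₀ M} i v → i < w → v < n → Agree M₀ M → Agree M₀ (write M (w + w + i) v)
  agree-write {M₀} {M} i v i<w v<n h = record
    { low  = λ a p → trans (write-miss M (w + w + i) v (<⇒≢ (≤-trans p (m≤m+n (w + w) i)))) (low h a p)
    ; high = λ a p → trans (write-miss M (w + w + i) v (>⇒≢ (<-≤-trans (+-monoʳ-< (w + w) i<w) p))) (high h a p)
    ; aux′ = new }
    where
    new : ∀ j → j < w → write M (w + w + i) v (w + w + j) < n
    new j p with j ≟ i
    ... | yes refl = subst (_< n) (sym (write-hit M (w + w + i) v)) v<n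
    ... | no  j≢i  = subst (_< n) (sym (write-miss M (w + w + i) v (j≢i ∘ +-cancelˡ-≡ (w + w) j i))) (aux′ h j p)

  module _ {M₀ : ℕ → ℕ} (d : Fin n) (f : ℕ → Fin n) (inp : Input M₀) where

    HoldsAt : Conf n → Store → Set
    HoldsAt s σ = Holds M₀ d s (reg σ #len) (reg σ #code) (mem σ)

    jPost-spec : ∀ σ {M} xs c y j → Env n w b σ → Unique xs → mem σ ≡ M → Agree M₀ M →
      (∀ i → i < length xs → M (w + w + i) ≡ toℕ (nth d xs i)) → reg σ #len ≡ length xs → reg σ #v ≡ index y xs + n * c →
      reg σ #idx ≡ index y xs → reg σ #y ≡ toℕ y → reg σ #j ≡ j →
      HoldsAt (visit y (xs , c)) (⟦ jPost ⟧ σ) × reg (⟦ jPost ⟧ σ) #j ≡ suc j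
    jPost-spec σ {M} xs c y j (env _ one₃ _ X₃ _) u em ag ar el evv eix ey ej =
      holds (trans (cong₂ _+_ el (cong₂ _∸_ one₃ (cong₂ _∸_ el eix))) (sym (length-put y xs))) evv arr′
        (subst (Agree M₀) (sym mem≡) (agree-write ix (toℕ y) (≤-trans (index<n y u) n≤w) (toℕ<n y) ag)) ,
      trans (cong₂ _+_ ej one₃) (+-comm j 1)
      where
      ix = index y xs
      mem≡ : mem (⟦ jPost ⟧ σ) ≡ write M (w + w + ix) (toℕ y)
      mem≡ = trans (cong (λ M → write M (reg σ #X + reg σ #idx) (reg σ #y)) em)
        (cong₂ (write M) (cong₂ _+_ X₃ eix) ey)
      arr′ : ∀ i → i < length (put y xs) → mem (⟦ jPost ⟧ σ) (w + w + i) ≡ toℕ (nth d (put y xs) i)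
      arr′ i p = trans (cong (λ M → M (w + w + i)) mem≡) (go (i ≟ ix))
        where
        go : Dec (i ≡ ix) → write M (w + w + ix) (toℕ y) (w + w + i) ≡ toℕ (nth d (put y xs) i)
        go (yes refl) = trans (write-hit M (w + w + ix) (toℕ y)) (cong toℕ (sym (nth-put-index d y xs)))
        go (no i≢) = trans (write-miss M (w + w + ix) (toℕ y) (i≢ ∘ +-cancelˡ-≡ (w + w) i ix))
          (trans (ar i i<) (cong toℕ (sym (nth-put d y xs i i<))))
          where i< = put-old y xs i p i≢

    jPre-spec : ∀ σ x j → Env n w b σ → Agree M₀ (mem σ) → reg σ #row ≡ b + toℕ x * n → reg σ #j ≡ j → j < w →
      M₀ (w + j) ≡ toℕ (f j) → reg (⟦ jPre ⟧ σ) #y ≡ toℕ (x ∙ f j)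
    jPre-spec σ x j (env _ one₁ W₁ _ _) ag er ej j<w ef =
      cong₂ _∸_ (trans (cong₂ (λ a b → mem σ (a + b)) er slot≡)
        (trans (low ag _ (≤-trans (cell< x (f j)) (≤-trans bn≤w (m≤m+n w w)))) (tab inp x (f j)))) one₁
      where
      slot≡ : mem σ (reg σ #W + reg σ #j) ≡ toℕ (f j)
      slot≡ = trans (cong₂ (λ a b → mem σ (a + b)) W₁ ej) (trans (low ag (w + j) (+-monoʳ-< w j<w)) ef)

    jMul-spec : ∀ σ {M} xs c y j → Env n w b σ → Unique xs → mem σ ≡ M → Agree M₀ M →
      (∀ i → i < length xs → M (w + w + i) ≡ toℕ (nth d xs i)) → reg σ #len ≡ length xs → reg σ #code ≡ c →
      reg σ #idx ≡ index y xs → reg σ #y ≡ toℕ y → reg σ #j ≡ j →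
      HoldsAt (visit y (xs , c)) (⟦ jMul ⨾ jPost ⟧ σ) × reg (⟦ jMul ⨾ jPost ⟧ σ) #j ≡ suc j
    jMul-spec σ xs c y j ev u em ag ar el ec eix ey ej =
      seq (jMul ⨾ jPost) jMul jPost refl (λ τ → HoldsAt (visit y (xs , c)) τ × reg τ #j ≡ suc j) σ λ σ′ fr m e →
      jPost-spec σ′ xs c y j (env-frame jMul σ σ′ refl fr ev) u (trans (m refl) em) ag ar (trans (fr #len refl) el)
        (trans (cong (λ τ → reg τ #v) e) (trans (addmul-spec #v #idx #code #n #n σ refl refl refl refl refl refl refl refl ≤-refl)
          (cong₂ _+_ eix (cong₂ _*_ (EnvV.n≡ ev) ec))))
        (trans (fr #idx refl) eix) (trans (fr #y refl) ey) (trans (fr #j refl) ej)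

    jSearch-spec : ∀ σ {M} xs c y j → Env n w b σ → Unique xs → mem σ ≡ M → Agree M₀ M →
      (∀ i → i < length xs → M (w + w + i) ≡ toℕ (nth d xs i)) → reg σ #len ≡ length xs → reg σ #code ≡ c →
      reg σ #y ≡ toℕ y → reg σ #j ≡ j →
      HoldsAt (visit y (xs , c)) (⟦ search ⨾ jMul ⨾ jPost ⟧ σ) × reg (⟦ search ⨾ jMul ⨾ jPost ⟧ σ) #j ≡ suc j
    jSearch-spec σ xs c y j ev u refl ag ar el ec ey ej =
      seq (search ⨾ jMul ⨾ jPost) search (jMul ⨾ jPost) refl (λ τ → HoldsAt (visit y (xs , c)) τ × reg τ #j ≡ suc j) σ λ σ′ fr m e →
      jMul-spec σ′ xs c y j (env-frame search σ σ′ refl fr ev) u (m refl) ag ar (trans (fr #len refl) el) (trans (fr #code refl) ec)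
        (trans (cong (λ τ → reg τ #idx) e) (search-spec d xs y σ (EnvV.one≡ ev) el
          (≤-trans (≤-trans (unique≤ u) n≤w) (≤-reflexive (sym (EnvV.W≡ ev)))) ey
          (λ i p → trans (cong (λ a → mem σ (a + i)) (EnvV.X≡ ev)) (ar i p))))
        (trans (fr #y refl) ey) (trans (fr #j refl) ej)

    jBody-spec : ∀ σ s x j → Env n w b σ → Unique (proj₁ s) → HoldsAt s σ →
      reg σ #row ≡ b + toℕ x * n → reg σ #j ≡ j → j < w → M₀ (w + j) ≡ toℕ (f j) →
      HoldsAt (visit (x ∙ f j) s) (⟦ jBody ⟧ σ) × reg (⟦ jBody ⟧ σ) #j ≡ suc j
    jBody-spec σ s@(xs , c) x j ev u h er ej j<w ef =
      seq jBody jPre (search ⨾ jMul ⨾ jPost) refl (λ τ → HoldsAt (visit (x ∙ f j) s) τ × reg τ #j ≡ suc j) σ λ σ′ fr m e →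
      jSearch-spec σ′ xs c (x ∙ f j) j (env-frame jPre σ σ′ refl fr ev) u (m refl) (agree h) (arr h)
        (trans (fr #len refl) (len≡ h)) (trans (fr #code refl) (code≡ h))
        (trans (cong (λ τ → reg τ #y) e) (jPre-spec σ x j ev (agree h) er ej j<w ef)) (trans (fr #j refl) ej)

    jLoop-spec : ∀ σ s x L → Env n w b σ → Unique (proj₁ s) → Holds M₀ d s (reg σ #len) (reg σ #code) (mem σ) →
      reg σ #row ≡ b + toℕ x * n → reg σ #j ≡ 0 → reg σ #cur ≡ L → L ≤ w → (∀ j → j < L → M₀ (w + j) ≡ toℕ (f j)) →
      let σ′ = ⟦ loop #c3 #cur #W jBody ⟧ σ in Holds M₀ d (row f x s L) (reg σ′ #len) (reg σ′ #code) (mem σ′)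
    jLoop-spec σ s x L ev u h er ej ec L≤w ef = proj₁ (loop-rule #c3 #cur #W jBody σ P L
        (trans (trips #c3 #cur #W σ refl (subst₂ _≤_ (sym ec) (sym (EnvV.W≡ ev)) L≤w)) ec)
        (h , ej) step)
      where
      P : ℕ → Store → Set
      P j σ′ = Holds M₀ d (row f x s j) (reg σ′ #len) (reg σ′ #code) (mem σ′) × reg σ′ #j ≡ j
      step : ∀ j k σ′ → j < L → k < L → Frame (loop #c3 #cur #W jBody) σ σ′ → P j σ′ → P (suc j) (⟦ jBody ⟧ (tick #c3 k σ′))
      step j k σ′ j<L _ fr (h , e) = jBody-spec (tick #c3 k σ′) (row f x s j) x j
        (env-frame (loop #c3 #cur #W jBody) σ σ′ refl fr ev) (row-unique f x s j u) h (trans (fr #row refl) er) e (≤-trans j<L L≤w) (ef j j<L)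

    private
      IPost : Conf n → ℕ → ℕ → Store → Set
      IPost s t L τ = HoldsAt (row f (nth d (proj₁ s) t) s L) τ × reg τ #i ≡ suc t

    holds-frame : ∀ {s} σ σ′ → reg σ′ #len ≡ reg σ #len → reg σ′ #code ≡ reg σ #code → mem σ′ ≡ mem σ → HoldsAt s σ → HoldsAt s σ′
    holds-frame σ σ′ el ec em h rewrite el | ec | em = h

    iLoop-spec : ∀ σ s t L → Env n w b σ → Unique (proj₁ s) → HoldsAt s σ → reg σ #i ≡ t → reg σ #cur ≡ L → L ≤ w →
      (∀ j → j < L → M₀ (w + j) ≡ toℕ (f j)) → reg σ #row ≡ b + toℕ (nth d (proj₁ s) t) * n → reg σ #j ≡ 0 →
      IPost s t L (⟦ iLoop ⟧ σ)
    iLoop-spec σ s t L ev u h ei ec L≤w ef er ej =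
      seq iLoop (loop #c3 #cur #W jBody) (op (add #i #i #one)) refl (IPost s t L) σ λ σ′ fr m e →
      subst (HoldsAt (row f (nth d (proj₁ s) t) s L)) (sym e) (jLoop-spec σ s (nth d (proj₁ s) t) L ev u h er ej ec L≤w ef) ,
      trans (cong₂ _+_ (trans (fr #i refl) ei) (trans (fr #one refl) (EnvV.one≡ ev))) (+-comm t 1)

    iRow-spec : ∀ σ s t L → Env n w b σ → Unique (proj₁ s) → HoldsAt s σ → reg σ #i ≡ t → reg σ #cur ≡ L → L ≤ w →
      (∀ j → j < L → M₀ (w + j) ≡ toℕ (f j)) → reg σ #x ≡ toℕ (nth d (proj₁ s) t) →
      IPost s t L (⟦ iRow ⨾ iLoop ⟧ σ)
    iRow-spec σ s t L ev u h ei ec L≤w ef ex =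
      seq (iRow ⨾ iLoop) iRow iLoop refl (IPost s t L) σ λ σ′ fr m e →
      iLoop-spec σ′ s t L (env-frame iRow σ σ′ refl fr ev) u (holds-frame σ σ′ (fr #len refl) (fr #code refl) (m refl) h)
        (trans (fr #i refl) ei) (trans (fr #cur refl) ec) L≤w ef
        (trans (cong (λ τ → reg τ #row) e)
          (trans (addmul-spec #row #T #n #x #n σ refl refl refl refl refl refl refl refl
             (≤-trans (≤-reflexive ex) (≤-trans (<⇒≤ (toℕ<n (nth d (proj₁ s) t))) (≤-reflexive (sym (EnvV.n≡ ev))))))
            (cong₂ _+_ (EnvV.T≡ ev) (cong₂ _*_ ex (EnvV.n≡ ev)))))
        (cong (λ τ → reg τ #j) e)

    iLoad-spec : ∀ σ s t L → Env n w b σ → Unique (proj₁ s) → HoldsAt s σ → reg σ #i ≡ t → reg σ #cur ≡ L → L ≤ w →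
      (∀ j → j < L → M₀ (w + j) ≡ toℕ (f j)) → mem σ (w + w + reg σ #v) ≡ toℕ (nth d (proj₁ s) t) →
      IPost s t L (⟦ iLoad ⨾ iRow ⨾ iLoop ⟧ σ)
    iLoad-spec σ s t L ev u h ei ec L≤w ef ex =
      seq (iLoad ⨾ iRow ⨾ iLoop) iLoad (iRow ⨾ iLoop) refl (IPost s t L) σ λ σ′ fr m e →
      iRow-spec σ′ s t L (env-frame iLoad σ σ′ refl fr ev) u (holds-frame σ σ′ (fr #len refl) (fr #code refl) (m refl) h)
        (trans (fr #i refl) ei) (trans (fr #cur refl) ec) L≤w ef
        (trans (cong (λ τ → reg τ #x) e) (trans (cong (λ a → mem σ (a + reg σ #v)) (EnvV.X≡ ev)) ex))

    iBody-spec : ∀ σ s t L → Env n w b σ → Unique (proj₁ s) → 0 < length (proj₁ s) → nth d (proj₁ s) 0 ≡ d →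
      HoldsAt s σ → reg σ #i ≡ t → reg σ #cur ≡ L → L ≤ w → (∀ j → j < L → M₀ (w + j) ≡ toℕ (f j)) →
      IPost s t L (⟦ iBody ⟧ σ)
    iBody-spec σ s t L ev u 0<l hd h ei ec L≤w ef =
      seq iBody iPick (iLoad ⨾ iRow ⨾ iLoop) refl (IPost s t L) σ λ σ′ fr m e →
      iLoad-spec σ′ s t L (env-frame iPick σ σ′ refl fr ev) u (holds-frame σ σ′ (fr #len refl) (fr #code refl) (m refl) h)
        (trans (fr #i refl) ei) (trans (fr #cur refl) ec) L≤w ef
        (trans (cong₂ (λ M τ → M (w + w + reg τ #v)) (m refl) e) loaded)
      where
      loaded : mem σ (w + w + reg (⟦ iPick ⟧ σ) #v) ≡ toℕ (nth d (proj₁ s) t)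
      loaded with iPick-spec (length (proj₁ s)) t σ (len≡ h) ei (EnvV.one≡ ev)
      ... | inj₁ (p , e) = trans (cong (λ a → mem σ (w + w + a)) e) (arr h t p)
      ... | inj₂ (p , e) = trans (cong (λ a → mem σ (w + w + a)) e)
              (trans (arr h 0 0<l) (cong toℕ (trans hd (sym (nth-past d (proj₁ s) t p)))))

  closureInit-spec : ∀ σ f L → Env n w b σ → Input (mem σ) → 0 < w → mem σ (w + 0) ≡ toℕ (f 0) →
    Holds (mem σ) (f 0) (run f L 0) (reg (⟦ closureInit ⟧ σ) #len) (reg (⟦ closureInit ⟧ σ) #code) (mem (⟦ closureInit ⟧ σ))
  closureInit-spec σ f L ev inp 0<w ef = holds refl refl arr₀ (subst (Agree (mem σ)) (sym mem₁) (agree-write 0 _ 0<w (toℕ<n (f 0))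
      (record { low = λ _ _ → refl ; high = λ _ _ → refl ; aux′ = aux inp })))
    where
    mem₁ : mem (⟦ closureInit ⟧ σ) ≡ write (mem σ) (w + w + 0) (toℕ (f 0))
    mem₁ = cong₂ (write (mem σ)) (trans (EnvV.X≡ ev) (sym (+-identityʳ (w + w))))
      (trans (cong (mem σ) (trans (EnvV.W≡ ev) (sym (+-identityʳ w)))) ef)
    arr₀ : ∀ i → i < 1 → mem (⟦ closureInit ⟧ σ) (w + w + i) ≡ toℕ (nth (f 0) (f 0 ∷ []) i)
    arr₀ zero p = trans (cong (λ M → M (w + w + 0)) mem₁) (write-hit (mem σ) (w + w + 0) _)
    arr₀ (suc i) (s≤s ())

  Closed : (ℕ → ℕ) → (ℕ → Fin n) → ℕ → Store → Set
  Closed M₀ f t σ = Holds M₀ (f 0) (run f t n) (reg σ #len) (reg σ #code) (mem σ)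

  closure-spec : ∀ σ f L → Env n w b σ → Input (mem σ) → 0 < w → reg σ #cur ≡ L → L ≤ w →
    (∀ j → j < w → mem σ (w + j) ≡ toℕ (f j)) → Closed (mem σ) f L (⟦ closure ⟧ σ)
  closure-spec σ f L ev inp 0<w ec L≤w ef =
    seq closure closureInit (loop #c2 #n #n iBody) refl (Closed (mem σ) f L) σ λ σ′ fr _ e →
    main σ′ (env-frame closureInit σ σ′ refl fr ev) (trans (fr #cur refl) ec)
      (subst (λ τ → Holds (mem σ) (f 0) (run f L 0) (reg τ #len) (reg τ #code) (mem τ)) (sym e) (closureInit-spec σ f L ev inp 0<w (ef 0 0<w)))
      (cong (λ τ → reg τ #i) e)
    where
    P : ℕ → Store → Set
    P t σ′ = Holds (mem σ) (f 0) (run f L t) (reg σ′ #len) (reg σ′ #code) (mem σ′) × reg σ′ #i ≡ t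
    main : ∀ σ₁ → Env n w b σ₁ → reg σ₁ #cur ≡ L → Holds (mem σ) (f 0) (run f L 0) (reg σ₁ #len) (reg σ₁ #code) (mem σ₁) →
      reg σ₁ #i ≡ 0 → Closed (mem σ) f L (⟦ loop #c2 #n #n iBody ⟧ σ₁)
    main σ₁ ev₁ ec₁ h₀ ei = proj₁ (loop-rule #c2 #n #n iBody σ₁ P n
        (trans (trips #c2 #n #n σ₁ refl ≤-refl) (EnvV.n≡ ev₁)) (h₀ , ei) step)
      where
      step : ∀ t k σ′ → t < n → k < n → Frame (loop #c2 #n #n iBody) σ₁ σ′ → P t σ′ → P (suc t) (⟦ iBody ⟧ (tick #c2 k σ′))
      step t k σ′ _ _ fr (h , e) = iBody-spec (f 0) f inp (tick #c2 k σ′) (run f L t) t L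
        (env-frame (loop #c2 #n #n iBody) σ₁ σ′ refl fr ev₁) (run-unique f L t) (run-nonempty f L t) (run-head (f 0) f L t)
        h e (trans (fr #cur refl) ec₁) L≤w (λ j p → ef j (≤-trans p L≤w))

-- Every y in turn is written behind the tuple, which is extended by it only if it was not generated before.
greedyPost : Stmt
greedyPost = op (add #t #W #cur) ⨾ op (store #t #y0) ⨾ op (sub #t #len #idx) ⨾ op (sub #t #one #t)
  ⨾ op (add #cur #cur #t) ⨾ op (add #y0 #y0 #one)

greedyBody : Stmt
greedyBody = closure ⨾ op (move #y #y0) ⨾ search ⨾ greedyPost

greedy : Stmt
greedy = op (set0 #y0) ⨾ loop #c1 #n #n greedyBody

-- One step of a base-n counter, with carry #y, on the F digits from address #O on.
odoPre : Stmt
odoPre = op (load #v #j) ⨾ op (add #v #v #y) ⨾ op (sub #t #n #v) ⨾ op (sub #y #one #t)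

odoCarry : Stmt
odoCarry = loop #c4 #y #one (op (set0 #v))

odoPost : Stmt
odoPost = op (store #j #v) ⨾ op (add #j #j #one)

odoBody : Stmt
odoBody = odoPre ⨾ odoCarry ⨾ odoPost

odometer : Stmt
odometer = (op (set1 #y) ⨾ op (move #j #O)) ⨾ loop #c1 #F #W odoBody

-- Greedy extension computed in memory

module GreedySpec {n : ℕ} (G : GroupTable n) (w b : ℕ) (bn≤w : b + n * n ≤ w) (n≤w : n ≤ w) where
  open GroupTable G using (_∙_; ε)
  open Runs G
  open Generation G
  open Closure G w b bn≤w n≤w public
  open Input
  open Agree
  open Holds

  slots : (ℕ → ℕ) → ℕ → Fin n
  slots M j = decode ε (M (w + j))

  record Scratch (M M′ : ℕ → ℕ) : Set where
    constructor scratch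
    field
      low′  : ∀ a → a < w → M′ a ≡ M a
      high′ : ∀ a → w + w + w ≤ a → M′ a ≡ M a
      slot′ : ∀ j → j < w → M′ (w + j) < n
      aux″  : ∀ i → i < w → M′ (w + w + i) < n
  open Scratch

  scratch-input : ∀ {M M′} → Input M → Scratch M M′ → Input M′
  scratch-input inp sc = record
    { tab  = λ x y → trans (low′ sc _ (≤-trans (cell< x y) bn≤w)) (tab inp x y)
    ; slot = slot′ sc ; aux = aux″ sc }

  scratch-agree : ∀ {M M₁ M₂} → Scratch M M₁ → Agree M₁ M₂ → Scratch M M₂
  scratch-agree sc ag = scratch (λ a p → trans (low ag a (≤-trans p (m≤m+n w w))) (low′ sc a p))
    (λ a p → trans (high ag a p) (high′ sc a p))
    (λ j p → subst (_< n) (sym (low ag (w + j) (+-monoʳ-< w p))) (slot′ sc j p)) (aux′ ag)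

  scratch-refl : ∀ {M} → Input M → Scratch M M
  scratch-refl inp = scratch (λ _ _ → refl) (λ _ _ → refl) (slot inp) (aux inp)

  scratch-trans : ∀ {M M₁ M₂} → Scratch M M₁ → Scratch M₁ M₂ → Scratch M M₂
  scratch-trans p q = scratch (λ a h → trans (low′ q a h) (low′ p a h)) (λ a h → trans (high′ q a h) (high′ p a h)) (slot′ q) (aux″ q)

  scratch-write : ∀ {M M₁} j v → j < w → v < n → Scratch M M₁ → Scratch M (write M₁ (w + j) v)
  scratch-write {M} {M₁} j v j<w v<n sc = scratch
    (λ a p → trans (write-miss M₁ (w + j) v (<⇒≢ (≤-trans p (m≤m+n w j)))) (low′ sc a p))
    (λ a p → trans (write-miss M₁ (w + j) v (>⇒≢ (<-≤-trans (+-monoʳ-< w j<w) (≤-trans (m≤m+n (w + w) w) p)))) (high′ sc a p))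
    new
    (λ i p → subst (_< n) (sym (write-miss M₁ (w + j) v (>⇒≢ (<-≤-trans (+-monoʳ-< w j<w) (m≤m+n (w + w) i))))) (aux″ sc i p))
    where
    new : ∀ i → i < w → write M₁ (w + j) v (w + i) < n
    new i p with i ≟ j
    ... | yes refl = subst (_< n) (sym (write-hit M₁ (w + i) v)) v<n
    ... | no  i≢j  = subst (_< n) (sym (write-miss M₁ (w + j) v (i≢j ∘ +-cancelˡ-≡ w i j))) (slot′ sc i p)

  -- `t` candidates have been offered and the tuple has length `c`. Together with `c₀ + n ≤ w` the
  -- field `c≤` keeps the tuple inside its zone.
  record GreedyInv (M : ℕ → ℕ) (c₀ t c : ℕ) (M′ : ℕ → ℕ) : Set where
    field
      c₀≤    : c₀ ≤ c
      c≤     : c ≤ c₀ + t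
      scr    : Scratch M M′
      fixed  : ∀ j → j < c₀ → M′ (w + j) ≡ M (w + j)
      before : ∀ y → toℕ y < t → Gen (slots M′) c y
      fresh  : ∀ i → c₀ ≤ i → i < c → ¬ Gen (slots M′) i (slots M′ i)
  open GreedyInv

  module _ {M M₁ M₂ : ℕ → ℕ} {c₀ t c : ℕ} (0<c₀ : 0 < c₀) (c<w : c < w) (t<n : t < n) (inv : GreedyInv M c₀ t c M₁)
    (ag : Agree M₁ M₂) where

    private
      y  = fromℕ< t<n
      xs = elements (slots M₁) c
      M₃ = write M₂ (w + c) (toℕ y)
      0<c = ≤-trans 0<c₀ (c₀≤ inv)
      same : ∀ j → j < c → M₃ (w + j) ≡ M₁ (w + j)
      same j p = trans (write-miss M₂ (w + c) (toℕ y) (<⇒≢ p ∘ +-cancelˡ-≡ w j c)) (low ag (w + j) (+-monoʳ-< w (<-trans p c<w)))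
      f≡ : ∀ j → j < c → slots M₁ j ≡ slots M₃ j
      f≡ j p = cong (decode ε) (sym (same j p))
      fc : slots M₃ c ≡ y
      fc = trans (cong (decode ε) (write-hit M₂ (w + c) (toℕ y))) (decode-toℕ ε y)
      scr₃ : Scratch M M₃
      scr₃ = scratch-write c (toℕ y) c<w (toℕ<n y) (scratch-agree (scr inv) ag)
      fixed₃ : ∀ j → j < c₀ → M₃ (w + j) ≡ M (w + j)
      fixed₃ j p = trans (same j (≤-trans p (c₀≤ inv))) (fixed inv j p)
      older : ∀ i → i < c → ¬ Gen (slots M₁) i (slots M₁ i) → ¬ Gen (slots M₃) i (slots M₃ i)
      older i p h q = h (subst (Gen (slots M₁) i) (sym (f≡ i p)) (Gen-mono ≤-refl (λ j r → sym (f≡ j (<-trans r p))) q))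
      earlier : ∀ {c′} → c ≤ c′ → Gen (slots M₃) c′ y → ∀ z → toℕ z < suc t → Gen (slots M₃) c′ z
      earlier le q z p with m≤n⇒m<n∨m≡n (s≤s⁻¹ p)
      ... | inj₁ r = Gen-mono le f≡ (before inv z r)
      ... | inj₂ r = subst (Gen (slots M₃) _) (toℕ-injective (trans (toℕ-fromℕ< t<n) (sym r))) q

    -- A rejected candidate stays in slot `c`, just behind the current tuple, until the next one
    -- overwrites it. Statements about the first `c` slots do not see it.
    greedy-old : y ∈ xs → GreedyInv M c₀ (suc t) c M₃
    greedy-old y∈ = record
      { c₀≤ = c₀≤ inv ; c≤ = ≤-trans (c≤ inv) (+-monoʳ-≤ c₀ (n≤1+n t)) ; scr = scr₃ ; fixed = fixed₃
      ; before = earlier ≤-refl (Gen-mono ≤-refl f≡ (∈-gen 0<c y∈))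
      ; fresh = λ i p q → older i q (fresh inv i p q) }

    greedy-new : y ∉ xs → GreedyInv M c₀ (suc t) (suc c) M₃
    greedy-new y∉ = record
      { c₀≤ = m≤n⇒m≤1+n (c₀≤ inv) ; c≤ = ≤-trans (s≤s (c≤ inv)) (≤-reflexive (sym (+-suc c₀ t))) ; scr = scr₃ ; fixed = fixed₃
      ; before = earlier (n≤1+n c) (subst (Gen (slots M₃) (suc c)) fc (gen c (n<1+n c)))
      ; fresh = new }
      where
      new : ∀ i → c₀ ≤ i → i < suc c → ¬ Gen (slots M₃) i (slots M₃ i)
      new i p q with m≤n⇒m<n∨m≡n (s≤s⁻¹ q)
      ... | inj₁ r    = older i r (fresh inv i p r)
      ... | inj₂ refl = λ g → y∉ (gen-∈ 0<c (Gen-mono ≤-refl (λ j r → sym (f≡ j r)) (subst (Gen (slots M₃) c) fc g)))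

  GreedyAt : (ℕ → ℕ) → ℕ → ℕ → Store → Set
  GreedyAt M c₀ t σ = GreedyInv M c₀ t (reg σ #cur) (mem σ) × reg σ #y0 ≡ t

  module _ {M : ℕ → ℕ} {c₀ : ℕ} (0<c₀ : 0 < c₀) (c₀n≤w : c₀ + n ≤ w) (inp : Input M) where

    private
      0<w : 0 < w
      0<w = ≤-trans 0<c₀ (≤-trans (m≤m+n c₀ n) c₀n≤w)

    greedyPost-spec : ∀ σ {M₁ c t} (t<n : t < n) → Env n w b σ → GreedyInv M c₀ t c M₁ → Agree M₁ (mem σ) →
      reg σ #len ≡ order (slots M₁) c → reg σ #idx ≡ index (fromℕ< t<n) (elements (slots M₁) c) →
      reg σ #cur ≡ c → reg σ #y0 ≡ t → GreedyAt M c₀ (suc t) (⟦ greedyPost ⟧ σ)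
    greedyPost-spec σ {M₁} {c} {t} t<n (env _ e1 eW _ _) inv ag el ei refl ey =
      main (fromℕ< t<n ∈? xs) , trans (cong₂ _+_ ey e1) (+-comm t 1)
      where
      xs = elements (slots M₁) c
      ix = index (fromℕ< t<n) xs
      c<w : c < w
      c<w = <-≤-trans (≤-<-trans (c≤ inv) (+-monoʳ-< c₀ t<n)) c₀n≤w
      mem≡ : mem (⟦ greedyPost ⟧ σ) ≡ write (mem σ) (w + c) (toℕ (fromℕ< t<n))
      mem≡ = cong₂ (write (mem σ)) (cong (_+ c) eW) (trans ey (sym (toℕ-fromℕ< t<n)))
      cur≡ : reg (⟦ greedyPost ⟧ σ) #cur ≡ c + (1 ∸ (length xs ∸ ix))
      cur≡ = cong (λ z → c + z) (cong₂ _∸_ e1 (cong₂ _∸_ el ei))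
      main : Dec (fromℕ< t<n ∈ xs) → GreedyInv M c₀ (suc t) (reg (⟦ greedyPost ⟧ σ) #cur) (mem (⟦ greedyPost ⟧ σ))
      main (yes y∈) = subst₂ (GreedyInv M c₀ (suc t)) (sym (trans cur≡ lemma)) (sym mem≡) (greedy-old 0<c₀ c<w t<n inv ag y∈)
        where
        lemma : c + (1 ∸ (length xs ∸ ix)) ≡ c
        lemma with length xs ∸ ix in e
        ... | zero  = contradiction (m∸n≡0⇒m≤n e) (<⇒≱ (∈⇒index< xs y∈))
        ... | suc m = trans (cong (λ z → c + z) (0∸n≡0 m)) (+-identityʳ c)
      main (no y∉) = subst₂ (GreedyInv M c₀ (suc t)) (sym (trans cur≡ lemma)) (sym mem≡) (greedy-new 0<c₀ c<w t<n inv ag y∉)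
        where
        lemma : c + (1 ∸ (length xs ∸ ix)) ≡ suc c
        lemma = trans (cong (λ z → c + (1 ∸ z)) (m≤n⇒m∸n≡0 (≮⇒≥ (λ p → y∉ (index<⇒∈ xs p))))) (+-comm c 1)

    greedySearch-spec : ∀ σ {M₁ c t} (t<n : t < n) → Env n w b σ → GreedyInv M c₀ t c M₁ → Closed M₁ (slots M₁) c σ →
      reg σ #cur ≡ c → reg σ #y0 ≡ t → reg σ #y ≡ t → GreedyAt M c₀ (suc t) (⟦ search ⨾ greedyPost ⟧ σ)
    greedySearch-spec σ {M₁} {c} {t} t<n ev inv h ec ey ey′ =
      seq (search ⨾ greedyPost) search greedyPost refl (GreedyAt M c₀ (suc t)) σ λ σ′ fr m e →
      greedyPost-spec σ′ t<n (env-frame search σ σ′ refl fr ev) inv (subst (Agree M₁) (sym (m refl)) (agree h))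
        (trans (fr #len refl) (len≡ h))
        (trans (cong (λ τ → reg τ #idx) e) (search-spec (slots M₁ 0) (elements (slots M₁) c) (fromℕ< t<n) σ (EnvV.one≡ ev) (len≡ h)
          (≤-trans (≤-trans (unique≤ (elements-unique (slots M₁) c)) n≤w) (≤-reflexive (sym (EnvV.W≡ ev))))
          (trans ey′ (sym (toℕ-fromℕ< t<n)))
          (λ i p → trans (cong (λ a → mem σ (a + i)) (EnvV.X≡ ev)) (arr h i p))))
        (trans (fr #cur refl) ec) (trans (fr #y0 refl) ey)

    greedyBody-spec : ∀ σ {t} (t<n : t < n) → Env n w b σ → GreedyAt M c₀ t σ → GreedyAt M c₀ (suc t) (⟦ greedyBody ⟧ σ)
    greedyBody-spec σ {t} t<n ev (inv , ey) =
      seq greedyBody closure (op (move #y #y0) ⨾ search ⨾ greedyPost) refl (GreedyAt M c₀ (suc t)) σ λ σ₁ fr₁ _ e₁ →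
      seq (op (move #y #y0) ⨾ search ⨾ greedyPost) (op (move #y #y0)) (search ⨾ greedyPost) refl (GreedyAt M c₀ (suc t)) σ₁ λ σ₂ fr₂ _ e₂ →
      greedySearch-spec σ₂ t<n (env-frame (op (move #y #y0)) σ₁ σ₂ refl fr₂ (env-frame closure σ σ₁ refl fr₁ ev)) inv
        (subst (Closed (mem σ) f c) (sym e₂) (subst (Closed (mem σ) f c) (sym e₁)
          (closure-spec σ f c ev (scratch-input inp (scr inv)) 0<w refl c≤w (λ j p → sym (toℕ-decode ε (slot′ (scr inv) j p))))))
        (trans (fr₂ #cur refl) (fr₁ #cur refl)) (trans (fr₂ #y0 refl) (trans (fr₁ #y0 refl) ey))
        (trans (cong (λ τ → reg τ #y) e₂) (trans (fr₁ #y0 refl) ey))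
      where
      c = reg σ #cur
      f = slots (mem σ)
      c≤w : c ≤ w
      c≤w = ≤-trans (c≤ inv) (≤-trans (+-monoʳ-≤ c₀ (<⇒≤ t<n)) c₀n≤w)

    greedy-spec : ∀ σ → Env n w b σ → mem σ ≡ M → reg σ #cur ≡ c₀ →
      ∃[ c₁ ] Greedy G (slots (mem (⟦ greedy ⟧ σ))) c₀ c₁ × Scratch M (mem (⟦ greedy ⟧ σ)) ×
        (∀ j → j < c₀ → mem (⟦ greedy ⟧ σ) (w + j) ≡ M (w + j))
    greedy-spec σ ev em ec =
      seq greedy (op (set0 #y0)) (loop #c1 #n #n greedyBody) refl Q σ λ σ₁ fr₁ m₁ e₁ →
      finish (⟦ loop #c1 #n #n greedyBody ⟧ σ₁) (loop-rule #c1 #n #n greedyBody σ₁ (GreedyAt M c₀) n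
        (trans (trips #c1 #n #n σ₁ refl ≤-refl) (trans (fr₁ #n refl) (EnvV.n≡ ev)))
        (start σ₁ (trans (m₁ refl) em) (trans (fr₁ #cur refl) ec) , cong (λ τ → reg τ #y0) e₁)
        (λ t k σ′ t<n _ fr h → greedyBody-spec (tick #c1 k σ′) t<n
          (env-frame (loop #c1 #n #n greedyBody) σ₁ σ′ refl fr (env-frame (op (set0 #y0)) σ σ₁ refl fr₁ ev)) h))
      where
      Q : Store → Set
      Q τ = ∃[ c₁ ] Greedy G (slots (mem τ)) c₀ c₁ × Scratch M (mem τ) × (∀ j → j < c₀ → mem τ (w + j) ≡ M (w + j))
      start : ∀ σ₁ → mem σ₁ ≡ M → reg σ₁ #cur ≡ c₀ → GreedyInv M c₀ 0 (reg σ₁ #cur) (mem σ₁)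
      start σ₁ refl refl = record
        { c₀≤ = ≤-refl ; c≤ = m≤m+n c₀ 0 ; scr = scratch-refl inp ; fixed = λ _ _ → refl ; before = λ _ ()
        ; fresh = λ i p q → contradiction p (<⇒≱ q) }
      finish : ∀ τ → GreedyAt M c₀ n τ → Q τ
      finish τ (inv , _) = reg τ #cur , record { c₀≤c₁ = c₀≤ inv ; all = λ x → before inv x (toℕ<n x) ; new = fresh inv } , scr inv , fixed inv

-- The value of f base-n digits stored from address o on, least significant digit first.
val : ℕ → (ℕ → ℕ) → ℕ → ℕ → ℕ
val n M o zero    = 0
val n M o (suc f) = val n M o f + n ^ f * M (o + f)

val-cong : ∀ n M M′ o o′ f → (∀ i → i < f → M (o + i) ≡ M′ (o′ + i)) → val n M o f ≡ val n M′ o′ f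
val-cong n M M′ o o′ zero    h = refl
val-cong n M M′ o o′ (suc f) h = cong₂ (λ a b → a + n ^ f * b) (val-cong n M M′ o o′ f (λ i p → h i (m<n⇒m<1+n p))) (h f (n<1+n f))

val< : ∀ n M o f → (∀ i → i < f → M (o + i) < n) → val n M o f < n ^ f
val< n M o zero    h = s≤s z≤n
val< n M o (suc f) h = begin-strict
  val n M o f + n ^ f * M (o + f)  <⟨ +-monoˡ-< _ (val< n M o f (λ i p → h i (m<n⇒m<1+n p))) ⟩
  n ^ f + n ^ f * M (o + f)        ≡⟨ *-suc (n ^ f) (M (o + f)) ⟨
  n ^ f * suc (M (o + f))          ≤⟨ *-monoʳ-≤ (n ^ f) (h f (n<1+n f)) ⟩
  n ^ f * n                        ≡⟨ *-comm (n ^ f) n ⟩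
  n ^ suc f                        ∎
  where open ≤-Reasoning

val-injective : ∀ n M M′ o o′ f → (∀ i → i < f → M (o + i) < n) → (∀ i → i < f → M′ (o′ + i) < n) →
  val n M o f ≡ val n M′ o′ f → ∀ i → i < f → M (o + i) ≡ M′ (o′ + i)
val-injective n M M′ o o′ (suc f) h h′ e i p
  with digit-injective (n ^ f) (val< n M o f (λ i p → h i (m<n⇒m<1+n p))) (val< n M′ o′ f (λ i p → h′ i (m<n⇒m<1+n p))) e
... | e₁ , e₂ with m≤n⇒m<n∨m≡n (s≤s⁻¹ p)
... | inj₁ q    = val-injective n M M′ o o′ f (λ i p → h i (m<n⇒m<1+n p)) (λ i p → h′ i (m<n⇒m<1+n p)) e₁ i q
... | inj₂ refl = e₂

-- The cyclic counter over half tuples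

next : ℕ → ℕ → ℕ
next N a with suc a <? N
... | yes _ = suc a
... | no  _ = 0

nexts : ℕ → ℕ → ℕ → ℕ
nexts N zero    a = a
nexts N (suc c) a = next N (nexts N c a)

-- Dropping the carry `e` out of the top digit makes the counter cyclic modulo `N`.
next-carry : ∀ {N a a′} e → a < N → a′ < N → a′ + e * N ≡ suc a → a′ ≡ next N a
next-carry {N} {a} {a′} e p q eq with suc a <? N
next-carry {N} {a} {a′} zero    p q eq | yes r = trans (sym (+-identityʳ a′)) eq
next-carry {N} {a} {a′} (suc e) p q eq | yes r =
  contradiction (≤-trans (≤-trans (m≤m+n N (e * N)) (m≤n+m (N + e * N) a′)) (≤-reflexive eq)) (<⇒≱ r)
next-carry {N} {a} {a′} zero    p q eq | no r = contradiction (subst (_< N) (trans (sym (+-identityʳ a′)) eq) q) r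
next-carry {N} {a} {zero}  (suc e) p q eq | no r = refl
next-carry {N} {a} {suc a′} (suc e) p q eq | no r =
  contradiction (≤-trans (≤-trans (m≤m+n N (e * N)) (m≤n+m (N + e * N) a′)) (≤-reflexive (suc-injective eq))) (<⇒≱ p)

nexts-up : ∀ {N} a c → c + a < N → nexts N c a ≡ c + a
nexts-up a zero    p = refl
nexts-up {N} a (suc c) p rewrite nexts-up {N} a c (<-trans (n<1+n _) p) with suc (c + a) <? N
... | yes _ = refl
... | no ¬p = contradiction p ¬p

nexts-+ : ∀ N m c a → nexts N (m + c) a ≡ nexts N m (nexts N c a)
nexts-+ N zero    c a = refl
nexts-+ N (suc m) c a = cong (next N) (nexts-+ N m c a)

-- The starting value is arbitrary, since the second half for H begins with whatever the earlier
-- computation left there. The counter moves before each trial, hence `suc c`. If `v` is not above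
-- `a`, the path wraps around: `suc d` steps lead to 0 and `v` more to `v`.
nexts-covers : ∀ {N a v} → a < N → v < N → ∃[ c ] c < N × nexts N (suc c) a ≡ v
nexts-covers {N} {a} {v} p q with a <? v
... | yes a<v = v ∸ suc a , ≤-trans (s≤s (m∸n≤m v (suc a))) q ,
    trans (nexts-up a (suc (v ∸ suc a)) (subst (_< N) (sym eq) q)) eq
  where
  eq : suc (v ∸ suc a) + a ≡ v
  eq = trans (sym (+-suc (v ∸ suc a) a)) (m∸n+n≡m a<v)
... | no a≮v = v + d , subst (v + d <_) (trans (cong (λ z → a + suc z) refl) eq) (≤-<-trans (+-monoˡ-≤ d (≮⇒≥ a≮v)) (≤-reflexive (sym (+-suc a d)))) ,
    trans (cong (λ c → nexts N c a) (sym (+-suc v d))) (trans (nexts-+ N v (suc d) a)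
      (trans (cong (nexts N v) wrap) (trans (nexts-up 0 v (subst (_< N) (sym (+-identityʳ v)) q)) (+-identityʳ v))))
  where
  d = N ∸ suc a
  eq : a + suc d ≡ N
  eq = trans (+-suc a d) (m+[n∸m]≡n p)
  top : d + a < N
  top = ≤-reflexive (trans (cong suc (+-comm d a)) (trans (sym (+-suc a d)) eq))
  wrap : nexts N (suc d) a ≡ 0
  wrap rewrite nexts-up {N} a d top with suc (d + a) <? N
  ... | yes r = contradiction r (≤⇒≯ (≤-reflexive (trans (sym eq) (trans (+-suc a d) (cong suc (+-comm a d))))))
  ... | no _  = refl

-- A digit plus a carry of at most 1 never exceeds n, so a carry out leaves the digit 0. The
-- truncated expression is the program's way to detect this.
odo-carry : ∀ {n} y d → y ≤ 1 → d < n → ∃[ y′ ] ∃[ d′ ] y′ ≤ 1 × d′ < n × d′ + y′ * n ≡ d + y ×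
  (1 ∸ (n ∸ (d + y)) ≡ y′) × ((y′ ≡ 0 × d′ ≡ d + y) ⊎ (y′ ≡ 1 × d′ ≡ 0))
odo-carry {n} y d y≤1 d<n with d + y <? n
... | yes p = 0 , d + y , z≤n , p , +-identityʳ (d + y) , lemma , inj₁ (refl , refl)
  where
  lemma : 1 ∸ (n ∸ (d + y)) ≡ 0
  lemma with n ∸ (d + y) in e
  ... | zero  = contradiction (m∸n≡0⇒m≤n e) (<⇒≱ p)
  ... | suc m = 0∸n≡0 m
... | no ¬p = 1 , 0 , ≤-refl , ≤-<-trans z≤n d<n , trans (+-identityʳ n) (sym d+y≡n) , cong (1 ∸_) (m≤n⇒m∸n≡0 (≮⇒≥ ¬p)) , inj₂ (refl , refl)
  where
  d+y≡n : d + y ≡ n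
  d+y≡n = ≤-antisym (≤-trans (+-monoʳ-≤ d y≤1) (≤-trans (≤-reflexive (+-comm d 1)) d<n)) (≮⇒≥ ¬p)

record OdoInv (n : ℕ) (M : ℕ → ℕ) (o f : ℕ) (vy : ℕ) (M′ : ℕ → ℕ) : Set where
  field
    y≤1   : vy ≤ 1
    below : ∀ a → a < o → M′ a ≡ M a
    above : ∀ a → o + f ≤ a → M′ a ≡ M a
    digit : ∀ i → i < f → M′ (o + i) < n
    sum   : val n M′ o f + vy * n ^ f ≡ suc (val n M o f)
open OdoInv public

odo-step : ∀ {n M o f y M′} y′ d′ → d′ < n → y′ ≤ 1 → OdoInv n M o f y M′ → d′ + y′ * n ≡ M (o + f) + y →
  OdoInv n M o (suc f) y′ (write M′ (o + f) d′)
odo-step {n} {M} {o} {f} {y} {M′} y′ d′ d′<n y′≤1 inv e = record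
  { y≤1 = y′≤1
  ; below = λ a p → trans (write-miss M′ (o + f) d′ (<⇒≢ (≤-trans p (m≤m+n o f)))) (below inv a p)
  ; above = λ a p → trans (write-miss M′ (o + f) d′ (>⇒≢ (≤-trans (≤-reflexive (sym (+-suc o f))) p))) (above inv a (≤-trans (+-monoʳ-≤ o (n≤1+n f)) p))
  ; digit = dig
  ; sum = begin
      val n M″ o f + n ^ f * M″ (o + f) + y′ * (n * n ^ f)
        ≡⟨ cong₂ (λ a b → a + n ^ f * b + y′ * (n * n ^ f)) (val-cong n M″ M′ o o f (λ i p → write-miss M′ (o + f) d′ (<⇒≢ p ∘ +-cancelˡ-≡ o i f))) (write-hit M′ (o + f) d′) ⟩
      val n M′ o f + n ^ f * d′ + y′ * (n * n ^ f)   ≡⟨ lemma₁ (val n M′ o f) (n ^ f) d′ y′ n ⟩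
      val n M′ o f + n ^ f * (d′ + y′ * n)           ≡⟨ cong (λ z → val n M′ o f + n ^ f * z) e ⟩
      val n M′ o f + n ^ f * (M (o + f) + y)         ≡⟨ lemma₂ (val n M′ o f) (n ^ f) (M (o + f)) y ⟩
      (val n M′ o f + y * n ^ f) + n ^ f * M (o + f) ≡⟨ cong (λ z → z + n ^ f * M (o + f)) (sum inv) ⟩
      suc (val n M o f) + n ^ f * M (o + f)          ∎ }
  where
  open ≡-Reasoning
  M″ = write M′ (o + f) d′
  dig : ∀ i → i < suc f → M″ (o + i) < n
  dig i p with m≤n⇒m<n∨m≡n (s≤s⁻¹ p)
  ... | inj₁ q    = subst (_< n) (sym (write-miss M′ (o + f) d′ (<⇒≢ q ∘ +-cancelˡ-≡ o i f))) (digit inv i q)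
  ... | inj₂ refl = subst (_< n) (sym (write-hit M′ (o + i) d′)) d′<n
  lemma₁ : ∀ v q d y n → v + q * d + y * (n * q) ≡ v + q * (d + y * n)
  lemma₁ = solve-∀
  lemma₂ : ∀ v q d y → v + q * (d + y) ≡ v + y * q + q * d
  lemma₂ = solve-∀

odoCarry-spec : ∀ σ {y′ d d′} → reg σ #one ≡ 1 → reg σ #y ≡ y′ → reg σ #v ≡ d → (y′ ≡ 0 × d′ ≡ d) ⊎ (y′ ≡ 1 × d′ ≡ 0) →
  reg (⟦ odoCarry ⟧ σ) #v ≡ d′
odoCarry-spec σ {d = d} e1 ey ev (inj₁ (refl , refl)) = loop-rule #c4 #y #one (op (set0 #v)) σ (λ _ τ → reg τ #v ≡ d) 0
  (trans (trips #c4 #y #one σ refl (subst₂ _≤_ (sym ey) (sym e1) z≤n)) ey) ev (λ j k σ′ ())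
odoCarry-spec σ e1 ey ev (inj₂ (refl , refl)) = loop-rule #c4 #y #one (op (set0 #v)) σ (λ j τ → 0 < j → reg τ #v ≡ 0) 1
  (trans (trips #c4 #y #one σ refl (subst₂ _≤_ (sym ey) (sym e1) ≤-refl)) ey) (λ ()) (λ j k σ′ _ _ _ _ _ → refl) (s≤s z≤n)

OdoAt : ℕ → (ℕ → ℕ) → ℕ → ℕ → Store → Set
OdoAt n M o f σ = OdoInv n M o f (reg σ #y) (mem σ) × reg σ #j ≡ o + f

odoPost-spec : ∀ σ {n M o f y M′} y′ d′ → reg σ #one ≡ 1 → mem σ ≡ M′ → reg σ #y ≡ y′ → reg σ #v ≡ d′ → reg σ #j ≡ o + f →
  d′ < n → y′ ≤ 1 → OdoInv n M o f y M′ → d′ + y′ * n ≡ M (o + f) + y → OdoAt n M o (suc f) (⟦ odoPost ⟧ σ)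
odoPost-spec σ {n} {M} {o} {f} y′ d′ e1 em ey ev ej p q inv e =
  subst₂ (OdoInv n M o (suc f)) (sym ey) (sym (trans (cong (λ M → write M (reg σ #j) (reg σ #v)) em) (cong₂ (write _) ej ev)))
    (odo-step y′ d′ p q inv e) ,
  trans (cong₂ _+_ ej e1) (trans (+-comm (o + f) 1) (sym (+-suc o f)))

odoBody-spec : ∀ σ {n M o f} → reg σ #one ≡ 1 → reg σ #n ≡ n → M (o + f) < n → OdoAt n M o f σ → OdoAt n M o (suc f) (⟦ odoBody ⟧ σ)
odoBody-spec σ {n} {M} {o} {f} e1 en d<n (inv , ej) with odo-carry (reg σ #y) (M (o + f)) (y≤1 inv) d<n
... | y′ , d′ , y′≤1 , d′<n , e , ey′ , cases =
  seq odoBody odoPre (odoCarry ⨾ odoPost) refl (OdoAt n M o (suc f)) σ λ σ₁ fr₁ m₁ e₁ →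
  seq (odoCarry ⨾ odoPost) odoCarry odoPost refl (OdoAt n M o (suc f)) σ₁ λ σ₂ fr₂ m₂ e₂ →
  odoPost-spec σ₂ y′ d′ (trans (fr₂ #one refl) (trans (fr₁ #one refl) e1)) (trans (m₂ refl) (m₁ refl))
    (trans (fr₂ #y refl) (trans (cong (λ τ → reg τ #y) e₁) y₁))
    (trans (cong (λ τ → reg τ #v) e₂) (odoCarry-spec σ₁ (trans (fr₁ #one refl) e1) (trans (cong (λ τ → reg τ #y) e₁) y₁)
      (trans (cong (λ τ → reg τ #v) e₁) v₁) cases))
    (trans (fr₂ #j refl) (trans (fr₁ #j refl) ej)) d′<n y′≤1 inv e
  where
  v₁ : mem σ (reg σ #j) + reg σ #y ≡ M (o + f) + reg σ #y
  v₁ = cong (_+ reg σ #y) (trans (cong (mem σ) ej) (above inv (o + f) ≤-refl))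
  y₁ : reg σ #one ∸ (reg σ #n ∸ (mem σ (reg σ #j) + reg σ #y)) ≡ y′
  y₁ = trans (cong₂ _∸_ e1 (cong₂ _∸_ en v₁)) ey′

record OdoResult (n : ℕ) (M : ℕ → ℕ) (o F : ℕ) (M′ : ℕ → ℕ) : Set where
  field
    odo-below : ∀ a → a < o → M′ a ≡ M a
    odo-above : ∀ a → o + F ≤ a → M′ a ≡ M a
    odo-digit : ∀ i → i < F → M′ (o + i) < n
    odo-val   : val n M′ o F ≡ next (n ^ F) (val n M o F)
open OdoResult public

odometer-spec : ∀ σ {n o F} → reg σ #one ≡ 1 → reg σ #n ≡ n → reg σ #O ≡ o → reg σ #F ≡ F → F ≤ reg σ #W →
  (∀ i → i < F → mem σ (o + i) < n) → OdoResult n (mem σ) o F (mem (⟦ odometer ⟧ σ))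
odometer-spec σ {n} {o} {F} e1 en eo eF F≤W dig =
  seq odometer (op (set1 #y) ⨾ op (move #j #O)) (loop #c1 #F #W odoBody) refl Q σ λ σ₁ fr₁ m₁ e₁ →
  finish (⟦ loop #c1 #F #W odoBody ⟧ σ₁) (loop-rule #c1 #F #W odoBody σ₁ (OdoAt n (mem σ) o) F
    (trans (trips #c1 #F #W σ₁ refl (subst₂ _≤_ (sym (trans (fr₁ #F refl) eF)) (sym (fr₁ #W refl)) F≤W)) (trans (fr₁ #F refl) eF))
    (subst₂ (OdoInv n (mem σ) o 0) (sym (cong (λ τ → reg τ #y) e₁)) (sym (m₁ refl)) start ,
     trans (cong (λ τ → reg τ #j) e₁) (trans eo (sym (+-identityʳ o))))
    (λ f k σ′ f<F _ fr h → odoBody-spec (tick #c1 k σ′) (trans (fr #one refl) (trans (fr₁ #one refl) e1))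
      (trans (fr #n refl) (trans (fr₁ #n refl) en)) (dig f f<F) h))
  where
  Q : Store → Set
  Q τ = OdoResult n (mem σ) o F (mem τ)
  start : OdoInv n (mem σ) o 0 1 (mem σ)
  start = record { y≤1 = ≤-refl ; below = λ _ _ → refl ; above = λ _ _ → refl ; digit = λ _ () ; sum = refl }
  finish : ∀ τ → OdoAt n (mem σ) o F τ → Q τ
  finish τ (inv , _) = record { odo-below = below inv ; odo-above = above inv ; odo-digit = digit inv
    ; odo-val = next-carry (reg τ #y) (val< n (mem σ) o F dig) (val< n (mem τ) o F (digit inv)) (sum inv) }

-- The next statements find k with n = p ^ k: for d = n, …, 2 the powers of d are computed up to n or
-- beyond, with ⌈m/2⌉ and ⌊m/2⌋ for the current exponent m in #j and #i; the last d with a power equal to n is p.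
eSwap : Stmt
eSwap = op (move #x #v) ⨾ op (add #t #i #one) ⨾ op (move #i #j) ⨾ op (move #j #t)

eStep : Stmt
eStep = addmul #v #y #x #cur #n ⨾ eSwap

eBody : Stmt
eBody = op (sub #t #n #x) ⨾ loop #c3 #t #one eStep

dInit : Stmt
dInit = op (set1 #x) ⨾ op (set0 #j) ⨾ op (set0 #i) ⨾ op (set0 #y)

dTest : Stmt
dTest = op (sub #t #x #n) ⨾ op (sub #t #one #t)

dPost : Stmt
dPost = dTest ⨾ loop #c3 #t #one (op (move #F #j)) ⨾ op (sub #cur #cur #one)

dBody : Stmt
dBody = dInit ⨾ loop #c2 #n #n eBody ⨾ dPost

halfLog : Stmt
halfLog = (op (set0 #F) ⨾ op (move #cur #n) ⨾ op (sub #t #n #one)) ⨾ loop #c1 #t #n dBody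

-- The conditional as a loop of at most one round: the body runs iff register `t` is nonzero.
when-rule : ∀ {ℓ} c t s σ (Q : Store → Set ℓ) → reg σ #one ≡ 1 → (c == #one) ≡ false →
  (reg σ t ≡ 0 → Q (init c t #one σ)) → (∀ m k → reg σ t ≡ suc m → Q (⟦ s ⟧ (tick c k (init c t #one σ)))) →
  Q (⟦ loop c t #one s ⟧ σ)
when-rule c t s σ Q e1 p h₀ h₁ = go (reg σ t) refl
  where
  count : reg (init c t #one σ) c ≡ 1 ∸ (1 ∸ reg σ t)
  count = trans (≔-same (reg (apply (sub c #one t) σ)) c _)
    (cong₂ _∸_ (trans (apply-keep (sub c #one t) #one σ p) e1) (trans (≔-same (reg σ) c _) (cong (_∸ reg σ t) e1)))
  go : ∀ m → reg σ t ≡ m → Q (⟦ loop c t #one s ⟧ σ)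
  go zero    e = subst (λ m → Q (iter c ⟦ s ⟧ m (init c t #one σ))) (sym (trans count (cong (λ z → 1 ∸ (1 ∸ z)) e))) (h₀ e)
  go (suc m) e = subst (λ m → Q (iter c ⟦ s ⟧ m (init c t #one σ)))
    (sym (trans count (trans (cong (λ z → 1 ∸ (1 ∸ z)) e) (cong (1 ∸_) (0∸n≡0 m))))) (h₁ m 0 e)

-- Multiplication stops once `x` reaches n; `running` ties the exponent to the round number `e` only
-- before that. After n rounds with 2 ≤ d, it is therefore the least m with n ≤ d ^ m.
record Pow (n d e : ℕ) (x f g : ℕ) : Set where
  field
    exponent : ℕ
    power≡       : x ≡ d ^ exponent
    ceil≡       : f ≡ ⌈ exponent /2⌉
    floor≡       : g ≡ ⌊ exponent /2⌋
    running  : x < n → exponent ≡ e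
    minimal  : ∀ m → exponent ≡ suc m → d ^ m < n
open Pow

PowAt : ℕ → ℕ → ℕ → Store → Set
PowAt n d e σ = Pow n d e (reg σ #x) (reg σ #j) (reg σ #i)

-- Halving needs no division: from m to m + 1, the new ceiling is ⌊m/2⌋ + 1 and the new floor is
-- ⌈m/2⌉.
eSwap-spec : ∀ σ {n d e x f g} → reg σ #one ≡ 1 → x < n → Pow n d e x f g → reg σ #v ≡ d * x → reg σ #j ≡ f → reg σ #i ≡ g →
  PowAt n d (suc e) (⟦ eSwap ⟧ σ)
eSwap-spec σ {d = d} e1 x<n pw ev ej ei = record
  { exponent = suc (exponent pw) ; power≡ = trans ev (cong (d *_) (power≡ pw))
  ; ceil≡ = trans (cong₂ _+_ (trans ei (floor≡ pw)) e1) (+-comm ⌊ exponent pw /2⌋ 1)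
  ; floor≡ = trans ej (ceil≡ pw) ; running = λ _ → cong suc (running pw x<n)
  ; minimal = λ { m refl → subst (_< _) (power≡ pw) x<n } }

eStep-spec : ∀ σ {n d e} → reg σ #one ≡ 1 → reg σ #n ≡ n → reg σ #cur ≡ d → d ≤ n → reg σ #y ≡ 0 → reg σ #x < n →
  PowAt n d e σ → PowAt n d (suc e) (⟦ eStep ⟧ σ)
eStep-spec σ {n} {d} {e} e1 en ed d≤n ey x<n pw =
  seq eStep (addmul #v #y #x #cur #n) eSwap refl (PowAt n d (suc e)) σ λ σ′ fr m eq →
  eSwap-spec σ′ (trans (fr #one refl) e1) x<n pw
    (trans (cong (λ τ → reg τ #v) eq) (trans (addmul-spec #v #y #x #cur #n σ refl refl refl refl refl refl refl refl
      (subst₂ _≤_ (sym ed) (sym en) d≤n)) (trans (cong₂ (λ a b → a + b * reg σ #x) ey ed) refl)))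
    (fr #j refl) (fr #i refl)

pow-stop : ∀ {n d e x f g} → n ≤ x → Pow n d e x f g → Pow n d (suc e) x f g
pow-stop n≤x pw = record { exponent = exponent pw ; power≡ = power≡ pw ; ceil≡ = ceil≡ pw ; floor≡ = floor≡ pw
  ; running = λ p → contradiction n≤x (<⇒≱ p) ; minimal = minimal pw }

eBody-spec : ∀ σ {n d e} → reg σ #one ≡ 1 → reg σ #n ≡ n → reg σ #cur ≡ d → d ≤ n → reg σ #y ≡ 0 →
  PowAt n d e σ → PowAt n d (suc e) (⟦ eBody ⟧ σ)
eBody-spec σ {n} {d} {e} e1 en ed d≤n ey pw =
  seq eBody (op (sub #t #n #x)) (loop #c3 #t #one eStep) refl (PowAt n d (suc e)) σ λ σ′ fr m eq →
  main σ′ (trans (fr #one refl) e1) (trans (fr #n refl) en) (trans (fr #cur refl) ed) (trans (fr #y refl) ey)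
    (subst (PowAt n d e) (sym eq) pw) (trans (cong (λ τ → reg τ #t) eq) (cong₂ _∸_ en (sym (fr #x refl))))
  where
  main : ∀ σ → reg σ #one ≡ 1 → reg σ #n ≡ n → reg σ #cur ≡ d → reg σ #y ≡ 0 → PowAt n d e σ → reg σ #t ≡ n ∸ reg σ #x →
    PowAt n d (suc e) (⟦ loop #c3 #t #one eStep ⟧ σ)
  main σ e1 en ed ey pw et = when-rule #c3 #t eStep σ (PowAt n d (suc e)) e1 refl
    (λ z → pow-stop (m∸n≡0⇒m≤n (trans (sym et) z)) pw)
    (λ m k z → eStep-spec (tick #c3 k (init #c3 #t #one σ)) e1 en ed d≤n ey (m∸n≢0⇒n<m (λ q → 1+n≢0 (trans (sym z) (trans et q)))) pw)

one-minus : ∀ {m a} → suc m ≡ 1 ∸ a → a ≡ 0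
one-minus {a = zero}  _ = refl
one-minus {a = suc a} q = contradiction (trans q (0∸n≡0 a)) λ ()

record LogResult (n d vF vF′ : ℕ) : Set where
  field
    m      : ℕ
    large  : n ≤ d ^ m
    least  : ∀ m′ → m ≡ suc m′ → d ^ m′ < n
    chosen : (d ^ m ≡ n × vF′ ≡ ⌈ m /2⌉) ⊎ (d ^ m ≢ n × vF′ ≡ vF)

LogAt : ℕ → ℕ → ℕ → Store → Set
LogAt n d vF σ = LogResult n d vF (reg σ #F) × reg σ #cur ≡ d ∸ 1

dPost-spec : ∀ σ {n d vF} → 2 ≤ d → reg σ #one ≡ 1 → reg σ #n ≡ n → reg σ #cur ≡ d → reg σ #F ≡ vF → PowAt n d n σ →
  LogAt n d vF (⟦ dPost ⟧ σ)
dPost-spec σ {n} {d} {vF} 2≤d e1 en ed eF pw =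
  seq dPost dTest _ refl (LogAt n d vF) σ λ σ₁ fr₁ m₁ q₁ →
  seq (loop #c3 #t #one (op (move #F #j)) ⨾ op (sub #cur #cur #one)) (loop #c3 #t #one (op (move #F #j))) (op (sub #cur #cur #one)) refl
    (LogAt n d vF) σ₁ λ σ₂ fr₂ m₂ q₂ →
  record { m = exponent pw ; large = subst (n ≤_) (power≡ pw) n≤x ; least = minimal pw
         ; chosen = subst (λ τ → Chosen (reg τ #F)) (sym q₂) (choose σ₁ (trans (fr₁ #one refl) e1) (trans (fr₁ #F refl) eF) (fr₁ #j refl)
             (trans (cong (λ τ → reg τ #t) q₁) (cong₂ _∸_ e1 (cong (λ z → reg σ #x ∸ z) en)))) } ,
  cong₂ _∸_ (trans (fr₂ #cur refl) (trans (fr₁ #cur refl) ed)) (trans (fr₂ #one refl) (trans (fr₁ #one refl) e1))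
  where
  n≤x : n ≤ reg σ #x
  n≤x with reg σ #x <? n
  ... | no ¬p = ≮⇒≥ ¬p
  ... | yes p = contradiction (subst (_< n) (trans (power≡ pw) (cong (d ^_) (running pw p))) p) (<-asym (m<n^m n 2≤d))
  Chosen : ℕ → Set
  Chosen vF′ = (d ^ exponent pw ≡ n × vF′ ≡ ⌈ exponent pw /2⌉) ⊎ (d ^ exponent pw ≢ n × vF′ ≡ vF)
  choose : ∀ τ → reg τ #one ≡ 1 → reg τ #F ≡ vF → reg τ #j ≡ reg σ #j → reg τ #t ≡ 1 ∸ (reg σ #x ∸ n) →
    Chosen (reg (⟦ loop #c3 #t #one (op (move #F #j)) ⟧ τ) #F)
  choose τ e1 eF ej et = when-rule #c3 #t (op (move #F #j)) τ (λ τ → Chosen (reg τ #F)) e1 refl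
    (λ z → inj₂ ((λ q → contradiction (trans (sym z) (trans et (cong (1 ∸_) (trans (cong (_∸ n) (trans (power≡ pw) q)) (n∸n≡0 n))))) λ ()) , eF))
    (λ m k z → inj₁ (trans (sym (power≡ pw)) (≤-antisym (m∸n≡0⇒m≤n (one-minus (trans (sym z) et))) n≤x) , trans ej (ceil≡ pw)))

dBody-spec : ∀ σ {n d vF} → 2 ≤ d → d ≤ n → reg σ #one ≡ 1 → reg σ #n ≡ n → reg σ #cur ≡ d → reg σ #F ≡ vF → LogAt n d vF (⟦ dBody ⟧ σ)
dBody-spec σ {n} {d} {vF} 2≤d d≤n e1 en ed eF =
  seq dBody dInit (loop #c2 #n #n eBody ⨾ dPost) refl (LogAt n d vF) σ λ σ₁ fr₁ m₁ q₁ →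
  seq (loop #c2 #n #n eBody ⨾ dPost) (loop #c2 #n #n eBody) dPost refl (LogAt n d vF) σ₁ λ σ₂ fr₂ m₂ q₂ →
  dPost-spec σ₂ 2≤d (trans (fr₂ #one refl) (trans (fr₁ #one refl) e1)) (trans (fr₂ #n refl) (trans (fr₁ #n refl) en))
    (trans (fr₂ #cur refl) (trans (fr₁ #cur refl) ed)) (trans (fr₂ #F refl) (trans (fr₁ #F refl) eF))
    (subst (PowAt n d n) (sym q₂) (loop-rule #c2 #n #n eBody σ₁ (PowAt n d) n
      (trans (trips #c2 #n #n σ₁ refl ≤-refl) (trans (fr₁ #n refl) en))
      (subst (PowAt n d 0) (cong (init #c2 #n #n) (sym q₁)) pow₀)
      (λ e k σ′ _ _ fr h → eBody-spec (tick #c2 k σ′) (trans (fr #one refl) (trans (fr₁ #one refl) e1))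
        (trans (fr #n refl) (trans (fr₁ #n refl) en)) (trans (fr #cur refl) (trans (fr₁ #cur refl) ed)) d≤n
        (trans (fr #y refl) (cong (λ τ → reg τ #y) q₁)) h)))
  where
  pow₀ : PowAt n d 0 (init #c2 #n #n (⟦ dInit ⟧ σ))
  pow₀ = record { exponent = 0 ; power≡ = refl ; ceil≡ = refl ; floor≡ = refl ; running = λ _ → refl ; minimal = λ _ () }

prime-∣-power : ∀ {p d} m → Prime p → p ∣ d ^ m → p ∣ d
prime-∣-power zero pr p∣ = contradiction (∣1⇒≡1 p∣) (>⇒≢ (nonTrivial⇒n>1 _ {{prime⇒nonTrivial pr}}))
prime-∣-power {d = d} (suc m) pr p∣ with euclidsLemma d (d ^ m) pr p∣
... | inj₁ q = q
... | inj₂ q = prime-∣-power m pr q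

^-cancel-< : ∀ b {x y} → 1 < b → b ^ x < b ^ y → x < y
^-cancel-< b 1<b h = ≰⇒> (λ y≤x → <⇒≱ h (^-monoʳ-≤ b {{>-nonZero (<⇒≤ 1<b)}} y≤x))

exponent-unique : ∀ {p} m k → 1 < p → p ^ k ≤ p ^ m → (∀ m′ → m ≡ suc m′ → p ^ m′ < p ^ k) → m ≡ k
exponent-unique {p} m k 1<p le h = ≤-antisym (upper-bound m h) (≮⇒≥ (λ m<k → <⇒≱ (^-monoʳ-< p 1<p m<k) le))
  where
  upper-bound : ∀ m → (∀ m′ → m ≡ suc m′ → p ^ m′ < p ^ k) → m ≤ k
  upper-bound zero    h = z≤n
  upper-bound (suc m) h = ^-cancel-< p 1<p (h m refl)

small-power : ∀ {p} k → Prime p → p ^ k < p → 0 ≡ ⌈ k /2⌉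
small-power zero    pr h = refl
small-power {p} (suc k) pr h =
  contradiction (≤-trans (≤-reflexive (sym (*-identityʳ p))) (*-monoʳ-≤ p (m^n>0 p {{prime⇒nonZero pr}} k))) (<⇒≱ h)

exponent-positive : ∀ {p} k → 2 ≤ p ^ k → 0 < k
exponent-positive zero    (s≤s ())
exponent-positive (suc k) _ = s≤s z≤n

∣-power : ∀ {p} k → 0 < k → p ∣ p ^ k
∣-power {p} (suc k) _ = m∣m*n (p ^ k)

-- A base with a power equal to n > 1 is a multiple of p by Euclid's lemma, so the last hit of the
-- descending scan is p itself. Accordingly the invariant promises the value of `#F` only when the
-- scan has passed below p; for n = 1 this is the case from the start, with `#F` = 0.
halfLog-spec : ∀ σ {n p k} → Prime p → n ≡ p ^ k → reg σ #one ≡ 1 → reg σ #n ≡ n → reg (⟦ halfLog ⟧ σ) #F ≡ ⌈ k /2⌉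
halfLog-spec σ {n} {p} {k} pr refl e1 en =
  seq halfLog (op (set0 #F) ⨾ op (move #cur #n) ⨾ op (sub #t #n #one)) (loop #c1 #t #n dBody) refl (λ τ → reg τ #F ≡ ⌈ k /2⌉) σ λ σ₁ fr₁ m₁ q₁ →
  finish (⟦ loop #c1 #t #n dBody ⟧ σ₁) (loop-rule #c1 #t #n dBody σ₁ P (n ∸ 1)
    (trans (trips #c1 #t #n σ₁ refl (subst₂ _≤_ (sym (t₁ σ₁ q₁)) (sym (trans (fr₁ #n refl) en)) (m∸n≤m n 1))) (t₁ σ₁ q₁))
    (trans (cong (λ τ → reg τ #cur) q₁) en , λ n<p → trans (cong (λ τ → reg τ #F) q₁) (small-power k pr n<p))
    (λ t k′ σ′ t< _ fr (ec , h) → step t t< σ′ h (⟦ dBody ⟧ (tick #c1 k′ σ′))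
      (dBody-spec (tick #c1 k′ σ′) (2≤ t t<) (m∸n≤m n t) (trans (fr #one refl) (trans (fr₁ #one refl) e1))
        (trans (fr #n refl) (trans (fr₁ #n refl) en)) ec refl)))
  where
  1<p : 1 < p
  1<p = nonTrivial⇒n>1 p {{prime⇒nonTrivial pr}}
  P : ℕ → Store → Set
  P t τ = reg τ #cur ≡ n ∸ t × (n ∸ t < p → reg τ #F ≡ ⌈ k /2⌉)
  t₁ : ∀ σ₁ → σ₁ ≡ _ → reg σ₁ #t ≡ n ∸ 1
  t₁ σ₁ q₁ = trans (cong (λ τ → reg τ #t) q₁) (cong₂ _∸_ en e1)
  2≤ : ∀ t → t < n ∸ 1 → 2 ≤ n ∸ t
  2≤ t t< = m+n≤o⇒m≤o∸n 2 (≤-trans (s≤s t<) (≤-reflexive (m+[n∸m]≡n (m^n>0 p {{prime⇒nonZero pr}} k))))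
  finish : ∀ τ → P (n ∸ 1) τ → reg τ #F ≡ ⌈ k /2⌉
  finish τ (_ , h) = h (subst (_< p) (sym (m∸[m∸n]≡n (m^n>0 p {{prime⇒nonZero pr}} k))) 1<p)
  step : ∀ t → t < n ∸ 1 → ∀ σ′ → (n ∸ t < p → reg σ′ #F ≡ ⌈ k /2⌉) → ∀ τ → LogAt n (n ∸ t) (reg σ′ #F) τ → P (suc t) τ
  step t t< σ′ h τ (r , ec) = trans ec (trans (∸-+-assoc n t 1) (cong (n ∸_) (+-comm t 1))) , λ d< → main (m≤n⇒m<n∨m≡n (d≤p d<))
    where
    open LogResult r
    d≤p : n ∸ suc t < p → n ∸ t ≤ p
    d≤p q = ≤-trans (≤-reflexive (trans (sym (m+[n∸m]≡n (≤-trans (s≤s z≤n) (2≤ t t<)))) (cong suc (trans (∸-+-assoc n t 1) (cong (n ∸_) (+-comm t 1)))))) q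
    p∣n : p ∣ n
    p∣n = ∣-power k (exponent-positive k (≤-trans (2≤ t t<) (m∸n≤m n t)))
    m≡k : n ∸ t ≡ p → m ≡ k
    m≡k d≡p = exponent-unique m k 1<p (subst (λ d → n ≤ d ^ m) d≡p large) (λ m′ e → subst (λ d → d ^ m′ < n) d≡p (least m′ e))
    main : n ∸ t < p ⊎ n ∸ t ≡ p → reg τ #F ≡ ⌈ k /2⌉
    main (inj₁ d<p) with chosen
    ... | inj₂ (_ , e) = trans e (h d<p)
    ... | inj₁ (e , _) = contradiction (∣⇒≤ {{>-nonZero (≤-trans (s≤s z≤n) (2≤ t t<))}} (prime-∣-power m pr (subst (p ∣_) (sym e) p∣n))) (<⇒≱ d<p)
    main (inj₂ d≡p) with chosen
    ... | inj₁ (_ , e)  = trans e (cong ⌈_/2⌉ (m≡k d≡p))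
    ... | inj₂ (ne , _) = contradiction (cong₂ _^_ d≡p (m≡k d≡p)) ne

set0-zero : ∀ e d σ → reg σ d ≡ 0 ⊎ d ≡ e → reg (apply (set0 e) σ) d ≡ 0
set0-zero e d σ h with d Fin.≟ e | h
... | yes refl | _      = ≔-same (reg σ) d 0
... | no d≢e   | inj₁ q = trans (updateAt-minimal d e (reg σ) d≢e) q
... | no d≢e   | inj₂ q = contradiction q d≢e

clear : List Reg → Stmt
clear []       = op (set0 dec)
clear (d ∷ ds) = op (set0 d) ⨾ clear ds

clear-zero : ∀ ds σ d → reg σ d ≡ 0 ⊎ d ∈ ds → reg (⟦ clear ds ⟧ σ) d ≡ 0
clear-zero []       σ d (inj₁ h)         = set0-zero dec d σ (inj₁ h)
clear-zero (e ∷ ds) σ d (inj₁ h)         = clear-zero ds (apply (set0 e) σ) d (inj₁ (set0-zero e d σ (inj₁ h)))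
clear-zero (e ∷ ds) σ d (inj₂ (here q))  = clear-zero ds (apply (set0 e) σ) d (inj₁ (set0-zero e d σ (inj₂ q)))
clear-zero (e ∷ ds) σ d (inj₂ (there q)) = clear-zero ds (apply (set0 e) σ) d (inj₂ q)

-- Clearing the scratch registers restores the bound on the numbers present after each round.
reset : Stmt
reset = clear (map (13 ↑ʳ_) (allFin 16))

clear-dec : ∀ ds σ → reg (⟦ clear ds ⟧ σ) dec ≡ 0
clear-dec []       σ = refl
clear-dec (d ∷ ds) σ = clear-dec ds (apply (set0 d) σ)

Clear : Store → Set
Clear σ = reg σ dec ≡ 0 × (∀ (e : Fin 16) → reg σ (13 ↑ʳ e) ≡ 0)

reset-spec : ∀ σ → Clear (⟦ reset ⟧ σ)
reset-spec σ = clear-dec (map (13 ↑ʳ_) (allFin 16)) σ ,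
  λ e → clear-zero (map (13 ↑ʳ_) (allFin 16)) σ (13 ↑ʳ e) (inj₂ (∈-map⁺ (13 ↑ʳ_) (∈-allFin e)))

-- One round for G and one round for H

fullTest : Stmt
fullTest = op (sub #t #n #len) ⨾ op (sub #t #one #t) ⨾ op (add #v #Z #code)

gMark : Stmt
gMark = fullTest ⨾ loop #c4 #t #one (op (store #v #one))

hAdd : Stmt
hAdd = op (load #v #v) ⨾ op (add #ans #ans #v)

-- Flags are 0 or 1 and are added up, so `#ans` counts the hits. It stays at most N, which bounds
-- its length.
hLook : Stmt
hLook = fullTest ⨾ loop #c4 #t #one hAdd

-- All L slots are encoded, including those behind a completed greedy tuple, which hold leftovers.
-- This is harmless: the second halves tried for H are unrestricted, so the images of the leftovers
-- are tried as well. A completion that does not fit into L slots fails the test in `gMark`, unless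
-- the first L slots generate G already.
gTry : Stmt
gTry = odometer ⨾ op (move #cur #F) ⨾ greedy ⨾ op (move #cur #L) ⨾ closure ⨾ gMark ⨾ reset

hTry : Stmt
hTry = odometer ⨾ op (move #cur #L) ⨾ closure ⨾ hLook ⨾ reset

gMark-spec : ∀ σ {n l z c} → reg σ #one ≡ 1 → reg σ #n ≡ n → reg σ #len ≡ l → reg σ #Z ≡ z → reg σ #code ≡ c →
  (n ≤ l × mem (⟦ gMark ⟧ σ) ≡ write (mem σ) (z + c) 1) ⊎ (¬ n ≤ l × mem (⟦ gMark ⟧ σ) ≡ mem σ)
gMark-spec σ {n} {l} {z} {c} e1 en el ez ec =
  seq gMark fullTest (loop #c4 #t #one (op (store #v #one))) refl Q σ λ σ′ fr m e →
  when-rule #c4 #t (op (store #v #one)) σ′ Q (trans (fr #one refl) e1) refl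
    (λ q → inj₂ ((λ le → contradiction (trans (sym q) (trans (t≡ σ′ e) (cong (1 ∸_) (m≤n⇒m∸n≡0 le)))) λ ()) , m refl))
    (λ j k q → inj₁ (m∸n≡0⇒m≤n (one-minus (trans (sym q) (t≡ σ′ e))) ,
      trans (cong (λ M → write M (reg σ′ #v) (reg σ′ #one)) (m refl))
        (cong₂ (write (mem σ)) (trans (cong (λ τ → reg τ #v) e) (cong₂ _+_ ez ec)) (trans (fr #one refl) e1))))
  where
  Q : Store → Set
  Q τ = (n ≤ l × mem τ ≡ write (mem σ) (z + c) 1) ⊎ (¬ n ≤ l × mem τ ≡ mem σ)
  t≡ : ∀ σ′ → σ′ ≡ ⟦ fullTest ⟧ σ → reg σ′ #t ≡ 1 ∸ (n ∸ l)
  t≡ σ′ e = trans (cong (λ τ → reg τ #t) e) (cong₂ _∸_ e1 (cong₂ _∸_ en el))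

hLook-spec : ∀ σ {n l z c} → reg σ #one ≡ 1 → reg σ #n ≡ n → reg σ #len ≡ l → reg σ #Z ≡ z → reg σ #code ≡ c →
  mem (⟦ hLook ⟧ σ) ≡ mem σ ×
  ((n ≤ l × reg (⟦ hLook ⟧ σ) #ans ≡ reg σ #ans + mem σ (z + c)) ⊎ (¬ n ≤ l × reg (⟦ hLook ⟧ σ) #ans ≡ reg σ #ans))
hLook-spec σ {n} {l} {z} {c} e1 en el ez ec = keepMem hLook σ refl , (
  seq hLook fullTest (loop #c4 #t #one hAdd) refl Q σ λ σ′ fr m e →
  when-rule #c4 #t hAdd σ′ Q (trans (fr #one refl) e1) refl
    (λ q → inj₂ ((λ le → contradiction (trans (sym q) (trans (t≡ σ′ e) (cong (1 ∸_) (m≤n⇒m∸n≡0 le)))) λ ()) , fr #ans refl))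
    (λ j k q → inj₁ (m∸n≡0⇒m≤n (one-minus (trans (sym q) (t≡ σ′ e))) ,
      cong₂ _+_ (fr #ans refl) (cong₂ (λ M a → M a) (m refl) (trans (cong (λ τ → reg τ #v) e) (cong₂ _+_ ez ec))))))
  where
  Q : Store → Set
  Q τ = (n ≤ l × reg τ #ans ≡ reg σ #ans + mem σ (z + c)) ⊎ (¬ n ≤ l × reg τ #ans ≡ reg σ #ans)
  t≡ : ∀ σ′ → σ′ ≡ ⟦ fullTest ⟧ σ → reg σ′ #t ≡ 1 ∸ (n ∸ l)
  t≡ σ′ e = trans (cong (λ τ → reg τ #t) e) (cong₂ _∸_ e1 (cong₂ _∸_ en el))

record Const (n w F b o : ℕ) (σ : Store) : Set where
  field
    kn : reg σ #n ≡ n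
    k1 : reg σ #one ≡ 1
    kW : reg σ #W ≡ w
    kF : reg σ #F ≡ F
    kL : reg σ #L ≡ F + F
    kN : reg σ #N ≡ n ^ F
    kT : reg σ #T ≡ b
    kX : reg σ #X ≡ w + w
    kZ : reg σ #Z ≡ w + w + w
    kO : reg σ #O ≡ o
open Const public

constRegs : Stmt → Bool
constRegs s = envRegs s ∨ (assigns s #F ∨ (assigns s #L ∨ (assigns s #N ∨ (assigns s #Z ∨ assigns s #O))))

const-frame : ∀ s {n w F b o} σ σ′ → constRegs s ≡ false → Frame s σ σ′ → Const n w F b o σ → Const n w F b o σ′
const-frame s σ σ′ p fr k with ∨-false {envRegs s} p
... | p₀ , p₁ with ∨-false {assigns s #F} p₁
... | pF , p₂ with ∨-false {assigns s #L} p₂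
... | pL , p₃ with ∨-false {assigns s #N} p₃
... | pN , p₄ with ∨-false {assigns s #Z} p₄
... | pZ , pO with env-frame s σ σ′ p₀ fr (env (kn k) (k1 k) (kW k) (kX k) (kT k))
... | env a b c d e = record { kn = a ; k1 = b ; kW = c ; kX = d ; kT = e ; kF = trans (fr #F pF) (kF k) ; kL = trans (fr #L pL) (kL k)
    ; kN = trans (fr #N pN) (kN k) ; kZ = trans (fr #Z pZ) (kZ k) ; kO = trans (fr #O pO) (kO k) }

const-env : ∀ {n w F b o} σ → Const n w F b o σ → Env n w b σ
const-env σ k = env (kn k) (k1 k) (kW k) (kX k) (kT k)

module Try {n : ℕ} (G : GroupTable n) (w b F : ℕ) (bn≤w : b + n * n ≤ w) (Fn≤w : F + n ≤ w) (FF≤w : F + F ≤ w) (0<F : 0 < F) where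

  n≤w : n ≤ w
  n≤w = ≤-trans (m≤n+m n F) Fn≤w

  open GreedySpec G w b bn≤w n≤w public
  open Input
  open Agree
  open Holds
  open Scratch
  open Runs G public

  private
    F≤w : F ≤ w
    F≤w = ≤-trans (m≤m+n F n) Fn≤w
    0<w : 0 < w
    0<w = ≤-trans 0<F F≤w

  L : ℕ
  L = F + F

  odo-scratch : ∀ {M M′ c} → c + F ≤ w → Input M → OdoResult n M (w + c) F M′ → Scratch M M′
  odo-scratch {M} {M′} {c} cF≤w inp od = scratch (λ a p → odo-below od a (≤-trans p (m≤m+n w c)))
    (λ a p → odo-above od a (≤-trans top (≤-trans (m≤m+n (w + w) w) p))) new
    (λ i p → subst (_< n) (sym (odo-above od (w + w + i) (≤-trans top (m≤m+n (w + w) i)))) (aux inp i p))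
    where
    top : w + c + F ≤ w + w
    top = ≤-trans (≤-reflexive (+-assoc w c F)) (+-monoʳ-≤ w cF≤w)
    new : ∀ j → j < w → M′ (w + j) < n
    new j p with j <? c
    ... | yes q = subst (_< n) (sym (odo-below od (w + j) (+-monoʳ-< w q))) (slot inp j p)
    ... | no ¬q with j <? c + F
    ... | yes r = subst (λ a → M′ a < n) (trans (+-assoc w c (j ∸ c)) (cong (λ z → w + z) (m+[n∸m]≡n (≮⇒≥ ¬q))))
                    (odo-digit od (j ∸ c) (+-cancelˡ-< c _ _ (subst (_< c + F) (sym (m+[n∸m]≡n (≮⇒≥ ¬q))) r)))
    ... | no ¬r = subst (_< n) (sym (odo-above od (w + j) (≤-trans (≤-reflexive (+-assoc w c F)) (+-monoʳ-≤ w (≮⇒≥ ¬r))))) (slot inp j p)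

  record GTry (M M′ : ℕ → ℕ) : Set where
    constructor gtry
    field
      {M₁ M₂ M₃} : ℕ → ℕ
      c₁   : ℕ
      odo  : OdoResult n M w F M₁
      scr  : Scratch M₁ M₂
      fix  : ∀ j → j < F → M₂ (w + j) ≡ M₁ (w + j)
      gr   : Greedy G (slots M₂) F c₁
      agr  : Agree M₂ M₃
      mark : (n ≤ order (slots M₂) L × M′ ≡ write M₃ (w + w + w + code (slots M₂) L) 1) ⊎ (¬ n ≤ order (slots M₂) L × M′ ≡ M₃)

  Q₁ : (ℕ → ℕ) → Store → Set
  Q₁ M σ = GTry M (mem σ) × Clear σ

  gEnd-spec : ∀ σ {M M₁ M₂ c₁} → Const n w F b w σ → OdoResult n M w F M₁ → Scratch M₁ M₂ →
    (∀ j → j < F → M₂ (w + j) ≡ M₁ (w + j)) → Greedy G (slots M₂) F c₁ → Closed M₂ (slots M₂) L σ → Q₁ M (⟦ gMark ⨾ reset ⟧ σ)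
  gEnd-spec σ {M} {M₁} {M₂} {c₁} k od sc fx gr cl =
    seq (gMark ⨾ reset) gMark reset refl (Q₁ M) σ λ σ′ fr m e →
    gtry c₁ od sc fx gr (agree cl)
      (subst (λ M′ → (n ≤ order (slots M₂) L × M′ ≡ write (mem σ) (w + w + w + code (slots M₂) L) 1) ⊎ (¬ n ≤ order (slots M₂) L × M′ ≡ mem σ))
        (sym (trans (keepMem reset σ′ refl) (cong mem e)))
        (gMark-spec σ (k1 k) (kn k) (len≡ cl) (kZ k) (code≡ cl))) ,
    reset-spec σ′

  gClose-spec : ∀ σ {M M₁ M₂ c₁} → Const n w F b w σ → OdoResult n M w F M₁ → Input M₁ → Scratch M₁ M₂ →
    (∀ j → j < F → M₂ (w + j) ≡ M₁ (w + j)) → Greedy G (slots M₂) F c₁ → mem σ ≡ M₂ →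
    Q₁ M (⟦ op (move #cur #L) ⨾ closure ⨾ gMark ⨾ reset ⟧ σ)
  gClose-spec σ {M} k od inp sc fx gr refl =
    seq (op (move #cur #L) ⨾ closure ⨾ gMark ⨾ reset) (op (move #cur #L)) (closure ⨾ gMark ⨾ reset) refl (Q₁ M) σ λ σ₁ fr₁ m₁ e₁ →
    seq (closure ⨾ gMark ⨾ reset) closure (gMark ⨾ reset) refl (Q₁ M) σ₁ λ σ₂ fr₂ m₂ e₂ →
    gEnd-spec σ₂ (const-frame closure σ₁ σ₂ refl fr₂ (const-frame (op (move #cur #L)) σ σ₁ refl fr₁ k)) od sc fx gr
      (subst (Closed (mem σ) (slots (mem σ)) L) (sym e₂)
        (subst (λ M′ → Closed M′ (slots (mem σ)) L (⟦ closure ⟧ σ₁)) (m₁ refl)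
          (closure-spec σ₁ (slots (mem σ)) L (const-env σ₁ (const-frame (op (move #cur #L)) σ σ₁ refl fr₁ k))
            (subst Input (sym (m₁ refl)) (scratch-input inp sc)) 0<w (trans (cong (λ τ → reg τ #cur) e₁) (kL k)) FF≤w
            (λ j p → trans (cong (λ M′ → M′ (w + j)) (m₁ refl)) (sym (toℕ-decode _ (slot′ sc j p)))))))

  gGreedy-spec : ∀ σ {M M₁} → Const n w F b w σ → OdoResult n M w F M₁ → Input M₁ → mem σ ≡ M₁ →
    Q₁ M (⟦ op (move #cur #F) ⨾ greedy ⨾ op (move #cur #L) ⨾ closure ⨾ gMark ⨾ reset ⟧ σ)
  gGreedy-spec σ {M} {M₁} k od inp em =
    seq (op (move #cur #F) ⨾ greedy ⨾ op (move #cur #L) ⨾ closure ⨾ gMark ⨾ reset) (op (move #cur #F))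
      (greedy ⨾ op (move #cur #L) ⨾ closure ⨾ gMark ⨾ reset) refl (Q₁ M) σ λ σ₁ fr₁ m₁ e₁ →
    seq (greedy ⨾ op (move #cur #L) ⨾ closure ⨾ gMark ⨾ reset) greedy (op (move #cur #L) ⨾ closure ⨾ gMark ⨾ reset) refl (Q₁ M) σ₁ λ σ₂ fr₂ m₂ e₂ →
    go σ₂ (const-frame greedy σ₁ σ₂ refl fr₂ (const-frame (op (move #cur #F)) σ σ₁ refl fr₁ k))
      (subst (λ τ → ∃[ c₁ ] Greedy G (slots (mem τ)) F c₁ × Scratch M₁ (mem τ) × (∀ j → j < F → mem τ (w + j) ≡ M₁ (w + j))) (sym e₂)
        (greedy-spec 0<F Fn≤w inp σ₁ (const-env σ₁ (const-frame (op (move #cur #F)) σ σ₁ refl fr₁ k)) (trans (m₁ refl) em)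
          (trans (cong (λ τ → reg τ #cur) e₁) (kF k))))
    where
    go : ∀ τ → Const n w F b w τ → (∃[ c₁ ] Greedy G (slots (mem τ)) F c₁ × Scratch M₁ (mem τ) × (∀ j → j < F → mem τ (w + j) ≡ M₁ (w + j))) →
      Q₁ M (⟦ op (move #cur #L) ⨾ closure ⨾ gMark ⨾ reset ⟧ τ)
    go τ k (c₁ , gr , sc , fx) = gClose-spec τ k od inp sc fx gr refl

  gTry-spec : ∀ σ → Const n w F b w σ → Input (mem σ) → Q₁ (mem σ) (⟦ gTry ⟧ σ)
  gTry-spec σ k inp =
    seq gTry odometer (op (move #cur #F) ⨾ greedy ⨾ op (move #cur #L) ⨾ closure ⨾ gMark ⨾ reset) refl (Q₁ (mem σ)) σ λ σ′ fr m e →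
    go σ′ (const-frame odometer σ σ′ refl fr k) (subst (λ τ → OdoResult n (mem σ) w F (mem τ)) (sym e)
      (odometer-spec σ (k1 k) (kn k) (kO k) (kF k) (≤-trans F≤w (≤-reflexive (sym (kW k)))) (λ i p → slot inp i (≤-trans p F≤w))))
    where
    go : ∀ τ → Const n w F b w τ → OdoResult n (mem σ) w F (mem τ) →
      Q₁ (mem σ) (⟦ op (move #cur #F) ⨾ greedy ⨾ op (move #cur #L) ⨾ closure ⨾ gMark ⨾ reset ⟧ τ)
    go τ k od = gGreedy-spec τ k od (scratch-input inp (odo-scratch {c = 0} F≤w inp (subst (λ o → OdoResult n (mem σ) o F (mem τ)) (sym (+-identityʳ w)) od))) refl

  record HTry (M : ℕ → ℕ) (vans : ℕ) (M′ : ℕ → ℕ) (vans′ : ℕ) : Set where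
    constructor htry
    field
      {M₁} : ℕ → ℕ
      odo  : OdoResult n M (w + F) F M₁
      agr  : Agree M₁ M′
      look : (n ≤ order (slots M₁) L × vans′ ≡ vans + M′ (w + w + w + code (slots M₁) L)) ⊎ (¬ n ≤ order (slots M₁) L × vans′ ≡ vans)

  Q₂ : (ℕ → ℕ) → ℕ → Store → Set
  Q₂ M v σ = HTry M v (mem σ) (reg σ #ans) × Clear σ

  hEnd-spec : ∀ σ {M M₁} → Const n w F b (w + F) σ → OdoResult n M (w + F) F M₁ → Closed M₁ (slots M₁) L σ →
    Q₂ M (reg σ #ans) (⟦ hLook ⨾ reset ⟧ σ)
  hEnd-spec σ {M} {M₁} k od cl =
    seq (hLook ⨾ reset) hLook reset refl (Q₂ M (reg σ #ans)) σ λ σ′ fr m e →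
    go σ′ (subst (λ τ → mem τ ≡ mem σ × Look (reg τ #ans)) (sym e) (hLook-spec σ (k1 k) (kn k) (len≡ cl) (kZ k) (code≡ cl)))
    where
    Look : ℕ → Set
    Look v = (n ≤ order (slots M₁) L × v ≡ reg σ #ans + mem σ (w + w + w + code (slots M₁) L)) ⊎ (¬ n ≤ order (slots M₁) L × v ≡ reg σ #ans)
    go : ∀ τ → mem τ ≡ mem σ × Look (reg τ #ans) → Q₂ M (reg σ #ans) (⟦ reset ⟧ τ)
    go τ (em , lk) = htry od (subst (Agree M₁) (sym em′) (agree cl))
        (subst₂ (λ M′ v → (n ≤ order (slots M₁) L × v ≡ reg σ #ans + M′ (w + w + w + code (slots M₁) L)) ⊎ (¬ n ≤ order (slots M₁) L × v ≡ reg σ #ans))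
          (sym em′) (sym (keep reset #ans τ refl)) lk) , reset-spec τ
      where em′ = trans (keepMem reset τ refl) em

  hClose-spec : ∀ σ {M M₁} → Const n w F b (w + F) σ → OdoResult n M (w + F) F M₁ → Input M₁ → mem σ ≡ M₁ →
    Q₂ M (reg σ #ans) (⟦ op (move #cur #L) ⨾ closure ⨾ hLook ⨾ reset ⟧ σ)
  hClose-spec σ {M} k od inp refl =
    seq (op (move #cur #L) ⨾ closure ⨾ hLook ⨾ reset) (op (move #cur #L)) (closure ⨾ hLook ⨾ reset) refl (Q₂ M (reg σ #ans)) σ λ σ₁ fr₁ m₁ e₁ →
    seq (closure ⨾ hLook ⨾ reset) closure (hLook ⨾ reset) refl (Q₂ M (reg σ #ans)) σ₁ λ σ₂ fr₂ m₂ e₂ →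
    subst (λ v → Q₂ M v (⟦ hLook ⨾ reset ⟧ σ₂)) (trans (fr₂ #ans refl) (fr₁ #ans refl))
     (hEnd-spec σ₂ (const-frame closure σ₁ σ₂ refl fr₂ (const-frame (op (move #cur #L)) σ σ₁ refl fr₁ k)) od
      (subst (Closed (mem σ) (slots (mem σ)) L) (sym e₂)
        (subst (λ M′ → Closed M′ (slots (mem σ)) L (⟦ closure ⟧ σ₁)) (m₁ refl)
          (closure-spec σ₁ (slots (mem σ)) L (const-env σ₁ (const-frame (op (move #cur #L)) σ σ₁ refl fr₁ k))
            (subst Input (sym (m₁ refl)) inp) 0<w (trans (cong (λ τ → reg τ #cur) e₁) (kL k)) FF≤w
            (λ j p → trans (cong (λ M′ → M′ (w + j)) (m₁ refl)) (sym (toℕ-decode _ (slot inp j p))))))))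

  hTry-spec : ∀ σ → Const n w F b (w + F) σ → Input (mem σ) → Q₂ (mem σ) (reg σ #ans) (⟦ hTry ⟧ σ)
  hTry-spec σ k inp =
    seq hTry odometer (op (move #cur #L) ⨾ closure ⨾ hLook ⨾ reset) refl (Q₂ (mem σ) (reg σ #ans)) σ λ σ′ fr m e →
    subst (λ v → Q₂ (mem σ) v (⟦ op (move #cur #L) ⨾ closure ⨾ hLook ⨾ reset ⟧ σ′)) (fr #ans refl)
     (go σ′ (const-frame odometer σ σ′ refl fr k) (subst (λ τ → OdoResult n (mem σ) (w + F) F (mem τ)) (sym e)
      (odometer-spec σ (k1 k) (kn k) (kO k) (kF k) (≤-trans F≤w (≤-reflexive (sym (kW k))))
        (λ i p → subst (λ a → mem σ a < n) (sym (+-assoc w F i)) (slot inp (F + i) (≤-trans (+-monoʳ-< F p) FF≤w))))))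
    where
    go : ∀ τ → Const n w F b (w + F) τ → OdoResult n (mem σ) (w + F) F (mem τ) →
      Q₂ (mem σ) (reg τ #ans) (⟦ op (move #cur #L) ⨾ closure ⨾ hLook ⨾ reset ⟧ τ)
    go τ k od = hClose-spec τ k od (scratch-input inp (odo-scratch {c = F} FF≤w inp od)) refl

-- Invariants of the two phases, and the verdict

up-to : ∀ {j} (P : ℕ → Set) → (∀ c → c < j → P c) → P j → ∀ c → c < suc j → P c
up-to {j} P h p c q with m≤n⇒m<n∨m≡n (s≤s⁻¹ q)
... | inj₁ r    = h c r
... | inj₂ refl = p

module Phases {n p k : ℕ} (G H : GroupTable n) (pr : Prime p) (n≡ : n ≡ p ^ k) (M₀ : ℕ → ℕ) (w : ℕ)
  (tables≤w : 1 + n * n + n * n ≤ w) (2n≤w : n + n ≤ w)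
  (tabG : ∀ x y → M₀ (1 + toℕ x * n + toℕ y) ≡ suc (toℕ (GroupTable._∙_ G x y)))
  (tabH : ∀ x y → M₀ (1 + n * n + toℕ x * n + toℕ y) ≡ suc (toℕ (GroupTable._∙_ H x y))) where

  F N : ℕ
  F = suc ⌈ k /2⌉
  N = n ^ F

  F≤n : F ≤ n
  F≤n = ≤-trans (s≤s (⌈n/2⌉≤n k)) (≤-trans (m<n^m k (nonTrivial⇒n>1 p {{prime⇒nonTrivial pr}})) (≤-reflexive (sym n≡)))

  private
    Fn≤w = ≤-trans (+-monoˡ-≤ n F≤n) 2n≤w
    FF≤w = ≤-trans (+-mono-≤ F≤n F≤n) 2n≤w
    0<F : 0 < F
    0<F = s≤s z≤n

  module A = Try G w 1 F (≤-trans (m≤m+n (1 + n * n) (n * n)) tables≤w) Fn≤w FF≤w 0<F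
  module B = Try H w (1 + n * n) F tables≤w Fn≤w FF≤w 0<F

  L : ℕ
  L = F + F

  record Base (M : ℕ → ℕ) : Set where
    constructor base
    field
      lowB  : ∀ a → a < w → M a ≡ M₀ a
      slotB : ∀ j → j < w → M (w + j) < n
      auxB  : ∀ i → i < w → M (w + w + i) < n
  open Base public

  inputG : ∀ {M} → Base M → A.Input M
  inputG m = record { tab = λ x y → trans (lowB m _ (≤-trans (A.cell< x y) (≤-trans (m≤m+n (1 + n * n) (n * n)) tables≤w))) (tabG x y)
    ; slot = slotB m ; aux = auxB m }

  inputH : ∀ {M} → Base M → B.Input M
  inputH m = record { tab = λ x y → trans (lowB m _ (≤-trans (B.cell< x y) tables≤w)) (tabH x y) ; slot = slotB m ; aux = auxB m }

  baseG : ∀ {M M′} → Base M → A.Scratch M M′ → Base M′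
  baseG m sc = base (λ a p → trans (A.Scratch.low′ sc a p) (lowB m a p)) (A.Scratch.slot′ sc) (A.Scratch.aux″ sc)

  baseH : ∀ {M M′} → Base M → B.Scratch M M′ → Base M′
  baseH m sc = base (λ a p → trans (B.Scratch.low′ sc a p) (lowB m a p)) (B.Scratch.slot′ sc) (B.Scratch.aux″ sc)

  Marked : (ℕ → ℕ) → ℕ → Set
  Marked M a = ∃[ f ] val n (toℕ ∘ f) 0 F ≡ a × (∃[ c₁ ] Greedy G f F c₁) × (n ≤ A.order f L → M (w + w + w + A.code f L) ≢ 0)

  -- `sound` and `done` serve the two directions: each mark stems from a generating tuple, and each
  -- first half visited has a greedy completion that is marked if it generates. As the counter moves
  -- before each trial, trial `c` treats the value `nexts N (suc c) 0`, and 0 comes last.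
  record MemG (j : ℕ) (M : ℕ → ℕ) : Set where
    field
      baseOf : Base M
      pos    : val n M w F ≡ nexts N j 0
      bit    : ∀ a → M (w + w + w + a) ≤ 1
      sound  : ∀ a → M (w + w + w + a) ≢ 0 → ∃[ f ] n ≤ A.order f L × A.code f L ≡ a
      done   : ∀ c → c < j → Marked M (nexts N (suc c) 0)

  g-advance : ∀ {j M M′} → MemG j M → A.GTry M M′ → MemG (suc j) M′
  g-advance {j} {M} {M′} mg (A.gtry {M₁} {M₂} {M₃} c₁ od sc fx gr ag mark) = result mark
    where
    open MemG mg
    Z = w + w + w
    f = A.slots M₂
    sc₁ : A.Scratch M M₁
    sc₁ = A.odo-scratch {c = 0} (≤-trans F≤n (≤-trans (m≤m+n n n) 2n≤w)) (inputG baseOf)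
      (subst (λ o → OdoResult n M o F M₁) (sym (+-identityʳ w)) od)
    sc₃ : A.Scratch M M₃
    sc₃ = A.scratch-agree (A.scratch-trans sc₁ sc) ag
    high₃ : ∀ a → M₃ (Z + a) ≡ M (Z + a)
    high₃ a = A.Scratch.high′ sc₃ (Z + a) (m≤m+n Z a)
    F≤w = ≤-trans F≤n (≤-trans (m≤m+n n n) 2n≤w)
    pos₁ : val n M₁ w F ≡ nexts N (suc j) 0
    pos₁ = trans (odo-val od) (cong (next N) pos)
    pos₃ : val n M₃ w F ≡ nexts N (suc j) 0
    pos₃ = trans (val-cong n M₃ M₁ w w F (λ i q → trans (A.Agree.low ag (w + i) (+-monoʳ-< w (≤-trans q F≤w))) (fx i q))) pos₁
    posf : val n (toℕ ∘ f) 0 F ≡ nexts N (suc j) 0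
    posf = trans (val-cong n (toℕ ∘ f) M₁ 0 w F (λ i q → trans (toℕ-decode _ (A.Scratch.slot′ sc i (≤-trans q F≤w))) (fx i q))) pos₁
    result : (n ≤ A.order f L × M′ ≡ write M₃ (Z + A.code f L) 1) ⊎ (¬ n ≤ A.order f L × M′ ≡ M₃) → MemG (suc j) M′
    result (inj₂ (¬full , refl)) = record
      { baseOf = baseG baseOf sc₃ ; pos = pos₃
      ; bit = λ a → subst (_≤ 1) (sym (high₃ a)) (bit a)
      ; sound = λ a h → sound a (λ q → h (trans (high₃ a) q))
      ; done = dn }
      where
      older : ∀ {a} → Marked M a → Marked M₃ a
      older (f′ , e , g , h) = f′ , e , g , λ full q → h full (trans (sym (high₃ (A.code f′ L))) q)
      dn : ∀ c → c < suc j → Marked M₃ (nexts N (suc c) 0)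
      dn c q = up-to (λ c → Marked M₃ (nexts N (suc c) 0)) (λ c r → older (done c r))
        (f , posf , (c₁ , gr) , λ full → contradiction full ¬full) c q
    result (inj₁ (full , refl)) = record
      { baseOf = base (λ a q → trans (miss a (<-≤-trans q w≤Z)) (lowB b₃ a q))
          (λ i q → subst (_< n) (sym (miss (w + i) (<-≤-trans (+-monoʳ-< w q) (m≤m+n (w + w) w)))) (slotB b₃ i q))
          (λ i q → subst (_< n) (sym (miss (w + w + i) (+-monoʳ-< (w + w) q))) (auxB b₃ i q))
      ; pos = trans (val-cong n M′ M₃ w w F (λ i q → miss (w + i) (<-≤-trans (+-monoʳ-< w (≤-trans q F≤w)) (m≤m+n (w + w) w)))) pos₃
      ; bit = λ a → bit′ a (a ≟ A.code f L)
      ; sound = λ a → sound′ a (a ≟ A.code f L)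
      ; done = dn }
      where
      b₃ = baseG baseOf sc₃
      x = Z + A.code f L
      w≤Z : w ≤ Z
      w≤Z = ≤-trans (m≤m+n w w) (m≤m+n (w + w) w)
      miss : ∀ a → a < Z → M′ a ≡ M₃ a
      miss a q = write-miss M₃ x 1 (<⇒≢ (<-≤-trans q (m≤m+n Z (A.code f L))))
      hit : M′ x ≡ 1
      hit = write-hit M₃ x 1
      other : ∀ a → a ≢ A.code f L → M′ (Z + a) ≡ M (Z + a)
      other a a≢ = trans (write-miss M₃ x 1 (a≢ ∘ +-cancelˡ-≡ Z a (A.code f L))) (high₃ a)
      bit′ : ∀ a → Dec (a ≡ A.code f L) → M′ (Z + a) ≤ 1
      bit′ a (yes refl) = ≤-reflexive hit
      bit′ a (no a≢)    = subst (_≤ 1) (sym (other a a≢)) (bit a)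
      sound′ : ∀ a → Dec (a ≡ A.code f L) → M′ (Z + a) ≢ 0 → ∃[ f ] n ≤ A.order f L × A.code f L ≡ a
      sound′ a (yes refl) h = f , full , refl
      sound′ a (no a≢)    h = sound a (λ q → h (trans (other a a≢) q))
      keeps : ∀ a → Dec (a ≡ A.code f L) → M (Z + a) ≢ 0 → M′ (Z + a) ≢ 0
      keeps a (yes refl) h q = contradiction (trans (sym hit) q) λ ()
      keeps a (no a≢)    h q = h (trans (sym (other a a≢)) q)
      older : ∀ {a} → Marked M a → Marked M′ a
      older (f′ , e , g , h) = f′ , e , g , λ full → keeps (A.code f′ L) (A.code f′ L ≟ A.code f L) (h full)
      dn : ∀ c → c < suc j → Marked M′ (nexts N (suc c) 0)
      dn c q = up-to (λ c → Marked M′ (nexts N (suc c) 0)) (λ c r → older (done c r))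
        (f , posf , (c₁ , gr) , λ _ q → contradiction (trans (sym hit) q) λ ()) c q

  Tested : (ℕ → ℕ) → ℕ → ℕ → Set
  Tested Mh v a = ∃[ f ] (∀ i → i < F → toℕ (f i) ≡ Mh (w + i)) × val n (toℕ ∘ f) F F ≡ a ×
    (n ≤ B.order f L → Mh (w + w + w + B.code f L) ≢ 0 → v ≢ 0)

  -- `Mh` is the memory after the greedy choice in H, and `a₀` the value of the second half found
  -- there. The flags and the first half remain those of `Mh` throughout the phase.
  record MemH (Mh : ℕ → ℕ) (a₀ j : ℕ) (M : ℕ → ℕ) (v : ℕ) : Set where
    field
      baseOf : Base M
      high   : ∀ a → w + w + w ≤ a → M a ≡ Mh a
      fixed  : ∀ i → i < F → M (w + i) ≡ Mh (w + i)
      pos    : val n M (w + F) F ≡ nexts N j a₀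
      v≤     : v ≤ j
      sound  : v ≢ 0 → ∃[ f ] n ≤ B.order f L × Mh (w + w + w + B.code f L) ≢ 0
      done   : ∀ c → c < j → Tested Mh v (nexts N (suc c) a₀)

  h-advance : ∀ {Mh a₀ j M v M′ v′} → (∀ a → Mh (w + w + w + a) ≤ 1) → MemH Mh a₀ j M v → B.HTry M v M′ v′ → MemH Mh a₀ (suc j) M′ v′
  h-advance {Mh} {a₀} {j} {M} {v} {M′} {v′} bits mh (B.htry {M₁} od ag look) = result look
    where
    open MemH mh
    Z = w + w + w
    f = B.slots M₁
    sc₁ : B.Scratch M M₁
    sc₁ = B.odo-scratch {c = F} FF≤w (inputH baseOf) od
    sc′ : B.Scratch M M′
    sc′ = B.scratch-agree sc₁ ag
    F≤w = ≤-trans (m≤m+n F F) FF≤w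
    high′ : ∀ a → Z ≤ a → M′ a ≡ Mh a
    high′ a q = trans (B.Scratch.high′ sc′ a q) (high a q)
    fixed₁ : ∀ i → i < F → M₁ (w + i) ≡ Mh (w + i)
    fixed₁ i q = trans (odo-below od (w + i) (+-monoʳ-< w q)) (fixed i q)
    fixed′ : ∀ i → i < F → M′ (w + i) ≡ Mh (w + i)
    fixed′ i q = trans (B.Agree.low ag (w + i) (+-monoʳ-< w (≤-trans q F≤w))) (fixed₁ i q)
    pos₁ : val n M₁ (w + F) F ≡ nexts N (suc j) a₀
    pos₁ = trans (odo-val od) (cong (next N) pos)
    tail< : ∀ {i} → i < F → F + i < w
    tail< q = ≤-trans (+-monoʳ-< F q) FF≤w
    pos′ : val n M′ (w + F) F ≡ nexts N (suc j) a₀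
    pos′ = trans (val-cong n M′ M₁ (w + F) (w + F) F (λ i q → trans (cong M′ (+-assoc w F i))
      (trans (B.Agree.low ag (w + (F + i)) (+-monoʳ-< w (tail< q))) (cong M₁ (sym (+-assoc w F i)))))) pos₁
    posf : val n (toℕ ∘ f) F F ≡ nexts N (suc j) a₀
    posf = trans (val-cong n (toℕ ∘ f) M₁ F (w + F) F (λ i q →
      trans (toℕ-decode _ (B.Scratch.slot′ sc₁ (F + i) (tail< q))) (cong M₁ (sym (+-assoc w F i))))) pos₁
    headf : ∀ i → i < F → toℕ (f i) ≡ Mh (w + i)
    headf i q = trans (toℕ-decode _ (B.Scratch.slot′ sc₁ i (≤-trans q F≤w))) (fixed₁ i q)
    result : (n ≤ B.order f L × v′ ≡ v + M′ (Z + B.code f L)) ⊎ (¬ n ≤ B.order f L × v′ ≡ v) → MemH Mh a₀ (suc j) M′ v′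
    result (inj₂ (¬full , refl)) = record
      { baseOf = baseH baseOf sc′ ; high = high′ ; fixed = fixed′ ; pos = pos′ ; v≤ = m≤n⇒m≤1+n v≤ ; sound = sound ; done = dn }
      where
      dn : ∀ c → c < suc j → Tested Mh v (nexts N (suc c) a₀)
      dn c q = up-to (λ c → Tested Mh v (nexts N (suc c) a₀)) done (f , headf , posf , λ full → contradiction full ¬full) c q
    result (inj₁ (full , refl)) = record
      { baseOf = baseH baseOf sc′ ; high = high′ ; fixed = fixed′ ; pos = pos′
      ; v≤ = ≤-trans (+-mono-≤ v≤ (subst (_≤ 1) (sym cell) (bits (B.code f L)))) (≤-reflexive (+-comm j 1))
      ; sound = λ h → sound′ (v ≟ 0) h
      ; done = dn }
      where
      cell : M′ (Z + B.code f L) ≡ Mh (Z + B.code f L)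
      cell = high′ (Z + B.code f L) (m≤m+n Z (B.code f L))
      sound′ : Dec (v ≡ 0) → v + M′ (Z + B.code f L) ≢ 0 → ∃[ f ] n ≤ B.order f L × Mh (w + w + w + B.code f L) ≢ 0
      sound′ (no v≢0)   h = sound v≢0
      sound′ (yes refl) h = f , full , λ q → h (trans cell q)
      older : ∀ {a} → Tested Mh v a → Tested Mh v′ a
      older (f′ , e , e′ , h) = f′ , e , e′ , λ full h′ q → h full h′ (m+n≡0⇒m≡0 v q)
      dn : ∀ c → c < suc j → Tested Mh v′ (nexts N (suc c) a₀)
      dn c q = up-to (λ c → Tested Mh v′ (nexts N (suc c) a₀)) (λ c r → older (done c r))
        (f , headf , posf , λ _ h q → h (trans (sym cell) (m+n≡0⇒n≡0 v q))) c q

  module Verdict {Mg Mh M : ℕ → ℕ} {a₀ v c₁ : ℕ} (mg : MemG N Mg) (bh : Base Mh) (high : ∀ a → w + w + w ≤ a → Mh a ≡ Mg a)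
    (gh : Greedy H (B.slots Mh) 1 c₁) (a₀< : a₀ < N) (mh : MemH Mh a₀ N M v) where

    private
      Z = w + w + w
      h = B.slots Mh
      1<p : 1 < p
      1<p = nonTrivial⇒n>1 p {{prime⇒nonTrivial pr}}
      module GenG = Generation G
      module GenH = Generation H

    accepts⇒≅ : v ≢ 0 → G ≅ H
    accepts⇒≅ v≢0 with MemH.sound mh v≢0
    ... | g , full′ , cell≢0 with MemG.sound mg (B.code g L) (λ q → cell≢0 (trans (high _ (m≤m+n Z _)) q))
    ... | f , full , e = Collision.collision⇒≅ G H f g L (s≤s z≤n) full full′ e

    -- If at least F entries were chosen, the ⌈k/2⌉ entries after the arbitrary first one are all
    -- new, and each multiplies the order by at least p. Otherwise fewer than F entries already
    -- generate H.
    order-h : p ^ ⌈ k /2⌉ ≤ B.order h F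
    order-h with F ≤? c₁
    ... | yes F≤c₁ = subst₂ (λ a b → p ^ a ≤ B.order h b) (+-identityʳ ⌈ k /2⌉) (+-comm ⌈ k /2⌉ 1)
        (greedy-order {k = k} H pr n≡ 0 (s≤s z≤n) gh (B.run-nonempty h 1 n) ⌈ k /2⌉ (≤-trans (≤-reflexive (+-comm ⌈ k /2⌉ 1)) F≤c₁))
    ... | no F≰c₁ = ≤-trans (^-monoʳ-≤ p {{prime⇒nonZero pr}} (⌈n/2⌉≤n k)) (≤-reflexive (trans (sym n≡)
        (sym (GenH.order-full (s≤s z≤n) (λ x → GenH.Gen-mono (<⇒≤ (≰⇒> F≰c₁)) (λ _ _ → refl) (Greedy.all gh x))))))

    -- Each of the d greedy additions multiplies the order by at least p, starting from p ^ ⌈k/2⌉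
    -- and never exceeding p ^ k. Hence d ≤ k - ⌈k/2⌉ ≤ ⌈k/2⌉, and the completion fits into the F
    -- slots of the second half.
    greedy-full : ∀ {f c} → Greedy G f F c → p ^ ⌈ k /2⌉ ≤ A.order f F → A.order f L ≡ n
    greedy-full {f} {c} gr le = GenG.order-full (s≤s z≤n) (λ x → GenG.Gen-mono c≤L (λ _ _ → refl) (Greedy.all gr x))
      where
      d = c ∸ F
      d+F≡c : d + F ≡ c
      d+F≡c = m∸n+n≡m (Greedy.c₀≤c₁ gr)
      d≤ : d + ⌈ k /2⌉ ≤ k
      d≤ = ≮⇒≥ λ k< → <⇒≱ (^-monoʳ-< p 1<p k<) (≤-trans
        (greedy-order {k = k} G pr n≡ ⌈ k /2⌉ (s≤s z≤n) gr le d (≤-reflexive d+F≡c))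
        (≤-trans (unique≤ (A.run-unique f (d + F) n)) (≤-reflexive n≡)))
      k≤ : k ≤ ⌈ k /2⌉ + ⌈ k /2⌉
      k≤ = ≤-trans (≤-reflexive (sym (⌊n/2⌋+⌈n/2⌉≡n k))) (+-monoˡ-≤ ⌈ k /2⌉ (⌊n/2⌋≤⌈n/2⌉ k))
      d≤half : d ≤ ⌈ k /2⌉
      d≤half = +-cancelʳ-≤ ⌈ k /2⌉ d ⌈ k /2⌉ (≤-trans d≤ k≤)
      c≤L : c ≤ L
      c≤L = ≤-trans (≤-reflexive (sym d+F≡c)) (+-monoˡ-≤ F (m≤n⇒m≤1+n d≤half))

    ≅⇒accepts : G ≅ H → v ≢ 0
    ≅⇒accepts (φ , iso) = accepted
      where
      open GroupMorphisms (GroupTable.rawGroup G) (GroupTable.rawGroup H) using (IsGroupIsomorphism)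
      open IsGroupIsomorphism iso using (injective; surjective; ∙-homo)
      open Collision.Image G H φ injective ∙-homo
      ψ : Fin n → Fin n
      ψ y = proj₁ (surjective y)
      φψ : ∀ y → φ (ψ y) ≡ y
      φψ y = proj₂ (surjective y) refl
      digits< : ∀ (g : ℕ → Fin n) o i → i < F → toℕ (g (o + i)) < n
      digits< g o i _ = toℕ<n (g (o + i))
      -- The round of the first phase in which the counter shows the preimage of the greedy half of
      -- H.
      c-first = nexts-covers {N} {0} (≤-trans (s≤s z≤n) a₀<) (val< n (toℕ ∘ ψ ∘ h) 0 F (digits< (ψ ∘ h) 0))
      found = MemG.done mg (proj₁ c-first) (proj₁ (proj₂ c-first))
      f = proj₁ found
      f≡ : ∀ i → i < F → f i ≡ ψ (h i)
      f≡ i q = toℕ-injective (val-injective n (toℕ ∘ f) (toℕ ∘ ψ ∘ h) 0 0 F (digits< f 0) (digits< (ψ ∘ h) 0)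
        (trans (proj₁ (proj₂ found)) (proj₂ (proj₂ c-first))) i q)
      φf≡ : ∀ i → i < F → φ (f i) ≡ h i
      φf≡ i q = trans (cong φ (f≡ i q)) (φψ (h i))
      order-f : A.order f F ≡ B.order h F
      order-f = trans (sym (order-image f F)) (cong (length ∘ proj₁) (B.run-cong F n (φf≡ 0 (s≤s z≤n)) φf≡))
      full : A.order f L ≡ n
      full = greedy-full (proj₂ (proj₁ (proj₂ (proj₂ found)))) (≤-trans order-h (≤-reflexive (sym order-f)))
      marked : Mg (Z + A.code f L) ≢ 0
      marked = proj₂ (proj₂ (proj₂ found)) (≤-reflexive (sym full))
      -- The round of the second phase in which the counter shows the image of the second half just
      -- found in G; its tuple is then the image of `f` on all L slots.
      c-second = nexts-covers {N} {a₀} a₀< (val< n (toℕ ∘ φ ∘ f) F F (digits< (φ ∘ f) F))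
      found′ = MemH.done mh (proj₁ c-second) (proj₁ (proj₂ c-second))
      g = proj₁ found′
      tail≡ : ∀ i → i < F → g (F + i) ≡ φ (f (F + i))
      tail≡ i q = toℕ-injective (val-injective n (toℕ ∘ g) (toℕ ∘ φ ∘ f) F F F (digits< g F) (digits< (φ ∘ f) F)
        (trans (proj₁ (proj₂ (proj₂ found′))) (proj₂ (proj₂ c-second))) i q)
      head≡ : ∀ i → i < F → g i ≡ φ (f i)
      head≡ i q = trans (toℕ-injective (trans (proj₁ (proj₂ found′) i q)
        (sym (toℕ-decode _ (slotB bh i (≤-trans q (≤-trans (m≤m+n F F) FF≤w))))))) (sym (φf≡ i q))
      g≡ : ∀ i → i < L → g i ≡ φ (f i)
      g≡ i q = split (i <? F)
        where
        split : Dec (i < F) → g i ≡ φ (f i)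
        split (yes r) = head≡ i r
        split (no ¬r) = subst (λ a → g a ≡ φ (f a)) (m+[n∸m]≡n (≮⇒≥ ¬r))
          (tail≡ (i ∸ F) (+-cancelˡ-< F _ _ (subst (_< L) (sym (m+[n∸m]≡n (≮⇒≥ ¬r))) q)))
      same-run : B.run g L n ≡ B.run (φ ∘ f) L n
      same-run = B.run-cong L n (g≡ 0 (s≤s z≤n)) g≡
      code≡ : B.code g L ≡ A.code f L
      code≡ = trans (cong proj₂ same-run) (code-image f L)
      order≡ : B.order g L ≡ n
      order≡ = trans (cong (length ∘ proj₁) same-run) (trans (order-image f L) full)
      accepted : v ≢ 0
      accepted = proj₂ (proj₂ (proj₂ found′)) (≤-reflexive (sym order≡))
        (λ q → marked (trans (sym (trans (high _ (m≤m+n Z _)) (cong (λ c → Mg (Z + c)) code≡))) q))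

-- The input in memory

fromList-++ʳ : ∀ xs ys a → fromList (xs ++ ys) (length xs + a) ≡ fromList ys a
fromList-++ʳ []       ys a = refl
fromList-++ʳ (x ∷ xs) ys a = fromList-++ʳ xs ys a

fromList-past : ∀ xs a → length xs ≤ a → fromList xs a ≡ 0
fromList-past []       a       p       = refl
fromList-past (x ∷ xs) (suc a) (s≤s p) = fromList-past xs a p

fromList-≤ : ∀ {m} xs a → All (_≤ m) xs → fromList xs a ≤ m
fromList-≤ []       a       []       = z≤n
fromList-≤ (x ∷ xs) zero    (p ∷ ps) = p
fromList-≤ (x ∷ xs) (suc a) (p ∷ ps) = fromList-≤ xs a ps

module _ {A B : Set} (f : A → B → ℕ) where

  fromList-row : ∀ {m} x (h : Fin m → B) zs j → fromList (map (f x) (List.tabulate h) ++ zs) (toℕ j) ≡ f x (h j)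
  fromList-row x h zs zero    = refl
  fromList-row x h zs (suc j) = fromList-row x (h ∘ suc) zs j

  fromList-product : ∀ {m n} (g : Fin m → A) (h : Fin n → B) zs i j →
    fromList (cartesianProductWith f (List.tabulate g) (List.tabulate h) ++ zs) (toℕ i * n + toℕ j) ≡ f (g i) (h j)
  fromList-product {suc m} {n} g h zs zero j =
    trans (cong (λ xs → fromList xs (toℕ j)) (++-assoc (map (f (g zero)) (List.tabulate h)) _ zs)) (fromList-row (g zero) h _ j)
  fromList-product {suc m} {n} g h zs (suc i) j = trans
    (cong₂ fromList (++-assoc (map (f (g zero)) (List.tabulate h)) _ zs) (trans (+-assoc n (toℕ i * n) (toℕ j))
      (cong (λ z → z + (toℕ i * n + toℕ j)) (sym (trans (length-map (f (g zero)) (List.tabulate h)) (length-tabulate h))))))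
    (trans (fromList-++ʳ (map (f (g zero)) (List.tabulate h)) _ (toℕ i * n + toℕ j)) (fromList-product (g ∘ suc) h zs i j))

  length-product : ∀ xs ys → length (cartesianProductWith f xs ys) ≡ length xs * length ys
  length-product []       ys = refl
  length-product (x ∷ xs) ys = trans (length-++ (map (f x) ys)) (cong₂ _+_ (length-map (f x) ys) (length-product xs ys))

  product-≤ : ∀ {m} xs ys → (∀ x y → f x y ≤ m) → All (_≤ m) (cartesianProductWith f xs ys)
  product-≤ []       ys h = []
  product-≤ (x ∷ xs) ys h = ++⁺ (map⁺ (All.universal (h x) ys)) (product-≤ xs ys h)

module Tables {n : ℕ} (G H : GroupTable n) where

  memory : ℕ → ℕ
  memory = fromList (n ∷ table G ++ table H)

  length-table : ∀ (K : GroupTable n) → length (table K) ≡ n * n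
  length-table K = trans (length-product (λ i j → suc (toℕ (GroupTable._∙_ K i j))) (allFin n) (allFin n))
    (cong (λ l → l * l) (length-tabulate {n = n} id))

  memory-G : ∀ x y → memory (1 + toℕ x * n + toℕ y) ≡ suc (toℕ (GroupTable._∙_ G x y))
  memory-G x y = fromList-product (λ i j → suc (toℕ (GroupTable._∙_ G i j))) id id (table H) x y

  memory-H : ∀ x y → memory (1 + n * n + toℕ x * n + toℕ y) ≡ suc (toℕ (GroupTable._∙_ H x y))
  memory-H x y = trans (cong (fromList (table G ++ table H)) (trans (+-assoc (n * n) (toℕ x * n) (toℕ y))
      (cong (λ z → z + (toℕ x * n + toℕ y)) (sym (length-table G)))))
    (trans (fromList-++ʳ (table G) (table H) _) (trans (cong (λ xs → fromList xs (toℕ x * n + toℕ y)) (sym (++-identityʳ (table H))))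
      (fromList-product (λ i j → suc (toℕ (GroupTable._∙_ H i j))) id id [] x y)))

  memory-past : ∀ a → 1 + n * n + n * n ≤ a → memory a ≡ 0
  memory-past a p = fromList-past (n ∷ table G ++ table H) a (≤-trans (≤-reflexive
    (cong suc (trans (length-++ (table G)) (cong₂ _+_ (length-table G) (length-table H))))) p)

  memory-≤ : ∀ a → memory a ≤ n
  memory-≤ a = fromList-≤ (n ∷ table G ++ table H) a (≤-refl ∷ ++⁺ (entries G) (entries H))
    where
    entries : ∀ (K : GroupTable n) → All (_≤ n) (table K)
    entries K = product-≤ (λ i j → suc (toℕ (GroupTable._∙_ K i j))) (allFin n) (allFin n) (λ i j → toℕ<n (GroupTable._∙_ K i j))

-- This is 2 n² + 6 n + 4 in the form in which the program computes it, with a single product. It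
-- exceeds the input length 1 + 2 n² and also 2 n, which leaves room for L slots and for F + n slots
-- during the greedy extension; for n ≥ 2 it is at most n ^ 5.
width : ℕ → ℕ
width n = let v = (n + 1 + 1) + (n + 1 + 1) in v + n * v

-- The assembled program, its parameters and its degrees

sizes : Stmt
sizes = op (set1 #one) ⨾ op (add #v #n #one) ⨾ op (add #v #v #one) ⨾ op (add #v #v #v)

setWidth : Stmt
setWidth = sizes ⨾ addmul #W #v #v #n #n

tupleLength : Stmt
tupleLength = op (add #F #F #one) ⨾ op (add #L #F #F) ⨾ op (set1 #N) ⨾ op (set0 #y)

powerBody : Stmt
powerBody = addmul #v #y #N #n #n ⨾ op (move #N #v)

power : Stmt
power = loop #c1 #F #W powerBody

bases : Stmt
bases = op (add #X #W #W) ⨾ op (add #Z #X #W) ⨾ op (set1 #T) ⨾ op (move #O #W)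

parameters : Stmt
parameters = halfLog ⨾ tupleLength ⨾ power ⨾ bases ⨾ reset

setup : Stmt
setup = op (load #n #n) ⨾ setWidth ⨾ parameters

hBase : Stmt
hBase = addmul #v #T #n #n #n ⨾ op (move #T #v) ⨾ op (add #O #W #F) ⨾ op (set1 #cur)

hSetup : Stmt
hSetup = hBase ⨾ greedy ⨾ reset

gPhase hPhase main : Stmt
gPhase = loop #c0 #N #N gTry
hPhase = loop #c0 #N #N hTry
main   = setup ⨾ gPhase ⨾ hSetup ⨾ hPhase

power-spec : ∀ σ {n F} → reg σ #n ≡ n → reg σ #F ≡ F → F ≤ reg σ #W → reg σ #N ≡ 1 → reg σ #y ≡ 0 → reg (⟦ power ⟧ σ) #N ≡ n ^ F
power-spec σ {n} {F} en eF F≤W eN ey = loop-rule #c1 #F #W powerBody σ (λ f τ → reg τ #N ≡ n ^ f) F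
  (trans (trips #c1 #F #W σ refl (≤-trans (≤-reflexive eF) F≤W)) eF) eN
  (λ f k σ′ _ _ fr h → step f (tick #c1 k σ′) (trans (fr #n refl) en) (trans (fr #y refl) ey) h)
  where
  step : ∀ f τ → reg τ #n ≡ n → reg τ #y ≡ 0 → reg τ #N ≡ n ^ f → reg (⟦ powerBody ⟧ τ) #N ≡ n ^ suc f
  step f τ en ey h = trans (addmul-spec #v #y #N #n #n τ refl refl refl refl refl refl refl refl ≤-refl) (cong₂ _+_ ey (cong₂ _*_ en h))

setWidth-spec : ∀ σ {n} → reg σ #n ≡ n → reg (⟦ setWidth ⟧ σ) #W ≡ width n × reg (⟦ setWidth ⟧ σ) #one ≡ 1
setWidth-spec σ {n} en = seq setWidth sizes (addmul #W #v #v #n #n) refl (λ τ → reg τ #W ≡ width n × reg τ #one ≡ 1) σ λ σ′ fr m e →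
  trans (addmul-spec #W #v #v #n #n σ′ refl refl refl refl refl refl refl refl ≤-refl)
    (cong₂ (λ v n → v + n * v) (trans (cong (λ τ → reg τ #v) e) (cong (λ n → (n + 1 + 1) + (n + 1 + 1)) en)) (trans (fr #n refl) en)) ,
  trans (keep (addmul #W #v #v #n #n) #one σ′ refl) (cong (λ τ → reg τ #one) e)

Ready : (n w F b o : ℕ) → Store → Set
Ready n w F b o σ = Const n w F b o σ × Clear σ

parameters-spec : ∀ σ {n p k} → Prime p → n ≡ p ^ k → reg σ #one ≡ 1 → reg σ #n ≡ n → reg σ #W ≡ width n → suc ⌈ k /2⌉ ≤ width n →
  Ready n (width n) (suc ⌈ k /2⌉) 1 (width n) (⟦ parameters ⟧ σ)
parameters-spec σ {n} {p} {k} pr n≡ e1 en eW F≤w =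
  seq parameters halfLog (tupleLength ⨾ power ⨾ bases ⨾ reset) refl Q σ λ σ₁ fr₁ m₁ q₁ →
  seq (tupleLength ⨾ power ⨾ bases ⨾ reset) tupleLength (power ⨾ bases ⨾ reset) refl Q σ₁ λ σ₂ fr₂ m₂ q₂ →
  stage₂ σ₂ (trans (fr₂ #one refl) (trans (fr₁ #one refl) e1)) (trans (fr₂ #n refl) (trans (fr₁ #n refl) en))
    (trans (fr₂ #W refl) (trans (fr₁ #W refl) eW))
    (trans (cong (λ τ → reg τ #F) q₂) (F≡ σ₁ q₁ (trans (fr₁ #one refl) e1)))
    (trans (cong (λ τ → reg τ #L) q₂) (cong₂ _+_ (F≡ σ₁ q₁ (trans (fr₁ #one refl) e1)) (F≡ σ₁ q₁ (trans (fr₁ #one refl) e1))))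
    (cong (λ τ → reg τ #N) q₂) (cong (λ τ → reg τ #y) q₂)
  where
  F = suc ⌈ k /2⌉
  w = width n
  Q : Store → Set
  Q = Ready n w F 1 w
  F≡ : ∀ σ₁ → σ₁ ≡ ⟦ halfLog ⟧ σ → reg σ₁ #one ≡ 1 → reg σ₁ #F + reg σ₁ #one ≡ F
  F≡ σ₁ q e = trans (cong₂ _+_ (trans (cong (λ τ → reg τ #F) q) (halfLog-spec σ pr n≡ e1 en)) e) (+-comm ⌈ k /2⌉ 1)
  stage₄ : ∀ σ → Const n w F 1 w σ → Q (⟦ reset ⟧ σ)
  stage₄ σ c = const-frame reset σ (⟦ reset ⟧ σ) refl (λ e → keep reset e σ) c , reset-spec σ
  stage₃ : ∀ σ → reg σ #one ≡ 1 → reg σ #n ≡ n → reg σ #W ≡ w → reg σ #F ≡ F → reg σ #L ≡ F + F → reg σ #N ≡ n ^ F → Q (⟦ bases ⨾ reset ⟧ σ)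
  stage₃ σ e1 en eW eF eL eN = seq (bases ⨾ reset) bases reset refl Q σ λ σ′ fr m q →
    stage₄ σ′ (record { kn = trans (fr #n refl) en ; k1 = trans (fr #one refl) e1 ; kW = trans (fr #W refl) eW ; kF = trans (fr #F refl) eF
      ; kL = trans (fr #L refl) eL ; kN = trans (fr #N refl) eN ; kT = cong (λ τ → reg τ #T) q
      ; kX = trans (cong (λ τ → reg τ #X) q) (cong₂ _+_ eW eW)
      ; kZ = trans (cong (λ τ → reg τ #Z) q) (cong₂ _+_ (cong₂ _+_ eW eW) eW)
      ; kO = trans (cong (λ τ → reg τ #O) q) eW })
  stage₂ : ∀ σ → reg σ #one ≡ 1 → reg σ #n ≡ n → reg σ #W ≡ w → reg σ #F ≡ F → reg σ #L ≡ F + F → reg σ #N ≡ 1 → reg σ #y ≡ 0 →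
    Q (⟦ power ⨾ bases ⨾ reset ⟧ σ)
  stage₂ σ e1 en eW eF eL eN ey = seq (power ⨾ bases ⨾ reset) power (bases ⨾ reset) refl Q σ λ σ′ fr m q →
    stage₃ σ′ (trans (fr #one refl) e1) (trans (fr #n refl) en) (trans (fr #W refl) eW) (trans (fr #F refl) eF) (trans (fr #L refl) eL)
      (trans (cong (λ τ → reg τ #N) q) (power-spec σ en eF (≤-trans F≤w (≤-reflexive (sym eW))) eN ey))

setup-spec : ∀ σ {n p k} → Prime p → n ≡ p ^ k → reg σ #n ≡ 0 → mem σ 0 ≡ n → suc ⌈ k /2⌉ ≤ width n →
  Ready n (width n) (suc ⌈ k /2⌉) 1 (width n) (⟦ setup ⟧ σ)
setup-spec σ {n} {k = k} pr n≡ e0 em F≤w =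
  seq setup (op (load #n #n)) (setWidth ⨾ parameters) refl Q σ λ σ₁ fr₁ m₁ q₁ →
  seq (setWidth ⨾ parameters) setWidth parameters refl Q σ₁ λ σ₂ fr₂ m₂ q₂ →
  let en = trans (cong (λ τ → reg τ #n) q₁) (trans (cong (mem σ) e0) em)
      sw = subst (λ τ → reg τ #W ≡ width n × reg τ #one ≡ 1) (sym q₂) (setWidth-spec σ₁ en)
  in parameters-spec σ₂ pr n≡ (proj₂ sw) (trans (fr₂ #n refl) en) (proj₁ sw) F≤w
  where
  Q : Store → Set
  Q = Ready n (width n) (suc ⌈ k /2⌉) 1 (width n)

const-tick : ∀ {n w F b o} k σ → Const n w F b o σ → Const n w F b o (tick #c0 k σ)
const-tick k σ c = record { kn = kn c ; k1 = k1 c ; kW = kW c ; kF = kF c ; kL = kL c ; kN = kN c ; kT = kT c ; kX = kX c ; kZ = kZ c ; kO = kO c }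

seq-time : ∀ {ℓ} u s t → u ≡ s ⨾ t → (Q : Store → ℕ → Set ℓ) → ∀ σ →
  (∀ σ′ → Frame s σ σ′ → (stores s ≡ false → mem σ′ ≡ mem σ) → σ′ ≡ ⟦ s ⟧ σ → Q (⟦ t ⟧ σ′) (time s σ + time t σ′)) → Q (⟦ u ⟧ σ) (time u σ)
seq-time u s t refl Q σ h = h (⟦ s ⟧ σ) (λ e → keep s e σ) (keepMem s σ) refl

==-true : ∀ d e → (d == e) ≡ true → d ≡ e
==-true d e p with d Fin.≟ e
... | yes q = q

∨-true : ∀ {a b} → a ∨ b ≡ true → a ≡ true ⊎ b ≡ true
∨-true {true}  p = inj₁ refl
∨-true {false} p = inj₂ p

-- Two stages are distinguished because `setWidth` itself assigns `#one` and `#W`: its own loop can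
-- be capped by `#n` only, and everything after it by all three.
capN capNW : Reg → Bool
capN d  = #n == d
capNW d = #n == d ∨ (#one == d ∨ #W == d)

caps-N : ∀ {V} σ → reg σ #n ≤ V → Caps capN V σ
caps-N σ h e p with ==-true #n e p
... | refl = h

caps-NW : ∀ {V} σ → reg σ #n ≤ V → reg σ #one ≤ V → reg σ #W ≤ V → Caps capNW V σ
caps-NW σ h h′ h″ e p with ∨-true {#n == e} p
... | inj₁ q with ==-true #n e q
... | refl = h
caps-NW σ h h′ h″ e p | inj₂ q with ∨-true {#one == e} q
... | inj₁ r with ==-true #one e r
... | refl = h′
caps-NW σ h h′ h″ e p | inj₂ q | inj₂ r with ==-true #W e r
... | refl = h″

-- Numbers start with about V ^ 2 bits and gain at most one per step, so each of the V ^ E steps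
-- costs on the order of V ^ E + V ^ 2. The 5 absorbs the constants and the V ^ 2.
steps-time : ∀ {V} → 2 ≤ V → ∀ s σ b E → wf s ≡ true → Bounded b σ → b ≤ V ^ 2 → steps s σ ≤ V ^ E → time s σ ≤ V ^ (E + (5 + E))
steps-time {V} 2≤V s σ b E wfs bd b≤ st≤ = begin
  time s σ                                  ≤⟨ time≤ s σ b (steps s σ + b) wfs bd ≤-refl ⟩
  steps s σ * (2 * suc (steps s σ + b))     ≤⟨ *-mono-≤ st≤ (*-mono-≤ 2≤V (s≤s (+-mono-≤ st≤ b≤))) ⟩
  V ^ E * (V * (V ^ 0 + (V ^ E + V ^ 2)))   ≤⟨ *-monoʳ-≤ (V ^ E) (*-monoʳ-≤ V (≤-trans (+-monoʳ-≤ 1 (pow-sum 2≤V E 2)) (pow-sum 2≤V 0 (suc (E + 2))))) ⟩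
  V ^ E * (V * V ^ suc (suc (E + 2)))       ≡⟨ ^-distribˡ-+-* V E (3 + (E + 2)) ⟨
  V ^ (E + (3 + (E + 2)))                   ≡⟨ cong (λ e → V ^ (E + (3 + e))) (+-comm E 2) ⟩
  V ^ (E + (5 + E))                         ∎
  where open ≤-Reasoning

val-zero : ∀ n M o f → (∀ i → i < f → M (o + i) ≡ 0) → val n M o f ≡ 0
val-zero n M o zero    h = refl
val-zero n M o (suc f) h = trans (cong₂ (λ a b → a + n ^ f * b) (val-zero n M o f (λ i p → h i (m<n⇒m<1+n p))) (h f (n<1+n f))) (*-zeroʳ (n ^ f))

width-tables : ∀ n → width n ≡ (1 + n * n + n * n) + (6 * n + 3)
width-tables = identity
  where
  identity : ∀ n → (n + 1 + 1) + (n + 1 + 1) + n * ((n + 1 + 1) + (n + 1 + 1)) ≡ (1 + n * n + n * n) + (6 * n + 3)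
  identity = solve-∀

width-double : ∀ n → width n ≡ (n + n) + (2 * (n * n) + 4 * n + 4)
width-double = identity
  where
  identity : ∀ n → (n + 1 + 1) + (n + 1 + 1) + n * ((n + 1 + 1) + (n + 1 + 1)) ≡ (n + n) + (2 * (n * n) + 4 * n + 4)
  identity = solve-∀

width-power : ∀ {n} → 2 ≤ n → width n ≤ n ^ 5
width-power {n} 2≤n = begin
  width n                                        ≡⟨ identity n ⟩
  2 * (n * n) + 3 * (2 * n) + 2 * 2              ≤⟨ +-mono-≤ (+-monoʳ-≤ (2 * (n * n)) (*-monoʳ-≤ 3 (*-monoˡ-≤ n 2≤n))) (*-mono-≤ 2≤n 2≤n) ⟩
  2 * (n * n) + 3 * (n * n) + n * n              ≤⟨ ≤-trans (≤-reflexive (identity₂ (n * n))) (*-monoˡ-≤ (n * n) {6} {8} (m≤m+n 6 2)) ⟩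
  2 * (2 * 2) * (n * n)                          ≤⟨ *-monoˡ-≤ (n * n) (*-mono-≤ 2≤n (*-mono-≤ 2≤n 2≤n)) ⟩
  n * (n * n) * (n * n)                          ≡⟨ identity₃ n ⟩
  n ^ 5                                          ∎
  where
  open ≤-Reasoning
  identity : ∀ n → (n + 1 + 1) + (n + 1 + 1) + n * ((n + 1 + 1) + (n + 1 + 1)) ≡ 2 * (n * n) + 3 * (2 * n) + 2 * 2
  identity = solve-∀
  identity₂ : ∀ m → 2 * m + 3 * m + m ≡ 6 * m
  identity₂ = solve-∀
  identity₃ : ∀ n → n * (n * n) * (n * n) ≡ n * (n * (n * (n * (n * 1))))
  identity₃ = solve-∀

zones : ∀ {w m} {M : ℕ → ℕ} → (∀ a → a < w → M a ≤ m) → (∀ j → j < w → M (w + j) ≤ m) → (∀ j → j < w → M (w + w + j) ≤ m) →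
  (∀ j → M (w + w + w + j) ≤ m) → ∀ a → M a ≤ m
zones {w} {m} {M} h₀ h₁ h₂ h₃ a with a <? w
... | yes p = h₀ a p
... | no p₁ with a <? w + w
... | yes p = subst (λ a → M a ≤ m) (m+[n∸m]≡n (≮⇒≥ p₁)) (h₁ (a ∸ w) (+-cancelˡ-< w _ _ (subst (_< w + w) (sym (m+[n∸m]≡n (≮⇒≥ p₁))) p)))
... | no p₂ with a <? w + w + w
... | yes p = subst (λ a → M a ≤ m) (m+[n∸m]≡n (≮⇒≥ p₂)) (h₂ (a ∸ (w + w)) (+-cancelˡ-< (w + w) _ _ (subst (_< w + w + w) (sym (m+[n∸m]≡n (≮⇒≥ p₂))) p)))
... | no p₃ = subst (λ a → M a ≤ m) (m+[n∸m]≡n (≮⇒≥ p₃)) (h₃ (a ∸ (w + w + w)))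

-- A chunk is one run from numbers at most `2 ^ (2 + w)`, with the exponent of `steps-time`. The 12
-- absorbs the loop overhead per round, which is polynomial in w by `loop-cost`.
chunkDegree loopDegree : Stmt → ℕ
chunkDegree s = degree s + (5 + degree s)
loopDegree s  = 12 + chunkDegree s

setupDegree hDegree gDegree mainDegree : ℕ
setupDegree = suc (0 + suc (degree setWidth + degree parameters))
hDegree     = suc (chunkDegree hSetup + loopDegree hTry)
gDegree     = suc (loopDegree gTry + hDegree)
mainDegree  = suc ((setupDegree + (5 + setupDegree)) + gDegree)

hBase-spec : ∀ σ {n w F o} → Const n w F 1 o σ →
  Const n w F (1 + n * n) (w + F) (⟦ hBase ⟧ σ) × reg (⟦ hBase ⟧ σ) #cur ≡ 1
hBase-spec σ {n} {w} {F} c =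
  seq hBase (addmul #v #T #n #n #n) hMove refl (λ τ → Const n w F (1 + n * n) (w + F) τ × reg τ #cur ≡ 1) σ λ σ′ fr m q →
  record { kn = trans (fr #n refl) (kn c) ; k1 = trans (fr #one refl) (k1 c) ; kW = trans (fr #W refl) (kW c)
         ; kF = trans (fr #F refl) (kF c) ; kL = trans (fr #L refl) (kL c) ; kN = trans (fr #N refl) (kN c)
         ; kX = trans (fr #X refl) (kX c) ; kZ = trans (fr #Z refl) (kZ c)
         ; kT = trans (cong (λ τ → reg τ #v) q) (trans (addmul-spec #v #T #n #n #n σ refl refl refl refl refl refl refl refl ≤-refl)
             (cong₂ _+_ (kT c) (cong₂ _*_ (kn c) (kn c))))
         ; kO = cong₂ _+_ (trans (fr #W refl) (kW c)) (trans (fr #F refl) (kF c)) } ,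
  refl
  where
  hMove = op (move #T #v) ⨾ op (add #O #W #F) ⨾ op (set1 #cur)

-- Correctness and cost of the whole run

module Machine {n p k : ℕ} (G H : GroupTable n) (pr : Prime p) (n≡ : n ≡ p ^ k) where
  open Tables G H

  w : ℕ
  w = width n

  private
    tables≤w : 1 + n * n + n * n ≤ w
    tables≤w = ≤-trans (m≤m+n _ _) (≤-reflexive (sym (width-tables n)))
    2n≤w : n + n ≤ w
    2n≤w = ≤-trans (m≤m+n _ _) (≤-reflexive (sym (width-double n)))

  open Phases {n} {p} {k} G H pr n≡ memory w tables≤w 2n≤w memory-G memory-H public

  private
    n≤w = ≤-trans (m≤m+n n n) 2n≤w
    F≤w = ≤-trans F≤n n≤w
    0<n : 0 < n
    0<n = ≤-trans (s≤s z≤n) F≤n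
    2≤w : 2 ≤ w
    2≤w = ≤-trans (+-mono-≤ 0<n 0<n) 2n≤w
    1≤w = ≤-trans (s≤s z≤n) 2≤w
    Z = w + w + w
    instance
      n≢0 : NonZero n
      n≢0 = >-nonZero 0<n
      w≢0 : NonZero w
      w≢0 = >-nonZero 1≤w

  0<N : 0 < N
  0<N = m^n>0 n F

  private
    -- From n ≤ 2 ^ n, F ≤ n and n * n ≤ w: the round counters have at most about w bits, although
    -- they count to n ^ F.
    N≤ : N ≤ 2 ^ (2 + w)
    N≤ = begin
      n ^ F          ≤⟨ ^-monoˡ-≤ F (<⇒≤ (m<n^m n ≤-refl)) ⟩
      (2 ^ n) ^ F    ≡⟨ ^-*-assoc 2 n F ⟩
      2 ^ (n * F)    ≤⟨ ^-monoʳ-≤ 2 (≤-trans (*-monoʳ-≤ n F≤n) (≤-trans (≤-trans (m≤n+m (n * n) 1) (m≤m+n (1 + n * n) (n * n))) (≤-trans tables≤w (m≤n+m w 2)))) ⟩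
      2 ^ (2 + w)    ∎
      where open ≤-Reasoning

    3w≤ : Z ≤ 2 ^ (2 + w)
    3w≤ = begin
      w + w + w                   ≤⟨ m≤m+n (w + w + w) w ⟩
      w + w + w + w               ≡⟨ four w ⟩
      2 * (2 * w)                 ≤⟨ *-monoʳ-≤ 2 (*-monoʳ-≤ 2 (<⇒≤ (m<n^m w ≤-refl))) ⟩
      2 ^ (2 + w)                 ∎
      where
      open ≤-Reasoning
      four : ∀ w → w + w + w + w ≡ 2 * (2 * w)
      four = solve-∀

    w≤ : w ≤ 2 ^ (2 + w)
    w≤ = ≤-trans (≤-trans (m≤m+n w w) (m≤m+n (w + w) w)) 3w≤
    2w≤ : w + w ≤ 2 ^ (2 + w)
    2w≤ = ≤-trans (m≤m+n (w + w) w) 3w≤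

  base-≤ : ∀ {M} → Base M → (∀ a → M (Z + a) ≤ 1) → ∀ a → M a ≤ 2 ^ (2 + w)
  base-≤ b bit = zones (λ a p → ≤-trans (≤-reflexive (lowB b a p)) (≤-trans (memory-≤ a) n≤))
    (λ j p → ≤-trans (<⇒≤ (slotB b j p)) n≤) (λ j p → ≤-trans (<⇒≤ (auxB b j p)) n≤) (λ a → ≤-trans (bit a) (m^n>0 2 (2 + w)))
    where n≤ = ≤-trans n≤w w≤

  -- This bound holds again before every round: the parameters, up to `Z = 3 w` and `N`, are at most
  -- `2 ^ (2 + w)`, and the scratch registers have been cleared. `dec` may be 1, so that the lemma
  -- also covers the store right after `tick`.
  state-bounded : ∀ {b o} σ → b ≤ w → o ≤ w + w → Const n w F b o σ → reg σ dec ≤ 1 → (∀ e → reg σ (13 ↑ʳ e) ≡ 0) →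
    reg σ #ans ≤ N → reg σ #c0 ≤ N → (∀ a → mem σ a ≤ 2 ^ (2 + w)) → Bounded (2 + w) σ
  state-bounded σ b≤ o≤ c hd hz ha h0 hm = bounded go hm
    where
    le : ∀ {x y z} → x ≡ y → y ≤ z → z ≤ 2 ^ (2 + w) → x ≤ 2 ^ (2 + w)
    le refl p q = ≤-trans p q
    go : ∀ d → reg σ d ≤ 2 ^ (2 + w)
    go zero                                                                = ≤-trans hd (m^n>0 2 (2 + w))
    go (suc zero)                                                          = le (kn c) n≤w w≤
    go (suc (suc zero))                                                    = le (k1 c) 1≤w w≤
    go (suc (suc (suc zero)))                                              = le (kW c) ≤-refl w≤
    go (suc (suc (suc (suc zero))))                                        = le (kF c) F≤w w≤
    go (suc (suc (suc (suc (suc zero)))))                                  = le (kL c) (+-mono-≤ F≤w F≤w) 2w≤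
    go (suc (suc (suc (suc (suc (suc zero))))))                            = le (kN c) ≤-refl N≤
    go (suc (suc (suc (suc (suc (suc (suc zero)))))))                      = le (kT c) b≤ w≤
    go (suc (suc (suc (suc (suc (suc (suc (suc zero))))))))                = le (kX c) ≤-refl 2w≤
    go (suc (suc (suc (suc (suc (suc (suc (suc (suc zero)))))))))          = le (kZ c) ≤-refl 3w≤
    go (suc (suc (suc (suc (suc (suc (suc (suc (suc (suc zero))))))))))    = le (kO c) o≤ 2w≤
    go (suc (suc (suc (suc (suc (suc (suc (suc (suc (suc (suc zero))))))))))) = ≤-trans ha N≤
    go (suc (suc (suc (suc (suc (suc (suc (suc (suc (suc (suc (suc zero)))))))))))) = ≤-trans h0 N≤
    go (suc (suc (suc (suc (suc (suc (suc (suc (suc (suc (suc (suc (suc e))))))))))))) = ≤-trans (≤-reflexive (hz e)) z≤n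

  const-caps : ∀ {b o} σ → Const n w F b o σ → Caps capNW w σ
  const-caps σ c = caps-NW σ (≤-trans (≤-reflexive (kn c)) n≤w) (≤-trans (≤-reflexive (k1 c)) 1≤w) (≤-reflexive (kW c))

  2+w≤ : 2 + w ≤ w ^ 2
  2+w≤ = ≤-trans (+-monoˡ-≤ w 2≤w) (≤-trans (≤-reflexive (cong (λ z → w + z) (sym (+-identityʳ w)))) (≤-trans (*-monoˡ-≤ w 2≤w) (≤-reflexive (cong (w *_) (sym (*-identityʳ w))))))

  chunk : ∀ {b o} s σ → wf s ≡ true → capped capNW s ≡ true → Const n w F b o σ → Bounded (2 + w) σ → time s σ ≤ w ^ chunkDegree s
  chunk s σ wfs cs c bd = steps-time 2≤w s σ (2 + w) (degree s) wfs bd 2+w≤ (steps≤ capNW 2≤w s σ cs (const-caps σ c))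

  loop-cost : ∀ x → suc N * (4 * (2 + (2 + w)) + w ^ x) + (2 + (2 + w)) ≤ N * w ^ (12 + x)
  loop-cost x = begin
    suc N * (4 * (4 + w) + w ^ x) + (4 + w)     ≤⟨ +-mono-≤ (*-mono-≤ (≤-trans (+-monoˡ-≤ N 0<N) (≤-reflexive (cong (λ z → N + z) (sym (+-identityʳ N)))))
                                                     (+-monoˡ-≤ (w ^ x) (*-mono-≤ 4≤ 4+w≤))) 4+w≤ ⟩
    2 * N * (w ^ 2 * w ^ 3 + w ^ x) + w ^ 3     ≡⟨ cong (λ z → 2 * N * (z + w ^ x) + w ^ 3) (^-distribˡ-+-* w 2 3) ⟨
    2 * N * (w ^ 5 + w ^ x) + w ^ 3             ≤⟨ +-mono-≤ (*-mono-≤ (*-monoˡ-≤ N 2≤w) (pow-sum 2≤w 5 x)) (m≤n*m (w ^ 3) N {{>-nonZero 0<N}}) ⟩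
    w * N * w ^ (6 + x) + N * w ^ 3             ≡⟨ identity w N (w ^ (6 + x)) (w ^ 3) ⟩
    N * (w ^ (7 + x) + w ^ 3)                   ≤⟨ *-monoʳ-≤ N (pow-sum 2≤w (7 + x) 3) ⟩
    N * w ^ suc (7 + x + 3)                     ≡⟨ cong (λ e → N * w ^ suc e) (+-comm (7 + x) 3) ⟩
    N * w ^ (11 + x)                            ≤⟨ *-monoʳ-≤ N (^-monoʳ-≤ w (n≤1+n (11 + x))) ⟩
    N * w ^ (12 + x)                            ∎
    where
    open ≤-Reasoning
    4≤ : 4 ≤ w ^ 2
    4≤ = ^-monoˡ-≤ 2 2≤w
    4+w≤ : 4 + w ≤ w ^ 3
    4+w≤ = ≤-trans (+-mono-≤ 4≤ (≤-reflexive (sym (*-identityʳ w)))) (≤-trans (≤-trans (+-monoʳ-≤ (w ^ 2) (^-monoʳ-≤ w {1} {2} (s≤s z≤n)))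
      (≤-reflexive (cong (λ z → w ^ 2 + z) (sym (+-identityʳ (w ^ 2)))))) (*-monoˡ-≤ (w ^ 2) 2≤w))
    identity : ∀ w n a b → w * n * a + n * b ≡ n * (w * a + b)
    identity = solve-∀

  record AfterSetup (σ : Store) : Set where
    field
      ready : Ready n w F 1 w σ
      mem≡  : mem σ ≡ memory
      ans≡  : reg σ #ans ≡ 0
      c0≡   : reg σ #c0 ≡ 0

  record AfterG (σ : Store) : Set where
    field
      ready : Ready n w F 1 w σ
      memG  : MemG N (mem σ)
      ans≡  : reg σ #ans ≡ 0
      c0≤   : reg σ #c0 ≤ N

  record BeforeH (Mg : ℕ → ℕ) (σ : Store) : Set where
    field
      ready : Ready n w F (1 + n * n) (w + F) σ
      memG  : MemG N Mg
      baseH′ : Base (mem σ)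
      high  : ∀ a → Z ≤ a → mem σ a ≡ Mg a
      c₁    : ℕ
      gr    : Greedy H (B.slots (mem σ)) 1 c₁
      ans≡  : reg σ #ans ≡ 0
      c0≤   : reg σ #c0 ≤ N

  setup-after : ∀ σ → reg σ #n ≡ 0 → reg σ #ans ≡ 0 → reg σ #c0 ≡ 0 → mem σ ≡ memory → ∀ τ → τ ≡ ⟦ setup ⟧ σ → AfterSetup τ
  setup-after σ e ea ec em τ q = record
    { ready = subst (Ready n w F 1 w) (sym q) (setup-spec σ {k = k} pr n≡ e (cong (λ M → M 0) em) F≤w)
    ; mem≡ = trans (cong mem q) (trans (keepMem setup σ refl) em)
    ; ans≡ = trans (cong (λ τ → reg τ #ans) q) (trans (keep setup #ans σ refl) ea)
    ; c0≡ = trans (cong (λ τ → reg τ #c0) q) (trans (keep setup #c0 σ refl) ec) }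

  setup-time : ∀ σ → (∀ d → reg σ d ≡ 0) → mem σ ≡ memory → time setup σ ≤ w ^ (setupDegree + (5 + setupDegree))
  setup-time σ hz em = steps-time 2≤w setup σ (2 + w) setupDegree refl
    (bounded (λ d → ≤-trans (≤-reflexive (hz d)) z≤n) (λ a → ≤-trans (≤-reflexive (cong (λ M → M a) em)) (≤-trans (memory-≤ a) (≤-trans n≤w w≤))))
    2+w≤ (stage₁ (apply (load #n #n) σ) (trans (cong (mem σ) (hz #n)) (cong (λ M → M 0) em)))
    where
    stage₂ : ∀ τ → reg τ #n ≡ n → ∀ τ′ → τ′ ≡ ⟦ setWidth ⟧ τ → steps parameters τ′ ≤ w ^ degree parameters
    stage₂ τ en τ′ q = steps≤ capNW 2≤w parameters τ′ refl (caps-NW τ′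
      (≤-trans (≤-reflexive (trans (cong (λ τ → reg τ #n) q) (trans (keep setWidth #n τ refl) en))) n≤w)
      (≤-trans (≤-reflexive (trans (cong (λ τ → reg τ #one) q) (proj₂ (setWidth-spec τ en)))) 1≤w)
      (≤-reflexive (trans (cong (λ τ → reg τ #W) q) (proj₁ (setWidth-spec τ en)))))
    stage₁ : ∀ τ → reg τ #n ≡ n → 1 + (steps setWidth τ + steps parameters (⟦ setWidth ⟧ τ)) ≤ w ^ setupDegree
    stage₁ τ en = ≤-trans (+-monoʳ-≤ 1 (≤-trans (+-mono-≤ (steps≤ capN 2≤w setWidth τ refl (caps-N τ (≤-trans (≤-reflexive en) n≤w)))
        (stage₂ τ en (⟦ setWidth ⟧ τ) refl)) (pow-sum 2≤w (degree setWidth) (degree parameters))))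
      (pow-sum 2≤w 0 (suc (degree setWidth + degree parameters)))

  base₀ : Base memory
  base₀ = base (λ _ _ → refl) (λ j _ → subst (_< n) (sym (past (w + j) (m≤m+n w j))) 0<n)
    (λ i _ → subst (_< n) (sym (past (w + w + i) (≤-trans (m≤m+n w w) (m≤m+n (w + w) i)))) 0<n)
    where
    past : ∀ a → w ≤ a → memory a ≡ 0
    past a p = memory-past a (≤-trans tables≤w p)

  memG₀ : MemG 0 memory
  memG₀ = record { baseOf = base₀ ; pos = val-zero n memory w F (λ i _ → past (w + i) (m≤m+n w i))
    ; bit = λ a → ≤-trans (≤-reflexive (high a)) z≤n ; sound = λ a h → contradiction (high a) h ; done = λ _ () }
    where
    past : ∀ a → w ≤ a → memory a ≡ 0
    past a p = memory-past a (≤-trans tables≤w p)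
    high : ∀ a → memory (Z + a) ≡ 0
    high a = past (Z + a) (≤-trans (≤-trans (m≤m+n w w) (m≤m+n (w + w) w)) (m≤m+n Z a))

  GInv : ℕ → Store → Set
  GInv j τ = MemG j (mem τ) × Clear τ × reg τ #c0 ≤ N

  module _ (σ : Store) (s : AfterSetup σ) where
    open AfterSetup s

    g-const : ∀ σ′ → Frame gPhase σ σ′ → Const n w F 1 w σ′
    g-const σ′ fr = const-frame gPhase σ σ′ refl fr (proj₁ ready)

    g-init : GInv 0 (init #c0 #N #N σ)
    g-init = subst (MemG 0) (sym mem≡) memG₀ , proj₂ ready , ≤-reflexive (trans (trips #c0 #N #N σ refl ≤-refl) (kN (proj₁ ready)))

    g-step : ∀ j k σ′ → j < N → k < N → Frame gPhase σ σ′ → GInv j σ′ → GInv (suc j) (⟦ gTry ⟧ (tick #c0 k σ′))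
    g-step j k σ′ _ k<N fr (mg , _ , _) = go (A.gTry-spec (tick #c0 k σ′) (const-tick k σ′ (g-const σ′ fr)) (inputG (MemG.baseOf mg)))
      where
      go : A.Q₁ (mem σ′) (⟦ gTry ⟧ (tick #c0 k σ′)) → GInv (suc j) (⟦ gTry ⟧ (tick #c0 k σ′))
      go (t , c) = g-advance mg t , c , ≤-trans (≤-reflexive (keep gTry #c0 (tick #c0 k σ′) refl)) (<⇒≤ k<N)

    g-count : reg (init #c0 #N #N σ) #c0 ≡ N
    g-count = trans (trips #c0 #N #N σ refl ≤-refl) (kN (proj₁ ready))

    g-after : ∀ τ → τ ≡ ⟦ gPhase ⟧ σ → Frame gPhase σ τ → AfterG τ
    g-after τ q fr = go (subst (GInv N) (sym q) (loop-rule #c0 #N #N gTry σ GInv N g-count g-init g-step))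
      where
      go : GInv N τ → AfterG τ
      go (mg , c , h) = record { ready = g-const τ fr , c ; memG = mg ; ans≡ = trans (fr #ans refl) ans≡ ; c0≤ = h }

    g-bounded : ∀ j σ′ → Frame gPhase σ σ′ → GInv j σ′ → Bounded (2 + w) σ′
    g-bounded j σ′ fr (mg , (cd , cz) , h) = state-bounded σ′ 1≤w (m≤m+n w w) (g-const σ′ fr) (≤-trans (≤-reflexive cd) z≤n) cz
      (≤-trans (≤-reflexive (trans (fr #ans refl) ans≡)) z≤n) h (base-≤ (MemG.baseOf mg) (MemG.bit mg))

    g-body : ∀ j k σ′ → k < N → Frame gPhase σ σ′ → GInv j σ′ → time gTry (tick #c0 k σ′) ≤ w ^ (chunkDegree gTry)
    g-body j k σ′ k<N fr (mg , (cd , cz) , h) = chunk gTry (tick #c0 k σ′) refl refl (const-tick k σ′ (g-const σ′ fr))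
      (state-bounded (tick #c0 k σ′) 1≤w (m≤m+n w w) (const-tick k σ′ (g-const σ′ fr)) ≤-refl cz
        (≤-trans (≤-reflexive (trans (fr #ans refl) ans≡)) z≤n) (<⇒≤ k<N) (base-≤ (MemG.baseOf mg) (MemG.bit mg)))

    g-start : Bounded (2 + w) σ
    g-start = state-bounded σ 1≤w (m≤m+n w w) (proj₁ ready) (≤-trans (≤-reflexive (proj₁ (proj₂ ready))) z≤n) (proj₂ (proj₂ ready))
      (≤-trans (≤-reflexive ans≡) z≤n) (≤-trans (≤-reflexive c0≡) z≤n)
      (subst (λ M → ∀ a → M a ≤ 2 ^ (2 + w)) (sym mem≡) (base-≤ base₀ (MemG.bit memG₀)))

    g-time : time gPhase σ ≤ N * w ^ loopDegree gTry
    g-time = ≤-trans (loop-time #c0 #N #N gTry σ GInv N (2 + w) _ g-count g-start g-init g-step g-bounded g-body)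
      (loop-cost (chunkDegree gTry))

  module _ (σ : Store) (s : AfterG σ) where
    open AfterG s

    private
      Mg = mem σ
      inp = inputH (MemG.baseOf memG)
      1+n≤w : 1 + n ≤ w
      1+n≤w = ≤-trans (+-monoˡ-≤ n 0<n) 2n≤w
      Q : Store → Set
      Q = BeforeH Mg

    hReset-spec : ∀ τ → Const n w F (1 + n * n) (w + F) τ → reg τ #ans ≡ 0 → reg τ #c0 ≤ N →
      (∃[ c₁ ] Greedy H (B.slots (mem τ)) 1 c₁ × B.Scratch Mg (mem τ) × (∀ j → j < 1 → mem τ (w + j) ≡ Mg (w + j))) → Q (⟦ reset ⟧ τ)
    hReset-spec τ c ea e0 (c₁ , gr , sc , _) = go (⟦ reset ⟧ τ) (λ e → keep reset e τ) (keepMem reset τ refl) (reset-spec τ)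
      where
      go : ∀ τ′ → Frame reset τ τ′ → mem τ′ ≡ mem τ → Clear τ′ → Q τ′
      go τ′ fr em cl = record
        { ready = const-frame reset τ τ′ refl fr c , cl ; memG = memG
        ; baseH′ = subst Base (sym em) (baseH (MemG.baseOf memG) sc)
        ; high = λ a p → trans (cong (λ M → M a) em) (B.Scratch.high′ sc a p)
        ; c₁ = c₁ ; gr = subst (λ M → Greedy H (B.slots M) 1 c₁) (sym em) gr
        ; ans≡ = trans (fr #ans refl) ea ; c0≤ = ≤-trans (≤-reflexive (fr #c0 refl)) e0 }

    hSetup-spec : Q (⟦ hSetup ⟧ σ)
    hSetup-spec =
      seq hSetup hBase (greedy ⨾ reset) refl Q σ λ σ₁ fr₁ m₁ q₁ →
      seq (greedy ⨾ reset) greedy reset refl Q σ₁ λ σ₂ fr₂ m₂ q₂ →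
      hReset-spec σ₂ (const-frame greedy σ₁ σ₂ refl fr₂ (proj₁ (based σ₁ q₁))) (trans (fr₂ #ans refl) (trans (fr₁ #ans refl) ans≡))
        (≤-trans (≤-reflexive (trans (fr₂ #c0 refl) (fr₁ #c0 refl))) c0≤)
        (subst (λ τ → ∃[ c₁ ] Greedy H (B.slots (mem τ)) 1 c₁ × B.Scratch Mg (mem τ) × (∀ j → j < 1 → mem τ (w + j) ≡ Mg (w + j))) (sym q₂)
          (B.greedy-spec (s≤s z≤n) 1+n≤w inp σ₁ (const-env σ₁ (proj₁ (based σ₁ q₁))) (m₁ refl) (proj₂ (based σ₁ q₁))))
      where
      based : ∀ τ → τ ≡ ⟦ hBase ⟧ σ → Const n w F (1 + n * n) (w + F) τ × reg τ #cur ≡ 1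
      based τ q = subst (λ τ → Const n w F (1 + n * n) (w + F) τ × reg τ #cur ≡ 1) (sym q) (hBase-spec σ (proj₁ ready))

    hSetup-time : time hSetup σ ≤ w ^ (chunkDegree hSetup)
    hSetup-time = chunk hSetup σ refl refl (proj₁ ready)
      (state-bounded σ 1≤w (m≤m+n w w) (proj₁ ready) (≤-trans (≤-reflexive (proj₁ (proj₂ ready))) z≤n) (proj₂ (proj₂ ready))
        (≤-trans (≤-reflexive ans≡) z≤n) c0≤ (base-≤ (MemG.baseOf memG) (MemG.bit memG)))

  module _ {Mg : ℕ → ℕ} (σ : Store) (s : BeforeH Mg σ) where
    open BeforeH s

    private
      Mh = mem σ
      a₀ = val n Mh (w + F) F
      b≤w : 1 + n * n ≤ w
      b≤w = ≤-trans (m≤m+n (1 + n * n) (n * n)) tables≤w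
      o≤ : w + F ≤ w + w
      o≤ = +-monoʳ-≤ w F≤w
      bits : ∀ a → Mh (Z + a) ≤ 1
      bits a = ≤-trans (≤-reflexive (high (Z + a) (m≤m+n Z a))) (MemG.bit memG a)

    a₀< : a₀ < N
    a₀< = val< n Mh (w + F) F (λ i p → subst (λ a → Mh a < n) (sym (+-assoc w F i)) (slotB baseH′ (F + i) (≤-trans (+-monoʳ-< F p) FF≤w)))
      where FF≤w = ≤-trans (+-mono-≤ F≤n F≤n) 2n≤w

    HInv : ℕ → Store → Set
    HInv j τ = MemH Mh a₀ j (mem τ) (reg τ #ans) × j ≤ N × Clear τ × reg τ #c0 ≤ N

    h-const : ∀ σ′ → Frame hPhase σ σ′ → Const n w F (1 + n * n) (w + F) σ′
    h-const σ′ fr = const-frame hPhase σ σ′ refl fr (proj₁ ready)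

    h-count : reg (init #c0 #N #N σ) #c0 ≡ N
    h-count = trans (trips #c0 #N #N σ refl ≤-refl) (kN (proj₁ ready))

    h-init : HInv 0 (init #c0 #N #N σ)
    h-init = record { baseOf = baseH′ ; high = λ _ _ → refl ; fixed = λ _ _ → refl ; pos = refl ; v≤ = ≤-reflexive ans≡
      ; sound = λ h → contradiction ans≡ h ; done = λ _ () } , z≤n , proj₂ ready , ≤-reflexive h-count

    h-step : ∀ j k σ′ → j < N → k < N → Frame hPhase σ σ′ → HInv j σ′ → HInv (suc j) (⟦ hTry ⟧ (tick #c0 k σ′))
    h-step j k σ′ j<N k<N fr (mh , _) = go (B.hTry-spec (tick #c0 k σ′) (const-tick k σ′ (h-const σ′ fr)) (inputH (MemH.baseOf mh)))
      where
      go : B.Q₂ (mem σ′) (reg σ′ #ans) (⟦ hTry ⟧ (tick #c0 k σ′)) → HInv (suc j) (⟦ hTry ⟧ (tick #c0 k σ′))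
      go (t , c) = h-advance bits mh t , j<N , c , ≤-trans (≤-reflexive (keep hTry #c0 (tick #c0 k σ′) refl)) (<⇒≤ k<N)

    h-memory : ∀ j σ′ → HInv j σ′ → ∀ a → mem σ′ a ≤ 2 ^ (2 + w)
    h-memory j σ′ (mh , _) = base-≤ (MemH.baseOf mh) (λ a → ≤-trans (≤-reflexive (MemH.high mh (Z + a) (m≤m+n Z a))) (bits a))

    h-bounded : ∀ j σ′ → Frame hPhase σ σ′ → HInv j σ′ → Bounded (2 + w) σ′
    h-bounded j σ′ fr i@(mh , j≤N , (cd , cz) , h) = state-bounded σ′ b≤w o≤ (h-const σ′ fr) (≤-trans (≤-reflexive cd) z≤n) cz
      (≤-trans (MemH.v≤ mh) j≤N) h (h-memory j σ′ i)

    h-body : ∀ j k σ′ → k < N → Frame hPhase σ σ′ → HInv j σ′ → time hTry (tick #c0 k σ′) ≤ w ^ (chunkDegree hTry)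
    h-body j k σ′ k<N fr i@(mh , j≤N , (cd , cz) , h) = chunk hTry (tick #c0 k σ′) refl refl (const-tick k σ′ (h-const σ′ fr))
      (state-bounded (tick #c0 k σ′) b≤w o≤ (const-tick k σ′ (h-const σ′ fr)) ≤-refl cz (≤-trans (MemH.v≤ mh) j≤N) (<⇒≤ k<N) (h-memory j σ′ i))

    h-start : Bounded (2 + w) σ
    h-start = state-bounded σ b≤w o≤ (proj₁ ready) (≤-trans (≤-reflexive (proj₁ (proj₂ ready))) z≤n) (proj₂ (proj₂ ready))
      (≤-trans (≤-reflexive ans≡) z≤n) c0≤ (base-≤ baseH′ bits)

    h-time : time hPhase σ ≤ N * w ^ loopDegree hTry
    h-time = ≤-trans (loop-time #c0 #N #N hTry σ HInv N (2 + w) _ h-count h-start h-init h-step h-bounded h-body)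
      (loop-cost (chunkDegree hTry))

    h-after : (reg (⟦ hPhase ⟧ σ) #ans ≢ 0 → G ≅ H) × (G ≅ H → reg (⟦ hPhase ⟧ σ) #ans ≢ 0) × reg (⟦ hPhase ⟧ σ) #ans ≤ N
    h-after = go (⟦ hPhase ⟧ σ) (loop-rule #c0 #N #N hTry σ HInv N h-count h-init h-step)
      where
      go : ∀ τ → HInv N τ → (reg τ #ans ≢ 0 → G ≅ H) × (G ≅ H → reg τ #ans ≢ 0) × reg τ #ans ≤ N
      go τ (mh , _) = accepts⇒≅ , ≅⇒accepts , MemH.v≤ mh
        where open Verdict memG baseH′ high gr a₀< mh

  Correct : Store → Set
  Correct τ = (reg τ #ans ≢ 0 → G ≅ H) × (G ≅ H → reg τ #ans ≢ 0) × reg τ #ans ≤ N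

  Out : ℕ → Store → ℕ → Set
  Out e τ t = Correct τ × t ≤ N * w ^ e

  sum-cost : ∀ {a b} x y → a ≤ N * w ^ x → b ≤ N * w ^ y → a + b ≤ N * w ^ suc (x + y)
  sum-cost x y p q = ≤-trans (+-mono-≤ p q) (≤-trans (≤-reflexive (sym (*-distribˡ-+ N (w ^ x) (w ^ y)))) (*-monoʳ-≤ N (pow-sum 2≤w x y)))

  once : ∀ {a} x → a ≤ w ^ x → a ≤ N * w ^ x
  once x p = ≤-trans p (m≤n*m (w ^ x) N {{>-nonZero 0<N}})

  h-out : ∀ σ → AfterG σ → Out hDegree (⟦ hSetup ⨾ hPhase ⟧ σ) (time (hSetup ⨾ hPhase) σ)
  h-out σ s = seq-time (hSetup ⨾ hPhase) hSetup hPhase refl (Out hDegree) σ λ σ′ _ _ q →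
    go σ′ (subst (BeforeH (mem σ)) (sym q) (hSetup-spec σ s))
    where
    go : ∀ σ′ → BeforeH (mem σ) σ′ → Out hDegree (⟦ hPhase ⟧ σ′) (time hSetup σ + time hPhase σ′)
    go σ′ s′ = h-after σ′ s′ , sum-cost (chunkDegree hSetup) (loopDegree hTry) (once (chunkDegree hSetup) (hSetup-time σ s)) (h-time σ′ s′)

  g-out : ∀ σ → AfterSetup σ → Out gDegree (⟦ gPhase ⨾ hSetup ⨾ hPhase ⟧ σ) (time (gPhase ⨾ hSetup ⨾ hPhase) σ)
  g-out σ s = seq-time (gPhase ⨾ hSetup ⨾ hPhase) gPhase (hSetup ⨾ hPhase) refl (Out gDegree) σ λ σ′ fr _ q →
    go σ′ (h-out σ′ (g-after σ s σ′ q fr))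
    where
    go : ∀ σ′ → Out hDegree (⟦ hSetup ⨾ hPhase ⟧ σ′) (time (hSetup ⨾ hPhase) σ′) →
      Out gDegree (⟦ hSetup ⨾ hPhase ⟧ σ′) (time gPhase σ + time (hSetup ⨾ hPhase) σ′)
    go σ′ (c , t) = c , sum-cost (loopDegree gTry) hDegree (g-time σ s) t

  main-out : ∀ σ → (∀ d → reg σ d ≡ 0) → mem σ ≡ memory → Out mainDegree (⟦ main ⟧ σ) (time main σ)
  main-out σ hz em = seq-time main setup (gPhase ⨾ hSetup ⨾ hPhase) refl (Out mainDegree) σ λ σ′ _ _ q →
    go σ′ (g-out σ′ (setup-after σ (hz #n) (hz #ans) (hz #c0) em σ′ q))
    where
    go : ∀ σ′ → Out gDegree (⟦ gPhase ⨾ hSetup ⨾ hPhase ⟧ σ′) (time (gPhase ⨾ hSetup ⨾ hPhase) σ′) →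
      Out mainDegree (⟦ gPhase ⨾ hSetup ⨾ hPhase ⟧ σ′) (time setup σ + time (gPhase ⨾ hSetup ⨾ hPhase) σ′)
    go σ′ (c , t) = c , sum-cost (setupDegree + (5 + setupDegree)) gDegree (once (setupDegree + (5 + setupDegree)) (setup-time σ hz em)) t

  output-time : ∀ τ t e → Out e τ t → t + (size (reg τ #ans) + 1) ≤ N * w ^ suc (e + 3)
  output-time τ t e ((_ , _ , a≤N) , t≤) = sum-cost e 3 t≤ (once 3 (begin
    size (reg τ #ans) + 1  ≤⟨ +-monoˡ-≤ 1 (size≤ (2 + w) (≤-trans a≤N N≤)) ⟩
    3 + w + 1              ≡⟨ +-comm (3 + w) 1 ⟩
    2 + (2 + w)            ≤⟨ +-mono-≤ {2} (≤-trans 2≤w (m≤m*n w (w ^ 1) {{m^n≢0 w 1}})) 2+w≤ ⟩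
    w ^ 2 + w ^ 2          ≡⟨ cong (λ z → w ^ 2 + z) (+-identityʳ (w ^ 2)) ⟨
    2 * w ^ 2              ≤⟨ *-monoˡ-≤ (w ^ 2) 2≤w ⟩
    w ^ 3                  ∎))
    where open ≤-Reasoning

-- The machine, and the final exponents

open Whole main #ans using (machine; at; result; halts-deterministic)
open Execution machine using (HaltsFrom)

reflects-answer : ∀ {P : Set} a → (a ≢ 0 → P) → (P → a ≢ 0) → Reflects P (not (a ≡ᵇ 0))
reflects-answer zero    s c = ofⁿ (λ p → c p refl)
reflects-answer (suc a) s c = ofʸ (s λ ())

module _ {n p k : ℕ} (G H : GroupTable n) (pr : Prime p) (n≡ : n ≡ p ^ k) where
  private
    module 𝕄 = Machine {n} {p} {k} G H pr n≡

    Outcome : Store → Set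
    Outcome σ = ∃[ b ] ∃[ t ] HaltsFrom (at (Program.start machine) σ) b t × Reflects (G ≅ H) b ×
      t ≤ n ^ suc ⌈ k /2⌉ * width n ^ suc (mainDegree + 3)

    outcome : ∀ σ → (∀ d → reg σ d ≡ 0) → mem σ ≡ Tables.memory G H → Outcome σ
    outcome σ hz em = go (⟦ main ⟧ σ) (time main σ) (result refl σ) (𝕄.main-out σ hz em)
      where
      go : ∀ τ t → HaltsFrom (at (Program.start machine) σ) (not (reg τ #ans ≡ᵇ 0)) (t + (size (reg τ #ans) + 1)) → 𝕄.Out mainDegree τ t → Outcome σ
      go τ t h o@((s , c , _) , _) = _ , _ , h , reflects-answer (reg τ #ans) s c , 𝕄.output-time τ t mainDegree o

    initially : Outcome (const 0 ▪ Tables.memory G H)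
    initially = outcome (const 0 ▪ Tables.memory G H) (λ _ → refl) refl

  decides : ∃[ b ] ∃[ t ] Halts machine G H b t × Reflects (G ≅ H) b
  decides = go initially
    where
    go : Outcome (const 0 ▪ Tables.memory G H) → ∃[ b ] ∃[ t ] Halts machine G H b t × Reflects (G ≅ H) b
    go (b , t , h , r , _) = b , t , h , r

  halts-within : ∀ {b t} → Halts machine G H b t → t ≤ n ^ suc ⌈ k /2⌉ * width n ^ suc (mainDegree + 3)
  halts-within h = go initially
    where
    go : Outcome (const 0 ▪ Tables.memory G H) → _ ≤ n ^ suc ⌈ k /2⌉ * width n ^ suc (mainDegree + 3)
    go (b , t , h′ , _ , le) = ≤-trans (≤-reflexive (proj₂ (halts-deterministic h h′))) le

-- Origin of the constant: `width n ≤ n ^ 5` turns the polynomial factor into n ^ (5 E), and 2 F = 2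
-- ⌈k/2⌉ + 2 ≤ k + 3, rounded up to k + 4 so that the excess over k is twice a natural number.
square-bound : ∀ {n t} k E → 2 ≤ n → t ≤ n ^ suc ⌈ k /2⌉ * width n ^ E → t * t ≤ n ^ (k + 2 * (2 + 5 * E))
square-bound {n} {t} k E 2≤n h = begin
  t * t                                          ≤⟨ *-mono-≤ t≤ t≤ ⟩
  n ^ (F + 5 * E) * n ^ (F + 5 * E)              ≡⟨ ^-distribˡ-+-* n (F + 5 * E) (F + 5 * E) ⟨
  n ^ ((F + 5 * E) + (F + 5 * E))                ≤⟨ ^-monoʳ-≤ n exponents ⟩
  n ^ (k + 2 * (2 + 5 * E))                      ∎
  where
  open ≤-Reasoning
  instance
    n≢0 : NonZero n
    n≢0 = >-nonZero (≤-trans (s≤s z≤n) 2≤n)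
  F = suc ⌈ k /2⌉
  t≤ : t ≤ n ^ (F + 5 * E)
  t≤ = ≤-trans h (≤-trans (*-monoʳ-≤ (n ^ F) (^-monoˡ-≤ E (width-power 2≤n)))
    (≤-reflexive (trans (cong (n ^ F *_) (^-*-assoc n 5 E)) (sym (^-distribˡ-+-* n F (5 * E))))))
  double-half : ⌈ k /2⌉ + ⌈ k /2⌉ ≤ suc k
  double-half = ≤-trans (+-monoʳ-≤ ⌈ k /2⌉ (⌊n/2⌋≤⌈n/2⌉ (suc k))) (≤-reflexive (⌊n/2⌋+⌈n/2⌉≡n (suc k)))
  exponents : (F + 5 * E) + (F + 5 * E) ≤ k + 2 * (2 + 5 * E)
  exponents = begin
    (F + 5 * E) + (F + 5 * E)                      ≡⟨ identity ⌈ k /2⌉ (5 * E) ⟩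
    (⌈ k /2⌉ + ⌈ k /2⌉) + (2 + 2 * (5 * E))        ≤⟨ +-monoˡ-≤ _ double-half ⟩
    suc k + (2 + 2 * (5 * E))                      ≤⟨ n≤1+n _ ⟩
    suc (suc k + (2 + 2 * (5 * E)))                ≡⟨ identity₂ k (5 * E) ⟩
    k + 2 * (2 + 5 * E)                            ∎
    where
    identity : ∀ c e → (suc c + e) + (suc c + e) ≡ (c + c) + (2 + 2 * e)
    identity = solve-∀
    identity₂ : ∀ k e → suc (suc k + (2 + 2 * e)) ≡ k + 2 * (2 + e)
    identity₂ = solve-∀

-- E is a variable here because the actual exponent is a large numeral.
bounds : ∀ E → (∀ {n p k} (G H : GroupTable n) → Prime p → n ≡ p ^ k → ∀ {b t} → Halts machine G H b t → t ≤ n ^ suc ⌈ k /2⌉ * width n ^ E) →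
  (∃[ C ] ∃[ D ] RunsInTime machine 2 (λ p n →
           min (½ ⊗ log p (fromℕ n) ⊕ fromℕ C ⊗ fromℕ p)
               (log p (fromℕ n) ⊕ fromℕ D)))
      × (∃[ C ] RunsInTime machine 3 (λ p n →
           ½ ⊗ log p (fromℕ n) ⊕ fromℕ C ⊗ (log 2 (fromℕ n) ⊘ log 2 (log 2 (fromℕ n)))))
      × (∃[ C ] RunsInTime machine 2 (λ p n →
           ½ ⊗ log 2 (fromℕ n) ⊕ fromℕ C))
bounds E within =
    (C , C , λ { p _ pr (k , refl) 2≤n G H b t h → bound-min {t} {p} {k} {C} (1<p pr) (square k 2≤n pr G H h) })
  , (2 * C , λ { p _ pr (k , refl) 3≤n G H b t h → bound-loglog {t} {p} {k} {C} (1<p pr) (square k (<⇒≤ 3≤n) pr G H h) (<⇒≤ 3≤n) })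
  , (C , λ { p _ pr (k , refl) 2≤n G H b t h → bound-log {t} {p} {k} {C} (1<p pr) (square k 2≤n pr G H h) })
  where
  C = 2 + 5 * E
  1<p : ∀ {p} → Prime p → 1 < p
  1<p {p} pr = nonTrivial⇒n>1 p {{prime⇒nonTrivial pr}}
  square : ∀ {p} k → 2 ≤ p ^ k → Prime p → (G H : GroupTable (p ^ k)) → ∀ {b t} → Halts machine G H b t →
    t * t ≤ (p ^ k) ^ (k + 2 * C)
  square k 2≤n pr G H h = square-bound k E 2≤n (within {k = k} G H pr refl h)

theorem1p1 :
    ∃[ A ] DecidesPGroupIso A
      × (∃[ C ] ∃[ D ] RunsInTime A 2 (λ p n →
           min (½ ⊗ log p (fromℕ n) ⊕ fromℕ C ⊗ fromℕ p)
               (log p (fromℕ n) ⊕ fromℕ D)))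
      × (∃[ C ] RunsInTime A 3 (λ p n →
           ½ ⊗ log p (fromℕ n) ⊕ fromℕ C ⊗ (log 2 (fromℕ n) ⊘ log 2 (log 2 (fromℕ n)))))
      × (∃[ C ] RunsInTime A 2 (λ p n →
           ½ ⊗ log 2 (fromℕ n) ⊕ fromℕ C))
theorem1p1 = machine , (λ { p n pr (k , n≡) G H → decides {k = k} G H pr n≡ }) ,
  bounds (suc (mainDegree + 3)) (λ {n} {p} {k} G H pr n≡ h → halts-within {k = k} G H pr n≡ h)
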